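{- Let $G=(V,E)$ be an oriented 3-edge-connected graph with $\ell=|E|-|V|\ge 11$ and let $f:E\to\mathbb{Z}_6$. Then there exist at least $2^{\sqrt{\ell}/\log\ell}$ flows $\phi:E\to\mathbb{Z}_6$ with the property that $\phi(e)\neq f(e)$ for every $e\in E$. Here $\log$ denotes the logarithm to base $2$.
   Context: Graphs are finite and may have loops and parallel edges. A graph is $k$-edge-connected if it has at least two vertices and remains connected after deleting any set of fewer than $k$ edges (for oriented graphs this refers to the underlying undirected graph). For an oriented graph $G=(V,E)$ and $v\in V$, $\delta^+(v)$ is the set of edges with initial vertex $v$ and $\delta^-(v)$ the set of edges with terminal vertex $v$ (a loop at $v$ belongs to both). For an additive abelian group $\Gamma$, a flow is a function $\phi:E\to\Gamma$ with $\sum_{e\in\delta^+(v)}\phi(e)=\sum_{e\in\delta^-(v)}\phi(e)$ for every $v\in V$. -}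

module Defs where

open import Algebra.Bundles using (AbelianGroup)
open import Data.Fin using (Fin; zero; toℕ)
open import Data.Fin.Properties using (_≟_; all?)
import Data.Fin.Subset as Subset
open import Data.Fin.Subset using (Subset)
open import Data.List using (List; allFin; filter; foldr; map)
open import Data.Nat using (ℕ; _+_; _∸_; _*_; _^_; _≤_; _<_; NonZero)
open import Data.Nat.DivMod using (_mod_)
open import Data.Nat.Properties using (m*n≢0)
open import Data.Product using (_×_; _,_; Σ-syntax; ∃-syntax)
open import Data.Sum using (_⊎_)
open import Function.Definitions using (Injective)
open import Level using (0ℓ)
open import Relation.Binary.Construct.Closure.Equivalence using (EqClosure)
open import Relation.Binary.PropositionalEquality
  using (_≡_; _≗_; cong; cong₂; isEquivalence)
open import Relation.Nullary.Decidable using (from-yes)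

------------------------------------------------------------------------
-- Oriented graphs, loops and parallel edges allowed

record OrientedGraph : Set where
  field
    #V #E    : ℕ
    initial  : Fin #E → Fin #V
    terminal : Fin #E → Fin #V

  V E : Set
  V = Fin #V
  E = Fin #E

  δ⁺ δ⁻ : V → List E
  δ⁺ v = filter (λ e → initial e ≟ v) (allFin #E)
  δ⁻ v = filter (λ e → terminal e ≟ v) (allFin #E)

  JoinedWithout : Subset #E → V → V → Set
  JoinedWithout S u v =
    ∃[ e ] (e Subset.∉ S × initial e ≡ u × terminal e ≡ v)

  -- The equivalence closure lets walks traverse edges in either direction,
  -- so this is connectedness of the underlying undirected graph minus S.
  ConnectedWithout : Subset #E → Set
  ConnectedWithout S = ∀ u v → EqClosure (JoinedWithout S) u v

  EdgeConnected : ℕ → Set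
  EdgeConnected k =
    2 ≤ #V × (∀ (S : Subset #E) → Subset.∣ S ∣ < k → ConnectedWithout S)

------------------------------------------------------------------------
-- Flows

module _ {c ℓ} (Γ : AbelianGroup c ℓ) (G : OrientedGraph) where
  open AbelianGroup Γ
  open OrientedGraph G

  sumOver : List E → (E → Carrier) → Carrier
  sumOver es φ = foldr _∙_ ε (map φ es)

  IsFlow : (E → Carrier) → Set ℓ
  IsFlow φ = ∀ v → sumOver (δ⁺ v) φ ≈ sumOver (δ⁻ v) φ

------------------------------------------------------------------------
-- The cyclic group of order 6, on the residues 0, …, 5

infixl 6 _+₆_

_+₆_ : Fin 6 → Fin 6 → Fin 6
a +₆ b = (toℕ a + toℕ b) mod 6

-₆_ : Fin 6 → Fin 6
-₆ a = (6 ∸ toℕ a) mod 6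

ℤ₆ : AbelianGroup 0ℓ 0ℓ
ℤ₆ = record
  { Carrier = Fin 6
  ; _≈_     = _≡_
  ; _∙_     = _+₆_
  ; ε       = zero
  ; _⁻¹     = -₆_
  ; isAbelianGroup = record
    { isGroup = record
      { isMonoid = record
        { isSemigroup = record
          { isMagma = record
            { isEquivalence = isEquivalence
            ; ∙-cong        = cong₂ _+₆_
            }
          ; assoc = from-yes (all? λ a → all? λ b → all? λ c →
                      (a +₆ b) +₆ c ≟ a +₆ (b +₆ c))
          }
        ; identity = from-yes (all? λ a → zero +₆ a ≟ a)
                   , from-yes (all? λ a → a +₆ zero ≟ a)
        }
      ; inverse = from-yes (all? λ a → (-₆ a) +₆ a ≟ zero)
                , from-yes (all? λ a → a +₆ (-₆ a) ≟ zero)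
      ; ⁻¹-cong = cong -₆_
      }
    ; comm = from-yes (all? λ a → all? λ b → a +₆ b ≟ b +₆ a)
    }
  }

------------------------------------------------------------------------
-- Nonnegative reals

-- Nonnegative rationals, as fractions that need not be in lowest terms.
infix 8 _/_

record ℚ≥0 : Set where
  constructor _/_
  field
    num : ℕ
    den : ℕ
    .{{den≢0}} : NonZero den

infixl 7 _·_

_·_ : ℚ≥0 → ℚ≥0 → ℚ≥0
(a / b) · (c / d) = _/_ (a * c) (b * d) {{m*n≢0 b d}}

-- A nonnegative real x is presented by its Dedekind cut: the nonnegative
-- rationals r with r < x (Below) and those with x < r (Above).  Only the two
-- predicates are recorded; each real below spells out its own cut.
record ℝ≥0 : Set₁ where
  field
    Below : ℚ≥0 → Set
    Above : ℚ≥0 → Set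

open ℝ≥0

fromℕ : ℕ → ℝ≥0
fromℕ n .Below (a / b) = a < n * b
fromℕ n .Above (a / b) = n * b < a

-- a / b < √n  iff  a² < n b².
√_ : ℕ → ℝ≥0
(√ n) .Below (a / b) = a ^ 2 < n * b ^ 2
(√ n) .Above (a / b) = n * b ^ 2 < a ^ 2

-- Logarithm to base 2, for n ≥ 1:  a / b < log₂ n  iff  2^a < n^b.
log₂ : ℕ → ℝ≥0
log₂ n .Below (a / b) = 2 ^ a < n ^ b
log₂ n .Above (a / b) = n ^ b < 2 ^ a

-- Quotient, for y > 0:  r < x / y  iff  r s < x for some rational s > y.
infixl 7 _÷_

_÷_ : ℝ≥0 → ℝ≥0 → ℝ≥0
(x ÷ y) .Below r = ∃[ s ] (Above y s × Below x (r · s))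
(x ÷ y) .Above r = ∃[ s ] (Below y s × Above x (r · s))

-- 2^x is the supremum of 2^s over rational s < x and the infimum over rational
-- s > x; for s = c / d,  a / b < 2^s  iff  a^d < 2^c b^d.  The disjunct a < b
-- covers x = 0, below which there is no nonnegative rational.
2^_ : ℝ≥0 → ℝ≥0
(2^ x) .Below (a / b) =
  a < b ⊎ (∃[ s ] (Below x s × a ^ ℚ≥0.den s < 2 ^ ℚ≥0.num s * b ^ ℚ≥0.den s))
(2^ x) .Above (a / b) =
  ∃[ s ] (Above x s × 2 ^ ℚ≥0.num s * b ^ ℚ≥0.den s < a ^ ℚ≥0.den s)

infix 4 _≤ᵣ_

_≤ᵣ_ : ℝ≥0 → ℝ≥0 → Set
x ≤ᵣ y = ∀ r → Below x r → Below y r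

------------------------------------------------------------------------
-- Counting

-- At least x functions A → B satisfy P; functions are counted up to pointwise
-- equality.
AtLeast : ∀ {A B : Set} → ℝ≥0 → ((A → B) → Set) → Set
AtLeast {A} {B} x P =
  ∃[ N ] (x ≤ᵣ fromℕ N ×
          (Σ[ Φ ∈ (Fin N → A → B) ] (Injective _≡_ _≗_ Φ × (∀ i → P (Φ i)))))

{-# OPTIONS --safe #-}
-- After subtracting f, we count the nowhere-zero k : E → ℤ₆ with a prescribed
-- boundary b.  Splitting vertices preserves 3-edge-connectivity and ℓ, so the
-- graph may be taken to be cubic.  A map h : E → ℤ₃ with boundary b mod 3 is the
-- ℤ₃-part of such a k as soon as the edges with h ≠ 0 (the live ones) connect
-- the graph: the ℤ₂-part can be prescribed where h = 0 and corrected along live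
-- edges.  Live edges that are not needed for connectedness yield a factor 2 each.
--
-- The vertex set is decomposed into a first vertex, paths, and a last vertex r,
-- such that every vertex of a path has an edge to a later part and the ends of
-- the path have edges g and e′ to earlier parts.  Treating the parts from the
-- last to the first, the continuations of h along a path are indexed by ℤ₃, and
-- each edge of the path vanishes for exactly one of them.  Avoiding the zeros of
-- g and e′ keeps the treated part connected, so there is always a continuation.
--
-- There are two sources of further choices.  Let λ be the number of paths that
-- consist of a single vertex.
-- (1) One edge may be dead at any time: when the path containing its far end is
-- reached, that end can be reattached, or else both g and e′ can take over the
-- role of the dead edge.  This yields 2^P maps h, where the number of the
-- other paths is at most (4 + 2 λ) P.
-- (2) For an interior vertex v of a path, the edge to the later part may be dead
-- if b v ≢ 0 (mod 3), because a path edge at v is live then; if b v ≡ 0, a path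
-- edge at v is live and not needed.  Since the graph is cubic, λ is at most the
-- number of interior vertices, and about λ / 4 binary choices result.
-- Together, ℓ ≤ 9 M² for some M such that there are 2^M solutions.
module Submission where

open import Defs
open import Algebra.Bundles using (AbelianGroup; CommutativeMonoid)
open import Algebra.Morphism.Structures using (IsGroupHomomorphism)
import Algebra.Properties.AbelianGroup as AbelianGroupProperties
import Algebra.Properties.CommutativeMonoid.Sum as CommutativeMonoidSum
open import Data.Bool using (Bool; true; false; if_then_else_; not; _∧_; _∨_; _xor_)
import Data.Bool.Properties as Boolₚ
open import Data.Empty using (⊥; ⊥-elim)
open import Data.Fin as Fin using (Fin; zero; suc; toℕ; splitAt; inject≤)
open import Data.Fin.Patterns using (0F; 1F; 2F)
open import Data.Fin.Properties
  using (_≟_; any?; all?; 0≢1+n; suc-injective; join-splitAt; inject≤-injective)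
import Data.Fin.Subset as Subset
open import Data.Fin.Subset using (Subset)
open import Data.Fin.Subset.Properties using (anySubset?)
open import Data.List as List using (List; []; _∷_; _++_; filter; foldr; length; map)
open import Data.List.Membership.Propositional using (_∈_; _∉_)
open import Data.List.Membership.Propositional.Properties using (∈-++⁻)
open import Data.List.Properties using (length-++; length-map)
open import Data.List.Relation.Unary.All as All using (All; []; _∷_)
import Data.List.Relation.Unary.All.Properties as Allₚ
open import Data.List.Relation.Unary.AllPairs using ([]; _∷_)
open import Data.List.Relation.Unary.Any using (here; there)
open import Data.List.Relation.Unary.Unique.Propositional using (Unique)
import Data.List.Relation.Unary.Unique.Propositional.Properties as Uniqueₚ
open import Data.Nat
  using (ℕ; zero; suc; _+_; _*_; _∸_; _^_; _≤_; _<_; z≤n; s≤s; _≤?_)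
open import Data.Nat.DivMod using (_mod_)
open import Data.Nat.Properties hiding (_≟_; 0≢1+n; suc-injective)
import Data.Nat.Properties as ℕₚ
open import Data.Nat.Solver using (module +-*-Solver)
open import Data.Product using (Σ-syntax; ∃-syntax; _×_; _,_; proj₁; proj₂)
open import Data.Sum using (_⊎_; inj₁; inj₂; [_,_]′)
open import Data.Vec using (tabulate; lookup)
open import Data.Vec.Properties using (lookup∘tabulate; lookup⇒[]=)
open import Function using (_∘_; id)
open import Function.Definitions using (Injective)
open import Level using (0ℓ)
open import Relation.Binary.Construct.Closure.Equivalence as EqC using (EqClosure)
open import Relation.Binary.Construct.Closure.ReflexiveTransitive using (ε; _◅_; _◅◅_)
open import Relation.Binary.Construct.Closure.Symmetric using (SymClosure; fwd; bwd)
open import Relation.Binary.Definitions using (tri<; tri≈; tri>)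
open import Relation.Binary.PropositionalEquality
  using (_≡_; _≢_; _≗_; refl; sym; trans; cong; cong₂; subst; isEquivalence; module ≡-Reasoning)
import Relation.Binary.Reasoning.Setoid as SetoidReasoning
open import Relation.Nullary using (¬_; Dec; yes; no; does)
open import Relation.Nullary.Decidable using (_×-dec_; _→-dec_; ¬?; from-yes)

-- Boundaries

-- Source (1) alone is not enough because of the paths with a single vertex. If the dead edge ends
-- at such a vertex, there is no neighbour on the path to repair the damage: the vertex may become a
-- second component of the treated part, and only one continuation is guaranteed. Its edges
-- therefore get weight 0, which can cost 2 P of the potential. Source (2) is strong precisely when
-- this happens often. With N the larger of the two exponents, the number of single vertices is at
-- most linear in N, and the number of other paths is at most N times a linear function of the
-- number of single vertices. So ℓ is at most quadratic in N; this is where the square root comes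
-- from. One more factor 2 comes from the last vertex, where two values at one of its edges can be
-- used. The logarithm serves only to absorb a constant: log ℓ is at least 3, which cancels the 3 in
-- √ℓ ≤ 3 M.

module Sums (M : CommutativeMonoid 0ℓ 0ℓ) where
  open CommutativeMonoid M renaming (refl to ≈-refl; sym to ≈-sym; trans to ≈-trans; ε to 0#)
  open CommutativeMonoidSum M public
    using (sum; sum-cong-≋; ∑-distrib-+; ∑-comm; sum-replicate-zero)

  pick : Bool → Carrier → Carrier
  pick b a = if b then a else 0#

  pick-0 : ∀ b → pick b 0# ≈ 0#
  pick-0 true  = ≈-refl
  pick-0 false = ≈-refl

  pick-∙ : ∀ b x y → pick b (x ∙ y) ≈ pick b x ∙ pick b y
  pick-∙ true  x y = ≈-refl
  pick-∙ false x y = ≈-sym (identityˡ 0#)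

  sum-zero : ∀ {n} (f : Fin n → Carrier) → (∀ i → f i ≈ 0#) → sum f ≈ 0#
  sum-zero {n} f p = ≈-trans (sum-cong-≋ p) (sum-replicate-zero n)

  sum-single : ∀ {n} (j : Fin n) (f : Fin n → Carrier) →
               sum (λ i → pick (does (i ≟ j)) (f i)) ≈ f j
  sum-single {suc n} zero f = ≈-trans (∙-cong ≈-refl (sum-zero {n} (λ _ → 0#) λ _ → ≈-refl)) (identityʳ _)
  sum-single (suc j) f = ≈-trans (identityˡ _) (sum-single j (f ∘ suc))

module Links (G : OrientedGraph) where
  open OrientedGraph G

  At : E → V → Set
  At e v = initial e ≡ v ⊎ terminal e ≡ v

  data Link (u : V) (e : E) (v : V) : Set where
    along   : initial e ≡ u → terminal e ≡ v → Link u e v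
    against : initial e ≡ v → terminal e ≡ u → Link u e v

  link-sym : ∀ {u e v} → Link u e v → Link v e u
  link-sym (along p q)   = against p q
  link-sym (against p q) = along p q

  link-atˡ : ∀ {u e v} → Link u e v → At e u
  link-atˡ (along p q)   = inj₁ p
  link-atˡ (against p q) = inj₂ q

  link-atʳ : ∀ {u e v} → Link u e v → At e v
  link-atʳ l = link-atˡ (link-sym l)

  at-link : ∀ {e u v w} → Link u e v → At e w → w ≡ u ⊎ w ≡ v
  at-link (along refl refl)   (inj₁ refl) = inj₁ refl
  at-link (along refl refl)   (inj₂ refl) = inj₂ refl
  at-link (against refl refl) (inj₁ refl) = inj₂ refl
  at-link (against refl refl) (inj₂ refl) = inj₁ refl

  at-other : ∀ {e u} → At e u → ∃[ v ] Link u e v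
  at-other (inj₁ p) = _ , along p refl
  at-other (inj₂ p) = _ , against refl p

module Boundary (Γ : AbelianGroup 0ℓ 0ℓ) (G : OrientedGraph) where
  open AbelianGroup Γ
    renaming (refl to ≈-refl; sym to ≈-sym; trans to ≈-trans; ε to 0#)
  open AbelianGroupProperties Γ
  open OrientedGraph G
  open Links G
  open Sums commutativeMonoid public
  open SetoidReasoning setoid

  out into : (E → Carrier) → V → E → Carrier
  out  φ v e = pick (does (initial e ≟ v)) (φ e)
  into φ v e = pick (does (terminal e ≟ v)) (φ e)

  bd : (E → Carrier) → V → Carrier
  bd φ v = sum (λ e → out φ v e - into φ v e)

  single : E → Carrier → E → Carrier
  single g a e = pick (does (e ≟ g)) a

  -‿∙-comm : ∀ a b c d → (a ∙ b) - (c ∙ d) ≈ (a - c) ∙ (b - d)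
  -‿∙-comm a b c d = begin
    (a ∙ b) ∙ (c ∙ d) ⁻¹       ≈⟨ ∙-congˡ (⁻¹-∙-comm c d) ⟨
    (a ∙ b) ∙ (c ⁻¹ ∙ d ⁻¹)    ≈⟨ assoc _ _ _ ⟩
    a ∙ (b ∙ (c ⁻¹ ∙ d ⁻¹))    ≈⟨ ∙-congˡ (assoc _ _ _) ⟨
    a ∙ ((b ∙ c ⁻¹) ∙ d ⁻¹)    ≈⟨ ∙-congˡ (∙-congʳ (comm _ _)) ⟩
    a ∙ ((c ⁻¹ ∙ b) ∙ d ⁻¹)    ≈⟨ ∙-congˡ (assoc _ _ _) ⟩
    a ∙ (c ⁻¹ ∙ (b ∙ d ⁻¹))    ≈⟨ assoc _ _ _ ⟨
    (a - c) ∙ (b - d)          ∎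

  bd-local : ∀ {φ ψ v} → (∀ e → At e v → φ e ≈ ψ e) → bd φ v ≈ bd ψ v
  bd-local {φ} {ψ} {v} p = sum-cong-≋ λ e → ∙-cong (o e) (⁻¹-cong (i e))
    where
    o : ∀ e → out φ v e ≈ out ψ v e
    o e with initial e ≟ v
    ... | yes q = p e (inj₁ q)
    ... | no  q = ≈-refl
    i : ∀ e → into φ v e ≈ into ψ v e
    i e with terminal e ≟ v
    ... | yes q = p e (inj₂ q)
    ... | no  q = ≈-refl

  bd-cong : ∀ {φ ψ} v → (∀ e → φ e ≈ ψ e) → bd φ v ≈ bd ψ v
  bd-cong v p = bd-local λ e _ → p e

  bd-∙ : ∀ φ ψ v → bd (λ e → φ e ∙ ψ e) v ≈ bd φ v ∙ bd ψ v
  bd-∙ φ ψ v = ≈-trans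
    (sum-cong-≋ λ e → ≈-trans
      (∙-cong (pick-∙ (does (initial e ≟ v)) _ _)
              (⁻¹-cong (pick-∙ (does (terminal e ≟ v)) _ _)))
      (-‿∙-comm _ _ _ _))
    (∑-distrib-+ (λ e → out φ v e - into φ v e) (λ e → out ψ v e - into ψ v e))

  bd-single : ∀ g a v →
    bd (single g a) v ≈ pick (does (initial g ≟ v)) a - pick (does (terminal g ≟ v)) a
  bd-single g a v = ≈-trans (sum-cong-≋ swap)
    (sum-single g λ e → pick (does (initial e ≟ v)) a - pick (does (terminal e ≟ v)) a)
    where
    swap : ∀ e → out (single g a) v e - into (single g a) v e ≈
           pick (does (e ≟ g)) (pick (does (initial e ≟ v)) a - pick (does (terminal e ≟ v)) a)
    swap e with does (e ≟ g)
    ... | true  = ≈-refl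
    ... | false = ≈-trans (∙-cong (pick-0 (does (initial e ≟ v))) (⁻¹-cong (pick-0 (does (terminal e ≟ v)))))
                          (inverseʳ 0#)

  bd-0 : ∀ v → bd (λ _ → 0#) v ≈ 0#
  bd-0 v = sum-zero _ λ e → ≈-trans
    (∙-cong (pick-0 (does (initial e ≟ v))) (⁻¹-cong (pick-0 (does (terminal e ≟ v))))) (inverseʳ 0#)

  sum-⁻¹ : ∀ {n} (f : Fin n → Carrier) → sum (λ i → f i ⁻¹) ≈ sum f ⁻¹
  sum-⁻¹ f = ∙-cancelˡ (sum f) _ _ (begin
    sum f ∙ sum (λ i → f i ⁻¹)  ≈⟨ ∑-distrib-+ f (λ i → f i ⁻¹) ⟨
    sum (λ i → f i - f i)       ≈⟨ sum-zero _ (λ i → inverseʳ (f i)) ⟩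
    0#                          ≈⟨ inverseʳ _ ⟨
    sum f - sum f               ∎)

  pick-sym : ∀ {n} (i j : Fin n) a → pick (does (i ≟ j)) a ≈ pick (does (j ≟ i)) a
  pick-sym i j a with i ≟ j | j ≟ i
  ... | yes _ | yes _ = ≈-refl
  ... | no  _ | no  _ = ≈-refl
  ... | yes p | no  q = ⊥-elim (q (sym p))
  ... | no  p | yes q = ⊥-elim (p (sym q))

  sum-indicator : ∀ {n} (i : Fin n) a → sum (λ j → pick (does (i ≟ j)) a) ≈ a
  sum-indicator i a = ≈-trans (sum-cong-≋ λ j → pick-sym i j a) (sum-single i λ _ → a)

  bd-total : ∀ φ → sum (bd φ) ≈ 0#
  bd-total φ = begin
    sum (bd φ)
      ≈⟨ ∑-comm (λ v e → out φ v e - into φ v e) ⟩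
    sum (λ e → sum (λ v → out φ v e - into φ v e))
      ≈⟨ sum-zero _ (λ e → begin
           sum (λ v → out φ v e - into φ v e)
             ≈⟨ ∑-distrib-+ (λ v → out φ v e) (λ v → into φ v e ⁻¹) ⟩
           sum (λ v → out φ v e) ∙ sum (λ v → into φ v e ⁻¹)
             ≈⟨ ∙-cong (sum-indicator (initial e) (φ e))
                       (≈-trans (sum-⁻¹ (λ v → into φ v e)) (⁻¹-cong (sum-indicator (terminal e) (φ e)))) ⟩
           φ e - φ e
             ≈⟨ inverseʳ _ ⟩
           0# ∎) ⟩
    0# ∎

  pick-yes : ∀ {v w : V} {a} → v ≡ w → pick (does (v ≟ w)) a ≈ a
  pick-yes {v} {w} p with v ≟ w
  ... | yes _ = ≈-refl
  ... | no  q = ⊥-elim (q p)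

  pick-no : ∀ {v w : V} {a} → v ≢ w → pick (does (v ≟ w)) a ≈ 0#
  pick-no {v} {w} p with v ≟ w
  ... | yes q = ⊥-elim (p q)
  ... | no  _ = ≈-refl

  bd-single-initial : ∀ {g a} → initial g ≢ terminal g → bd (single g a) (initial g) ≈ a
  bd-single-initial {g} {a} ≢t = ≈-trans (bd-single g a _)
    (≈-trans (∙-cong (pick-yes {initial g} refl) (⁻¹-cong (pick-no (≢t ∘ sym))))
             (≈-trans (∙-congˡ ε⁻¹≈ε) (identityʳ a)))

  bd-single-terminal : ∀ {g a} → initial g ≢ terminal g → bd (single g a) (terminal g) ≈ a ⁻¹
  bd-single-terminal {g} {a} ≢t = ≈-trans (bd-single g a _)
    (≈-trans (∙-cong (pick-no ≢t) (⁻¹-cong (pick-yes {terminal g} refl))) (identityˡ _))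

  -- The flow of amount `a` from `x` to `y` along `g`. The sign absorbs the orientation, so
  -- `bd-unit` has one form for both constructors of `Link`.
  unit : ∀ {x g y} → Link x g y → Carrier → E → Carrier
  unit {g = g} (along _ _) a = single g a
  unit {g = g} (against _ _) a = single g (a ⁻¹)

  bd-unit : ∀ {x g y} (l : Link x g y) a v →
    bd (unit l a) v ≈ pick (does (x ≟ v)) a - pick (does (y ≟ v)) a
  bd-unit (along refl refl) a v = bd-single _ a v
  bd-unit {x} {g} {y} (against refl refl) a v = ≈-trans (bd-single _ (a ⁻¹) v)
    (flip (does (initial g ≟ v)) (does (terminal g ≟ v)))
    where
    flip : ∀ b c → pick b (a ⁻¹) - pick c (a ⁻¹) ≈ pick c a - pick b a
    flip true  true  = ≈-trans (inverseʳ _) (≈-sym (inverseʳ _))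
    flip true  false = ≈-trans (∙-congˡ ε⁻¹≈ε) (≈-trans (identityʳ _) (≈-sym (identityˡ _)))
    flip false true  = ≈-trans (identityˡ _) (≈-trans (⁻¹-involutive a) (≈-sym (≈-trans (∙-congˡ ε⁻¹≈ε) (identityʳ _))))
    flip false false = ≈-refl

  unit-off : ∀ {x g y} (l : Link x g y) a {s} → s ≢ g → unit l a s ≈ 0#
  unit-off {g = g} (along _ _) a {s} s≢ with s ≟ g
  ... | yes p = ⊥-elim (s≢ p)
  ... | no  _ = ≈-refl
  unit-off {g = g} (against _ _) a {s} s≢ with s ≟ g
  ... | yes p = ⊥-elim (s≢ p)
  ... | no  _ = ≈-refl

  bd-unit-here : ∀ {x g y} (l : Link x g y) → x ≢ y → ∀ a → bd (unit l a) x ≈ a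
  bd-unit-here {x} l x≢y a = ≈-trans (bd-unit l a _)
    (≈-trans (∙-cong (pick-yes {x} refl) (⁻¹-cong (pick-no (x≢y ∘ sym))))
             (≈-trans (∙-congˡ ε⁻¹≈ε) (identityʳ a)))

  opaque
    -- As `g` has exactly one end at `x`, the defect `t - bd h x` can be sent away along `g`.
    -- Repeated along a path, this pushes the defect ahead.
    solve-at : ∀ {x g y} → Link x g y → x ≢ y → ∀ (h : E → Carrier) (t : Carrier) →
      ∃[ h′ ] (bd h′ x ≈ t × (∀ s → s ≢ g → h′ s ≈ h s))
    solve-at {x} l x≢y h t =
        (λ s → h s ∙ unit l (t - bd h x) s)
      , (begin
          bd (λ s → h s ∙ unit l (t - bd h x) s) x  ≈⟨ bd-∙ h _ x ⟩
          bd h x ∙ bd (unit l (t - bd h x)) x       ≈⟨ ∙-congˡ (bd-unit-here l x≢y _) ⟩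
          bd h x ∙ (t - bd h x)                     ≈⟨ comm _ _ ⟩
          (t - bd h x) ∙ bd h x                     ≈⟨ //-rightDividesˡ (bd h x) t ⟩
          t                                         ∎)
      , λ s s≢ → ≈-trans (∙-congˡ (unit-off l _ s≢)) (identityʳ _)

  -- Near `x`, the difference of `h` and `k` is concentrated on `g`, and its boundary at `x` is its
  -- value at `g` up to sign.
  bd-unique : ∀ {x g y} → Link x g y → x ≢ y → ∀ {h k} →
    bd h x ≈ bd k x → (∀ s → At s x → s ≢ g → h s ≈ k s) → h g ≈ k g
  bd-unique {x} {g} l x≢y {h} {k} p q = lem l x≢y
    where
    d : E → Carrier
    d = single g (h g - k g)
    agree : ∀ s → At s x → h s ≈ k s ∙ d s
    agree s a with s ≟ g
    ... | yes refl = ≈-sym (≈-trans (comm _ _) (//-rightDividesˡ (k s) (h s)))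
    ... | no  s≢   = ≈-trans (q s a s≢) (≈-sym (identityʳ _))
    bd-d : bd d x ≈ 0#
    bd-d = ∙-cancelˡ (bd k x) _ _ (begin
      bd k x ∙ bd d x         ≈⟨ bd-∙ k d x ⟨
      bd (λ s → k s ∙ d s) x  ≈⟨ bd-local agree ⟨
      bd h x                  ≈⟨ p ⟩
      bd k x                  ≈⟨ identityʳ _ ⟨
      bd k x ∙ 0#             ∎)
    zero-diff : h g - k g ≈ 0# → h g ≈ k g
    zero-diff r = ≈-trans (≈-sym (//-rightDividesˡ (k g) (h g))) (≈-trans (∙-congʳ r) (identityˡ _))
    lem : ∀ {y} → Link x g y → x ≢ y → h g ≈ k g
    lem (along refl refl) ≢t = zero-diff (≈-trans (≈-sym (bd-single-initial ≢t)) bd-d)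
    lem (against refl refl) ≢t = zero-diff (begin
      h g - k g                ≈⟨ ⁻¹-involutive _ ⟨
      ((h g - k g) ⁻¹) ⁻¹      ≈⟨ ⁻¹-cong (≈-trans (≈-sym (bd-single-terminal (≢t ∘ sym))) bd-d) ⟩
      0# ⁻¹                    ≈⟨ ε⁻¹≈ε ⟩
      0#                       ∎)

  -- Because boundaries add up to zero.
  bd-last : ∀ {b : V → Carrier} → sum b ≈ 0# → ∀ h x →
    (∀ v → v ≢ x → bd h v ≈ b v) → bd h x ≈ b x
  bd-last {b} total h x p = begin
    bd h x        ≈⟨ //-rightDividesˡ (b x) _ ⟨
    d x ∙ b x     ≈⟨ ∙-congʳ d0 ⟩
    0# ∙ b x      ≈⟨ identityˡ _ ⟩
    b x           ∎
    where
    d : V → Carrier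
    d v = bd h v - b v
    conc : ∀ v → d v ≈ pick (does (v ≟ x)) (d v)
    conc v with v ≟ x
    ... | yes _ = ≈-refl
    ... | no  q = ≈-trans (∙-congʳ (p v q)) (inverseʳ _)
    d0 : d x ≈ 0#
    d0 = begin
      d x                                  ≈⟨ sum-single x d ⟨
      sum (λ v → pick (does (v ≟ x)) (d v)) ≈⟨ sum-cong-≋ conc ⟨
      sum d                                ≈⟨ ∑-distrib-+ (bd h) (λ v → b v ⁻¹) ⟩
      sum (bd h) ∙ sum (λ v → b v ⁻¹)      ≈⟨ ∙-cong (bd-total h) (≈-trans (sum-⁻¹ b) (≈-trans (⁻¹-cong total) ε⁻¹≈ε)) ⟩
      0# ∙ 0#                              ≈⟨ identityˡ _ ⟩
      0#                                   ∎

  module _ (D : E → Set) where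
    Linked : V → V → Set
    Linked u v = ∃[ e ] (D e × Link u e v)

    path : ∀ {u v} → EqClosure Linked u v → ∀ a →
      ∃[ ψ ] ((∀ w → bd ψ w ≈ pick (does (u ≟ w)) a - pick (does (v ≟ w)) a) × (∀ e → ¬ D e → ψ e ≈ 0#))
    path ε a = (λ _ → 0#) , (λ w → ≈-trans (bd-0 w) (≈-sym (inverseʳ _))) , λ _ _ → ≈-refl
    path {u} {v} (_◅_ {j = j} s r) a with path r a | step s
      where
      step : ∀ {j} → SymClosure Linked u j → ∃[ e ] (D e × Link u e j)
      step (fwd p)           = p
      step (bwd (e , d , l)) = e , d , link-sym l
    ... | ψ , bψ , sψ | e , d , l =
        (λ s → unit l a s ∙ ψ s)
      , (λ w → begin
          bd (λ s → unit l a s ∙ ψ s) w  ≈⟨ bd-∙ _ ψ w ⟩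
          bd (unit l a) w ∙ bd ψ w       ≈⟨ ∙-cong (bd-unit l a w) (bψ w) ⟩
          (pick (does (u ≟ w)) a - pick (does (j ≟ w)) a) ∙ (pick (does (j ≟ w)) a - pick (does (v ≟ w)) a)
            ≈⟨ assoc _ _ _ ⟩
          pick (does (u ≟ w)) a ∙ (pick (does (j ≟ w)) a ⁻¹ ∙ (pick (does (j ≟ w)) a - pick (does (v ≟ w)) a))
            ≈⟨ ∙-congˡ (\\-leftDividesʳ _ _) ⟩
          pick (does (u ≟ w)) a - pick (does (v ≟ w)) a ∎)
      , λ s ¬d → ≈-trans (∙-cong (unit-off l a λ { refl → ¬d d }) (sψ s ¬d)) (identityˡ _)

    sumᶠ : ∀ {n} → (Fin n → E → Carrier) → E → Carrier
    sumᶠ ψ e = sum (λ i → ψ i e)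

    bd-sumᶠ : ∀ {n} (ψ : Fin n → E → Carrier) w → bd (sumᶠ ψ) w ≈ sum (λ i → bd (ψ i) w)
    bd-sumᶠ {zero}  ψ w = bd-0 w
    bd-sumᶠ {suc n} ψ w = ≈-trans (bd-∙ (ψ zero) (sumᶠ (ψ ∘ suc)) w) (∙-congˡ (bd-sumᶠ (ψ ∘ suc) w))

    opaque
      -- The defect of `g` at each vertex is sent to `r` along a walk in `D`. The defects add up to
      -- zero, so nothing is left over at `r`.
      extend : (∀ u v → EqClosure Linked u v) → V → ∀ {b : V → Carrier} → sum b ≈ 0# → ∀ (g : E → Carrier) →
        ∃[ φ ] ((∀ v → bd φ v ≈ b v) × (∀ e → ¬ D e → φ e ≈ g e))
      extend conn r {b} total g =
          (λ e → g e ∙ sumᶠ ψ e)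
        , boundary
        , λ e ¬d → ≈-trans (∙-congˡ (sum-zero _ λ v → proj₂ (proj₂ (path (conn v r) (err v))) e ¬d)) (identityʳ _)
        where
        err : V → Carrier
        err v = b v - bd g v
        ψ : V → E → Carrier
        ψ v = proj₁ (path (conn v r) (err v))
        err-total : sum err ≈ 0#
        err-total = begin
          sum err                            ≈⟨ ∑-distrib-+ b (λ v → bd g v ⁻¹) ⟩
          sum b ∙ sum (λ v → bd g v ⁻¹)      ≈⟨ ∙-cong total (≈-trans (sum-⁻¹ (bd g)) (⁻¹-cong (bd-total g))) ⟩
          0# ∙ 0# ⁻¹                         ≈⟨ inverseʳ 0# ⟩
          0#                                 ∎
        pick-err : ∀ c → sum (λ v → pick c (err v) ⁻¹) ≈ 0#
        pick-err true  = ≈-trans (sum-⁻¹ err) (≈-trans (⁻¹-cong err-total) ε⁻¹≈ε)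
        pick-err false = sum-zero {#V} (λ _ → 0# ⁻¹) λ _ → ε⁻¹≈ε
        boundary : ∀ w → bd (λ e → g e ∙ sumᶠ ψ e) w ≈ b w
        boundary w = begin
          bd (λ e → g e ∙ sumᶠ ψ e) w       ≈⟨ bd-∙ g _ w ⟩
          bd g w ∙ bd (sumᶠ ψ) w            ≈⟨ ∙-congˡ (bd-sumᶠ ψ w) ⟩
          bd g w ∙ sum (λ v → bd (ψ v) w)
            ≈⟨ ∙-congˡ (sum-cong-≋ λ v → proj₁ (proj₂ (path (conn v r) (err v))) w) ⟩
          bd g w ∙ sum (λ v → pick (does (v ≟ w)) (err v) - pick (does (r ≟ w)) (err v))
            ≈⟨ ∙-congˡ (∑-distrib-+ (λ v → pick (does (v ≟ w)) (err v)) (λ v → pick (does (r ≟ w)) (err v) ⁻¹)) ⟩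
          bd g w ∙ (sum (λ v → pick (does (v ≟ w)) (err v)) ∙ sum (λ v → pick (does (r ≟ w)) (err v) ⁻¹))
            ≈⟨ ∙-congˡ (∙-cong (sum-single w err) (pick-err (does (r ≟ w)))) ⟩
          bd g w ∙ (err w ∙ 0#)             ≈⟨ ∙-congˡ (identityʳ _) ⟩
          bd g w ∙ (b w - bd g w)           ≈⟨ comm _ _ ⟩
          (b w - bd g w) ∙ bd g w           ≈⟨ //-rightDividesˡ (bd g w) (b w) ⟩
          b w                               ∎

-- Counting and cuts

module ℕΣ = Sums +-0-commutativeMonoid
open ℕΣ using () renaming (sum to ∑; sum-cong-≋ to ∑-cong; ∑-distrib-+ to ∑-+; pick to pickℕ)

⟦_⟧ : Bool → ℕ
⟦ b ⟧ = if b then 1 else 0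

∑-mono : ∀ {n} {f g : Fin n → ℕ} → (∀ i → f i ≤ g i) → ∑ f ≤ ∑ g
∑-mono {zero}  p = z≤n
∑-mono {suc n} p = +-mono-≤ (p zero) (∑-mono (p ∘ suc))

count : ∀ {n} → (Fin n → Bool) → ℕ
count p = ∑ (⟦_⟧ ∘ p)

count-cong : ∀ {n} {p q : Fin n → Bool} → p ≗ q → count p ≡ count q
count-cong e = ∑-cong (cong ⟦_⟧ ∘ e)

toggle : ∀ {n} → (Fin n → Bool) → Fin n → Fin n → Bool
toggle p e s = p s xor does (s ≟ e)

toggle-here : ∀ {n} (p : Fin n → Bool) e → toggle p e e ≡ not (p e)
toggle-here p e with e ≟ e
... | yes _ = Boolₚ.xor-comm (p e) true
... | no  q = ⊥-elim (q refl)

toggle-other : ∀ {n} (p : Fin n → Bool) {e s} → s ≢ e → toggle p e s ≡ p s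
toggle-other p {e} {s} q with s ≟ e
... | yes r = ⊥-elim (q r)
... | no  _ = Boolₚ.xor-identityʳ (p s)

count-toggle-on : ∀ {n} (p : Fin n → Bool) e → p e ≡ false → count (toggle p e) ≡ suc (count p)
count-toggle-on p e pe = begin
  count (toggle p e)                          ≡⟨ ∑-cong pointwise ⟩
  ∑ (λ s → pickℕ (does (s ≟ e)) 1 + ⟦ p s ⟧)   ≡⟨ ∑-+ (λ s → pickℕ (does (s ≟ e)) 1) (⟦_⟧ ∘ p) ⟩
  ∑ (λ s → pickℕ (does (s ≟ e)) 1) + count p   ≡⟨ cong (_+ count p) (ℕΣ.sum-single e λ _ → 1) ⟩
  suc (count p)                               ∎
  where
  open ≡-Reasoning
  pointwise : ∀ s → ⟦ toggle p e s ⟧ ≡ pickℕ (does (s ≟ e)) 1 + ⟦ p s ⟧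
  pointwise s with s ≟ e
  ... | yes refl rewrite pe = refl
  ... | no  _ = cong ⟦_⟧ (Boolₚ.xor-identityʳ (p s))

toggle-toggle : ∀ {n} (p : Fin n → Bool) e → toggle (toggle p e) e ≗ p
toggle-toggle p e s = trans (Boolₚ.xor-assoc (p s) _ _)
  (trans (cong (p s xor_) (Boolₚ.xor-same (does (s ≟ e)))) (Boolₚ.xor-identityʳ (p s)))

count-toggle-off : ∀ {n} (p : Fin n → Bool) e → p e ≡ true → suc (count (toggle p e)) ≡ count p
count-toggle-off p e pe = trans
  (sym (count-toggle-on (toggle p e) e (trans (toggle-here p e) (cong not pe))))
  (count-cong (toggle-toggle p e))

count-≥1 : ∀ {n} (p : Fin n → Bool) → 1 ≤ count p → ∃[ i ] p i ≡ true
count-≥1 {suc n} p h with p zero in eq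
... | true  = zero , eq
... | false with count-≥1 (p ∘ suc) h
...   | i , q = suc i , q

_∖_ : ∀ {n} → (Fin n → Bool) → Fin n → Fin n → Bool
(p ∖ e) s = p s ∧ not (does (s ≟ e))

∖-true : ∀ {n} (p : Fin n → Bool) {e s} → (p ∖ e) s ≡ true → p s ≡ true × s ≢ e
∖-true p {e} {s} h with p s | s ≟ e
... | true  | no q = refl , q
... | true  | yes _ with () ← h
... | false | _     with () ← h

∖-intro : ∀ {n} (p : Fin n → Bool) {e s} → p s ≡ true → s ≢ e → (p ∖ e) s ≡ true
∖-intro p {e} {s} h q with s ≟ e
... | yes r = ⊥-elim (q r)
... | no  _ rewrite h = refl

count-∖ : ∀ {n} (p : Fin n → Bool) e → p e ≡ true → count p ≡ suc (count (p ∖ e))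
count-∖ p e pe = trans (sym (count-toggle-off p e pe)) (cong suc (count-cong pointwise))
  where
  pointwise : toggle p e ≗ p ∖ e
  pointwise s with s ≟ e
  ... | yes refl rewrite pe = refl
  ... | no  _ = trans (Boolₚ.xor-identityʳ (p s)) (sym (Boolₚ.∧-identityʳ (p s)))

count-≤-∖ : ∀ {n} (p : Fin n → Bool) e → count p ≤ suc (count (p ∖ e))
count-≤-∖ p e with p e in eq
... | true  = ≤-reflexive (count-∖ p e eq)
... | false = ≤-trans (≤-reflexive (count-cong pointwise)) (n≤1+n _)
  where
  pointwise : p ≗ p ∖ e
  pointwise s with s ≟ e
  ... | yes refl rewrite eq = refl
  ... | no  _ = sym (Boolₚ.∧-identityʳ (p s))

opaque
  pick-one : ∀ {n k} (p : Fin n → Bool) → suc k ≤ count p → ∃[ e ] (p e ≡ true × k ≤ count (p ∖ e))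
  pick-one p h with count-≥1 p (≤-trans (s≤s z≤n) h)
  ... | e , pe = e , pe , ≤-pred (≤-trans h (≤-reflexive (count-∖ p e pe)))

count-0 : ∀ {n} (p : Fin n → Bool) → count p ≡ 0 → ∀ i → p i ≡ false
count-0 p h i with p i in eq
... | false = refl
... | true with () ← trans (sym h) (count-∖ p i eq)

Count : ∀ {A B : Set} → ℕ → ((A → B) → Set) → Set
Count {A} {B} N P = Σ[ Φ ∈ (Fin N → A → B) ] (Injective _≡_ _≗_ Φ × (∀ i → P (Φ i)))

module Cuts (G : OrientedGraph) where
  open OrientedGraph G
  open Links G public

  cross : (V → Bool) → E → Bool
  cross Z e = Z (initial e) xor Z (terminal e)

  d : (V → Bool) → ℕ
  d Z = count (cross Z)

  -- 3-edge-connectivity in terms of cuts, the form suited to submodularity and to arguments about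
  -- components.
  Conn3 : Set
  Conn3 = ∀ Z {u w} → Z u ≡ true → Z w ≡ false → 3 ≤ d Z

  cross-link : ∀ Z {u e w} → Link u e w → Z u ≡ true → Z w ≡ false → cross Z e ≡ true
  cross-link Z (along refl refl) p q rewrite p | q = refl
  cross-link Z (against refl refl) p q rewrite p | q = refl

  link-cross : ∀ Z {e} → cross Z e ≡ true → ∃[ u ] ∃[ w ] (Link u e w × Z u ≡ true × Z w ≡ false)
  link-cross Z {e} h with Z (initial e) in p | Z (terminal e) in q
  ... | true  | false = _ , _ , along refl refl , p , q
  ... | false | true  = _ , _ , against refl refl , q , p
  ... | true  | true  with () ← h
  ... | false | false with () ← h

  cross-not : ∀ Z e → cross (not ∘ Z) e ≡ cross Z e
  cross-not Z e with Z (initial e) | Z (terminal e)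
  ... | true  | true  = refl
  ... | true  | false = refl
  ... | false | true  = refl
  ... | false | false = refl

  opaque
    -- The two excluded edges are typically those already known to cross; a further one is obtained.
    cut3 : Conn3 → ∀ (Z : V → Bool) {u w} → Z u ≡ true → Z w ≡ false → ∀ (e₁ e₂ : E) →
      ∃[ e ] ∃[ a ] ∃[ c ] (Link a e c × Z a ≡ true × Z c ≡ false × e ≢ e₁ × e ≢ e₂)
    cut3 conn Z zu zw e₁ e₂ with count-≥1 ((cross Z ∖ e₁) ∖ e₂)
        (≤-pred (≤-trans (≤-pred (≤-trans (conn Z zu zw) (count-≤-∖ (cross Z) e₁))) (count-≤-∖ (cross Z ∖ e₁) e₂)))
    ... | e , h with ∖-true (cross Z ∖ e₁) h
    ... | h₁ , q₂ with ∖-true (cross Z) h₁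
    ... | h₂ , q₁ with link-cross Z h₂
    ... | a , c , l , za , zc = e , a , c , l , za , zc , q₁ , q₂

  ∣tabulate∣ : ∀ {n} (p : Fin n → Bool) → Subset.∣ tabulate p ∣ ≡ count p
  ∣tabulate∣ {zero}  p = refl
  ∣tabulate∣ {suc n} p with p zero
  ... | true  = cong suc (∣tabulate∣ (p ∘ suc))
  ... | false = ∣tabulate∣ (p ∘ suc)

  edgeConnected⇒conn3 : EdgeConnected 3 → Conn3
  edgeConnected⇒conn3 (_ , conn) Z {u} {w} zu zw with 3 ≤? d Z
  ... | yes p = p
  ... | no  p = ⊥-elim (absurd (conn S (≤-trans (s≤s (≤-reflexive (∣tabulate∣ (cross Z)))) (≰⇒> p)) u w) zu)
    where
    S : Subset #E
    S = tabulate (cross Z)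
    same : ∀ {a c} → JoinedWithout S a c → Z a ≡ Z c
    same (e , e∉ , refl , refl) with cross Z e in eq
    ... | true  = ⊥-elim (e∉ (lookup⇒[]= e S (trans (lookup∘tabulate _ e) eq)))
    ... | false with Z (initial e) | Z (terminal e)
    ...   | true  | true  = refl
    ...   | false | false = refl
    absurd : ∀ {a} → EqClosure (JoinedWithout S) a w → Z a ≡ true → ⊥
    absurd ε za with () ← trans (sym za) zw
    absurd (fwd j ◅ r) za = absurd r (trans (sym (same j)) za)
    absurd (bwd j ◅ r) za = absurd r (trans (same j) za)

  submodular : ∀ Y Z → d (λ v → Y v ∧ Z v) + d (λ v → Y v ∨ Z v) ≤ d Y + d Z
  submodular Y Z = ≤-trans
    (≤-reflexive (sym (∑-+ (⟦_⟧ ∘ cross (λ v → Y v ∧ Z v)) (⟦_⟧ ∘ cross (λ v → Y v ∨ Z v)))))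
    (≤-trans (∑-mono λ e → lem (Y (initial e)) (Y (terminal e)) (Z (initial e)) (Z (terminal e)))
             (≤-reflexive (∑-+ (⟦_⟧ ∘ cross Y) (⟦_⟧ ∘ cross Z))))
    where
    lem : ∀ a b c e → ⟦ (a ∧ c) xor (b ∧ e) ⟧ + ⟦ (a ∨ c) xor (b ∨ e) ⟧ ≤ ⟦ a xor b ⟧ + ⟦ c xor e ⟧
    lem true  true  true  true  = z≤n
    lem true  true  true  false = ≤-refl
    lem true  true  false true  = ≤-refl
    lem true  true  false false = z≤n
    lem true  false true  true  = ≤-refl
    lem true  false true  false = ≤-refl
    lem true  false false true  = z≤n
    lem true  false false false = ≤-refl
    lem false true  true  true  = ≤-refl
    lem false true  true  false = z≤n
    lem false true  false true  = ≤-refl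
    lem false true  false false = ≤-refl
    lem false false true  true  = z≤n
    lem false false true  false = ≤-refl
    lem false false false true  = ≤-refl
    lem false false false false = z≤n

  incidence : V → E → ℕ
  incidence v e = ⟦ does (initial e ≟ v) xor does (terminal e ≟ v) ⟧

  degree : V → ℕ
  degree v = d (λ u → does (u ≟ v))

  incidence-≤ : ∀ e v → incidence v e ≤ pickℕ (does (initial e ≟ v)) 1 + pickℕ (does (terminal e ≟ v)) 1
  incidence-≤ e v with does (initial e ≟ v) | does (terminal e ≟ v)
  ... | true  | true  = z≤n
  ... | true  | false = ≤-refl
  ... | false | true  = ≤-refl
  ... | false | false = z≤n

  pickℕ-sum : ∀ (u : V) → ∑ (λ v → pickℕ (does (u ≟ v)) 1) ≡ 1
  pickℕ-sum u = trans (∑-cong sw) (ℕΣ.sum-single u (λ _ → 1))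
    where
    sw : ∀ v → pickℕ (does (u ≟ v)) 1 ≡ pickℕ (does (v ≟ u)) 1
    sw v with u ≟ v | v ≟ u
    ... | yes _ | yes _ = refl
    ... | no  _ | no  _ = refl
    ... | yes p | no  q = ⊥-elim (q (sym p))
    ... | no  p | yes q = ⊥-elim (p (sym q))

  endpoints : ∀ e → ∑ (λ v → pickℕ (does (initial e ≟ v)) 1 + pickℕ (does (terminal e ≟ v)) 1) ≡ 2
  endpoints e = trans (∑-+ (λ v → pickℕ (does (initial e ≟ v)) 1) (λ v → pickℕ (does (terminal e ≟ v)) 1))
    (cong₂ _+_ (pickℕ-sum (initial e)) (pickℕ-sum (terminal e)))

  ∑-const : ∀ n c → ∑ {n} (λ _ → c) ≡ n * c
  ∑-const zero    c = refl
  ∑-const (suc n) c = cong (c +_) (∑-const n c)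

  -- `degree` is the size of a cut, so a loop adds nothing to it although it has two ends; hence
  -- only an inequality.
  handshake-≤ : ∑ degree ≤ #E * 2
  handshake-≤ = ≤-trans (≤-reflexive (ℕΣ.∑-comm incidence))
    (≤-trans (∑-mono λ e → ≤-trans (∑-mono (incidence-≤ e)) (≤-reflexive (endpoints e)))
             (≤-reflexive (∑-const #E 2)))

  handshake : (∀ e → initial e ≢ terminal e) → ∑ degree ≡ #E * 2
  handshake ¬loop = trans (ℕΣ.∑-comm incidence)
    (trans (∑-cong λ e → trans (∑-cong (eq e)) (endpoints e)) (∑-const #E 2))
    where
    eq : ∀ e v → incidence v e ≡ pickℕ (does (initial e ≟ v)) 1 + pickℕ (does (terminal e ≟ v)) 1
    eq e v with initial e ≟ v | terminal e ≟ v
    ... | yes p | yes q = ⊥-elim (¬loop e (trans p (sym q)))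
    ... | yes p | no  q = refl
    ... | no  p | yes q = refl
    ... | no  p | no  q = refl

xor-interchange : ∀ a b m n → (a xor m) xor (b xor n) ≡ (a xor b) xor (m xor n)
xor-interchange true true true true = refl
xor-interchange true true true false = refl
xor-interchange true true false true = refl
xor-interchange true true false false = refl
xor-interchange true false true true = refl
xor-interchange true false true false = refl
xor-interchange true false false true = refl
xor-interchange true false false false = refl
xor-interchange false true true true = refl
xor-interchange false true true false = refl
xor-interchange false true false true = refl
xor-interchange false true false false = refl
xor-interchange false false true true = refl
xor-interchange false false true false = refl
xor-interchange false false false true = refl
xor-interchange false false false false = refl

-- Moves the ends marked by mi and mt from the vertex v to the new vertex zero,
-- which is joined to v by the new edge zero.
module Split (G : OrientedGraph) (v : OrientedGraph.V G) (mi mt : OrientedGraph.E G → Bool) where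
  open OrientedGraph G
  open Cuts using (cross; d; Conn3)

  split : OrientedGraph
  split = record
    { #V = suc #V
    ; #E = suc #E
    ; initial  = λ { zero → zero  ; (suc e) → if mi e then zero else suc (initial e) }
    ; terminal = λ { zero → suc v ; (suc e) → if mt e then zero else suc (terminal e) }
    }

  module _ (at-i : ∀ e → mi e ≡ true → initial e ≡ v) (at-t : ∀ e → mt e ≡ true → terminal e ≡ v) where

    cross-same : ∀ Z → Z zero ≡ Z (suc v) → ∀ e → cross split Z (suc e) ≡ cross G (Z ∘ suc) e
    cross-same Z eq e = cong₂ _xor_ i t
      where
      i : Z (if mi e then zero else suc (initial e)) ≡ Z (suc (initial e))
      i with mi e in m
      ... | true  = trans eq (cong (Z ∘ suc) (sym (at-i e m)))
      ... | false = refl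
      t : Z (if mt e then zero else suc (terminal e)) ≡ Z (suc (terminal e))
      t with mt e in m
      ... | true  = trans eq (cong (Z ∘ suc) (sym (at-t e m)))
      ... | false = refl

    -- When `Z` separates `zero` from `suc v`, a moved end changes sides, and an edge changes its
    -- status if exactly one of its ends moves.
    cross-flip : ∀ Z → Z zero ≡ not (Z (suc v)) → ∀ e →
      cross split Z (suc e) ≡ cross G (Z ∘ suc) e xor (mi e xor mt e)
    cross-flip Z eq e = trans (cong₂ _xor_ i t) (xor-interchange (Z (suc (initial e))) (Z (suc (terminal e))) (mi e) (mt e))
      where
      i : Z (if mi e then zero else suc (initial e)) ≡ Z (suc (initial e)) xor mi e
      i with mi e in m
      ... | true  = trans eq (trans (cong (not ∘ Z ∘ suc) (sym (at-i e m))) (Boolₚ.xor-comm true _))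
      ... | false = sym (Boolₚ.xor-identityʳ _)
      t : Z (if mt e then zero else suc (terminal e)) ≡ Z (suc (terminal e)) xor mt e
      t with mt e in m
      ... | true  = trans eq (trans (cong (not ∘ Z ∘ suc) (sym (at-t e m))) (Boolₚ.xor-comm true _))
      ... | false = sym (Boolₚ.xor-identityʳ _)

-- Reduction to cubic graphs

module SplitPair (G : OrientedGraph) (v : OrientedGraph.V G) {ea eb : OrientedGraph.E G}
  (at-a : Links.At G ea v) (at-b : Links.At G eb v) (ea≢eb : ea ≢ eb) where
  open OrientedGraph G
  open Cuts using (cross; d; Conn3; link-cross)
  open Links G using (At)

  isInitial : ∀ {e} → At e v → Bool
  isInitial (inj₁ _) = true
  isInitial (inj₂ _) = false

  -- One end of `ea` and one of `eb` move. For a loop at `v`, the `At` witness selects which of its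
  -- ends.
  mi mt : E → Bool
  mi e = (does (e ≟ ea) ∧ isInitial at-a) ∨ (does (e ≟ eb) ∧ isInitial at-b)
  mt e = (does (e ≟ ea) ∧ not (isInitial at-a)) ∨ (does (e ≟ eb) ∧ not (isInitial at-b))

  isInitial-true : ∀ {e} (a : At e v) → isInitial a ≡ true → initial e ≡ v
  isInitial-true (inj₁ p) _ = p

  isInitial-false : ∀ {e} (a : At e v) → not (isInitial a) ≡ true → terminal e ≡ v
  isInitial-false (inj₂ p) _ = p

  at-i : ∀ e → mi e ≡ true → initial e ≡ v
  at-i e h with e ≟ ea | e ≟ eb
  ... | yes refl | yes p = ⊥-elim (ea≢eb p)
  ... | yes refl | no  _ = isInitial-true at-a (trans (sym (Boolₚ.∨-identityʳ _)) h)
  ... | no  _ | yes refl = isInitial-true at-b h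
  ... | no  _ | no _ with () ← h

  at-t : ∀ e → mt e ≡ true → terminal e ≡ v
  at-t e h with e ≟ ea | e ≟ eb
  ... | yes refl | yes p = ⊥-elim (ea≢eb p)
  ... | yes refl | no  _ = isInitial-false at-a (trans (sym (Boolₚ.∨-identityʳ _)) h)
  ... | no  _ | yes refl = isInitial-false at-b h
  ... | no  _ | no _ with () ← h

  moved : ∀ e → mi e xor mt e ≡ does (e ≟ ea) xor does (e ≟ eb)
  moved e with e ≟ ea | e ≟ eb
  ... | yes refl | yes p = ⊥-elim (ea≢eb p)
  ... | yes _ | no  _ = lem (isInitial at-a)
    where
    lem : ∀ i → (i ∨ false) xor (not i ∨ false) ≡ true
    lem true  = refl
    lem false = refl
  ... | no  _ | yes _ = lem (isInitial at-b)
    where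
    lem : ∀ i → i xor not i ≡ true
    lem true  = refl
    lem false = refl
  ... | no  _ | no _ = refl

  open Split G v mi mt

  -- If `Z` separates the two copies of `v`, its cut consists of the new edge and of the old cut
  -- with `ea` and `eb` toggled. The size drops, by one, only if both of these crossed; the
  -- hypothesis `tight` then provides a spare edge.
  conn3-split : Conn3 G → (∀ Z → cross G Z ea ≡ true → cross G Z eb ≡ true → 4 ≤ d G Z) → Conn3 split
  conn3-split conn tight Z {u} {w} zu zw with Z zero Boolₚ.≟ Z (suc v)
  ... | yes eq = ≤-trans (conn (Z ∘ suc) (trans (proj₂ (lower u)) zu) (trans (proj₂ (lower w)) zw))
                         (≤-trans (≤-reflexive (sym (count-cong (cross-same at-i at-t Z eq)))) (m≤n+m _ _))
    where
    lower : ∀ x → ∃[ x′ ] Z (suc x′) ≡ Z x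
    lower zero    = v , sym eq
    lower (suc x) = x , refl
  ... | no neq = ≤-trans bound (≤-reflexive (sym (cong₂ _+_ new (count-cong old))))
    where
    c : E → Bool
    c = cross G (Z ∘ suc)
    new : ⟦ Z zero xor Z (suc v) ⟧ ≡ 1
    new with Z zero | Z (suc v)
    ... | true  | false = refl
    ... | false | true  = refl
    ... | true  | true  = ⊥-elim (neq refl)
    ... | false | false = ⊥-elim (neq refl)
    old : ∀ e → cross split Z (suc e) ≡ toggle (toggle c ea) eb e
    old e = trans (cross-flip at-i at-t Z (Boolₚ.¬-not neq) e)
      (trans (cong (c e xor_) (moved e)) (sym (Boolₚ.xor-assoc (c e) _ _)))
    conn′ : ∀ {e} → c e ≡ true → 3 ≤ count c
    conn′ ce with link-cross G (Z ∘ suc) ce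
    ... | _ , _ , _ , p , q = conn (Z ∘ suc) p q
    bound : 3 ≤ suc (count (toggle (toggle c ea) eb))
    bound with c ea in ca | c eb in cb
    ... | true | true = s≤s (≤-pred (≤-pred (≤-trans (tight (Z ∘ suc) ca cb)
          (≤-reflexive (trans (sym (count-toggle-off c ea ca))
            (cong suc (sym (count-toggle-off (toggle c ea) eb (trans (toggle-other c (ea≢eb ∘ sym)) cb)))))))))
    ... | true | false = ≤-trans (conn′ ca) (≤-trans (≤-reflexive (sym (count-toggle-off c ea ca)))
          (≤-trans (≤-reflexive (sym (count-toggle-on (toggle c ea) eb (trans (toggle-other c (ea≢eb ∘ sym)) cb)))) (n≤1+n _)))
    ... | false | true = ≤-trans (conn′ cb) (≤-trans (≤-trans (n≤1+n _) (≤-reflexive (sym (count-toggle-on c ea ca))))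
          (≤-reflexive (sym (count-toggle-off (toggle c ea) eb (trans (toggle-other c (ea≢eb ∘ sym)) cb)))))
    -- The old cut may be empty here, but the new edge, `ea` and `eb` make three.
    ... | false | false = s≤s (≤-trans (s≤s (s≤s z≤n)) (≤-reflexive (sym (trans
          (count-toggle-on (toggle c ea) eb (trans (toggle-other c (ea≢eb ∘ sym)) cb))
          (cong suc (count-toggle-on c ea ca))))))

  module _ (Γ : AbelianGroup 0ℓ 0ℓ) where
    open AbelianGroup Γ renaming (refl to ≈-refl; sym to ≈-sym; trans to ≈-trans; ε to 0#)
    private
      module B  = Boundary Γ G
      module B′ = Boundary Γ split

    -- Contracting the new edge adds the boundary at `zero` to that at `v`, and the two
    -- contributions of the new edge cancel.
    bd-split : ∀ k u → B.bd (k ∘ suc) u ≈ B′.bd k (suc u) ∙ B.pick (does (v ≟ u)) (B′.bd k zero)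
    bd-split k u = go
      where
      open SetoidReasoning setoid
      open AbelianGroupProperties Γ
      t t′ : E → Carrier
      t  e = B′.out k (suc u) (suc e) - B′.into k (suc u) (suc e)
      t′ e = B′.out k zero (suc e) - B′.into k zero (suc e)
      p : Carrier → Carrier
      p = B.pick (does (v ≟ u))
      end : ∀ m {w x} → (m ≡ true → w ≡ v) →
        B.pick (does (w ≟ u)) x ≈ B.pick (does ((if m then zero else suc w) ≟ suc u)) x
                                  ∙ p (B.pick (does ((if m then zero else suc w) ≟ zero)) x)
      end true  {w} f rewrite f refl = ≈-sym (identityˡ _)
      end false f = ≈-sym (≈-trans (∙-congˡ (B.pick-0 (does (v ≟ u)))) (identityʳ _))
      p-neg : ∀ b x y → B.pick b x - B.pick b y ≈ B.pick b (x - y)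
      p-neg true  x y = ≈-refl
      p-neg false x y = inverseʳ _
      term : ∀ e → B.out (k ∘ suc) u e - B.into (k ∘ suc) u e ≈ t e ∙ p (t′ e)
      term e = ≈-trans (∙-cong (end (mi e) (at-i e)) (⁻¹-cong (end (mt e) (at-t e))))
        (≈-trans (B.-‿∙-comm _ _ _ _) (∙-congˡ (p-neg (does (v ≟ u)) _ _)))
      sum-p : ∀ b {n} (f : Fin n → Carrier) → B.sum (λ i → B.pick b (f i)) ≈ B.pick b (B.sum f)
      sum-p true  f = ≈-refl
      sum-p false {n} f = B.sum-zero {n} (λ _ → 0#) λ _ → ≈-refl
      x : Carrier
      x = k zero
      new : ∀ b → (0# - B.pick b x) ∙ B.pick b (x - 0#) ≈ 0#
      new true  = ≈-trans (∙-cong (identityˡ _) (≈-trans (∙-congˡ ε⁻¹≈ε) (identityʳ x))) (inverseˡ x)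
      new false = ≈-trans (identityʳ _) (inverseʳ 0#)
      go : B.bd (k ∘ suc) u ≈ B′.bd k (suc u) ∙ p (B′.bd k zero)
      go = begin
        B.bd (k ∘ suc) u                      ≈⟨ B.sum-cong-≋ term ⟩
        B.sum (λ e → t e ∙ p (t′ e))           ≈⟨ B.∑-distrib-+ t (p ∘ t′) ⟩
        B.sum t ∙ B.sum (p ∘ t′)               ≈⟨ ∙-congˡ (sum-p (does (v ≟ u)) t′) ⟩
        B.sum t ∙ p (B.sum t′)                 ≈⟨ identityˡ _ ⟨
        0# ∙ (B.sum t ∙ p (B.sum t′))          ≈⟨ ∙-congʳ (new (does (v ≟ u))) ⟨
        ((0# - p x) ∙ p (x - 0#)) ∙ (B.sum t ∙ p (B.sum t′))
          ≈⟨ assoc _ _ _ ⟩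
        (0# - p x) ∙ (p (x - 0#) ∙ (B.sum t ∙ p (B.sum t′)))
          ≈⟨ ∙-congˡ (≈-trans (≈-sym (assoc _ _ _)) (≈-trans (∙-congʳ (comm _ _)) (assoc _ _ _))) ⟩
        (0# - p x) ∙ (B.sum t ∙ (p (x - 0#) ∙ p (B.sum t′)))
          ≈⟨ assoc _ _ _ ⟨
        ((0# - p x) ∙ B.sum t) ∙ (p (x - 0#) ∙ p (B.sum t′))
          ≈⟨ ∙-congˡ (B.pick-∙ (does (v ≟ u)) _ _) ⟨
        B′.bd k (suc u) ∙ p (B′.bd k zero) ∎

NowhereZero : (G : OrientedGraph) → (OrientedGraph.V G → Fin 6) → (OrientedGraph.E G → Fin 6) → Set
NowhereZero G b k = (∀ v → Boundary.bd ℤ₆ G k v ≡ b v) × (∀ e → k e ≢ zero)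

-- The bound is stated for every boundary of sum zero, since a splitting changes the boundary
-- function. Squaring keeps it within the natural numbers.
Good : OrientedGraph → Set
Good G = ∀ b → Boundary.sum ℤ₆ G b ≡ zero →
  ∃[ M ] (#E ∸ #V ≤ 9 * (M * M) × Count (2 ^ M) (NowhereZero G b))
  where open OrientedGraph G

module _ (G : OrientedGraph) (v : OrientedGraph.V G) {ea eb : OrientedGraph.E G}
  (at-a : Links.At G ea v) (at-b : Links.At G eb v) (ea≢eb : ea ≢ eb) where
  open OrientedGraph G
  open Cuts using (cross; d; Conn3; link-cross)
  open Links G using (At)
  open SplitPair G v at-a at-b ea≢eb
  open Split G v mi mt
  private
    module B  = Boundary ℤ₆ G
    module B′ = Boundary ℤ₆ split

  -- The new vertex gets boundary zero. The value at the new edge is then determined by the other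
  -- edges at that vertex, so forgetting it loses no solution. Both `#E` and `#V` drop by one.
  good-split : Good split → Good G
  good-split good b total with good b′ (trans (AbelianGroup.identityˡ ℤ₆ (B.sum b)) total)
    where
    b′ : Fin (suc #V) → Fin 6
    b′ zero    = zero
    b′ (suc u) = b u
  ... | M , bound , Φ , inj , nz = M , bound , (λ i → Φ i ∘ suc) , inj′ , nz′
    where
    inj′ : Injective _≡_ _≗_ (λ i → Φ i ∘ suc)
    inj′ {i} {j} eq = inj λ
      { zero → B′.bd-unique {x = zero} {g = zero} {y = suc v} (Links.along refl refl) 0≢1+n {Φ i} {Φ j}
          (trans (proj₁ (nz i) zero) (sym (proj₁ (nz j) zero)))
          λ { zero _ q → ⊥-elim (q refl) ; (suc s) _ _ → eq s }
      ; (suc s) → eq s }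
    nz′ : ∀ i → NowhereZero G b (Φ i ∘ suc)
    nz′ i = (λ u → trans (bd-split ℤ₆ (Φ i) u) (trans (cong₂ _+₆_ (proj₁ (nz i) (suc u)) (lem u)) (AbelianGroup.identityʳ ℤ₆ (b u))))
          , (proj₂ (nz i) ∘ suc)
      where
      lem : ∀ u → B.pick (does (v ≟ u)) (B′.bd (Φ i) zero) ≡ zero
      lem u rewrite proj₁ (nz i) zero with does (v ≟ u)
      ... | true  = refl
      ... | false = refl

module Pairing (G : OrientedGraph) where
  open OrientedGraph G
  open Cuts G

  -- The obstruction to moving ends of `e₁` and `e₂` together: a cut of size 3 through both would
  -- shrink to 2. As `S` is a `Subset`, tightness is decidable by search.
  Tight : E → E → Set
  Tight e₁ e₂ = ∃[ S ] (cross (lookup S) e₁ ≡ true × cross (lookup S) e₂ ≡ true × d (lookup S) ≤ 3)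

  tight? : ∀ e₁ e₂ → Dec (Tight e₁ e₂)
  tight? e₁ e₂ = anySubset? λ S →
    (cross (lookup S) e₁ Boolₚ.≟ true) ×-dec ((cross (lookup S) e₂ Boolₚ.≟ true) ×-dec (d (lookup S) ≤? 3))

  cross-cong : ∀ {Y Z : V → Bool} → Y ≗ Z → cross Y ≗ cross Z
  cross-cong p e = cong₂ _xor_ (p (initial e)) (p (terminal e))

  untight : ∀ {e₁ e₂} → ¬ Tight e₁ e₂ → ∀ Z → cross Z e₁ ≡ true → cross Z e₂ ≡ true → 4 ≤ d Z
  untight {e₁} {e₂} ¬t Z p q with 4 ≤? d Z
  ... | yes r = r
  ... | no  r = ⊥-elim (¬t (tabulate Z , trans (eq e₁) p , trans (eq e₂) q ,
                  ≤-trans (≤-reflexive (count-cong eq)) (≤-pred (≰⇒> r))))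
    where
    eq : cross (lookup (tabulate Z)) ≗ cross Z
    eq = cross-cong (lookup∘tabulate Z)

  normalise : ∀ {e₁ e₂} v → Tight e₁ e₂ →
    ∃[ Z ] (Z v ≡ false × cross Z e₁ ≡ true × cross Z e₂ ≡ true × d Z ≤ 3)
  normalise {e₁} {e₂} v (S , p , q , r) with lookup S v in eq
  ... | false = lookup S , eq , p , q , r
  ... | true  = not ∘ lookup S , cong not eq , trans (cross-not (lookup S) e₁) p ,
                trans (cross-not (lookup S) e₂) q ,
                ≤-trans (≤-reflexive (count-cong (cross-not (lookup S)))) r

  far : ∀ {v e w} Z → Link v e w → Z v ≡ false → cross Z e ≡ true → Z w ≡ true
  far Z l zv c with link-cross Z c
  ... | a , b , l′ , za , zb with at-link l (link-atˡ l′) | at-link l (link-atʳ l′)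
  ... | inj₁ refl | _ with () ← trans (sym za) zv
  far Z l zv c | a , b , l′ , za , zb | inj₂ refl | _ = za

  -- The intersection contains `y` but not `v`, so its boundary is at least 3, and submodularity
  -- leaves at most 3 + 3 - 3 for the union.
  union-tight : Conn3 → ∀ {v y} Y Z → Y v ≡ false → Z v ≡ false → Y y ≡ true → Z y ≡ true →
    d Y ≤ 3 → d Z ≤ 3 → d (λ u → Y u ∨ Z u) ≤ 3
  union-tight conn {v} {y} Y Z yv zv yy zy p q = +-cancelˡ-≤ 3 _ _ (≤-trans
    (+-monoˡ-≤ _ (conn (λ u → Y u ∧ Z u) {y} {v} (cong₂ _∧_ yy zy) (cong₂ _∧_ yv zv)))
    (≤-trans (submodular Y Z) (+-mono-≤ p q)))

  star : V → E → Bool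
  star v = cross (λ u → does (u ≟ v))

  -- Sets of boundary 3 that share an element and avoid v are closed under
  -- union, so they cannot separate one edge at v together with each of three others.
  pair : Conn3 → ∀ v → 4 ≤ degree v →
    ∃[ ea ] ∃[ eb ] (At ea v × At eb v × ea ≢ eb × ¬ Tight ea eb)
  pair conn v deg
    with pick-one (star v) deg
  ... | a , pa , k₃ with pick-one (star v ∖ a) k₃
  ... | b₁ , p₁ , k₂ with pick-one ((star v ∖ a) ∖ b₁) k₂
  ... | b₂ , p₂ , k₁ with pick-one (((star v ∖ a) ∖ b₁) ∖ b₂) k₁
  ... | b₃ , p₃ , k₀
    with ∖-true (star v) p₁ | ∖-true (star v ∖ a) p₂ | ∖-true ((star v ∖ a) ∖ b₁) p₃
  ... | c₁ , n₁ | p₂′ , n₂₁ | p₃″ , n₃₂ with ∖-true (star v) p₂′ | ∖-true (star v ∖ a) p₃″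
  ... | c₂ , n₂ | p₃′ , n₃₁ with ∖-true (star v) p₃′
  ... | c₃ , n₃ = go
    where
    D : V → Bool
    D u = does (u ≟ v)
    link : ∀ {e} → cross D e ≡ true → ∃[ w ] Link v e w
    link c with link-cross D c
    ... | u , w , l , p , q with u ≟ v
    ...   | yes refl = w , l
    ...   | no  _ with () ← p
    la = link {a} pa
    l₁ = link {b₁} c₁
    l₂ = link {b₂} c₂
    l₃ = link {b₃} c₃
    contra : Tight a b₁ → Tight a b₂ → Tight a b₃ → ⊥
    contra t₁ t₂ t₃ with normalise v t₁ | normalise v t₂ | normalise v t₃
    ... | Z₁ , v₁ , a₁ , q₁ , d₁ | Z₂ , v₂ , a₂ , q₂ , d₂ | Z₃ , v₃ , a₃ , q₃ , d₃ =
      1+n≰n (≤-trans four three)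
      where
      U U′ : V → Bool
      U u = Z₁ u ∨ Z₂ u
      U′ u = U u ∨ Z₃ u
      y : V
      y = proj₁ la
      y₁ : Z₁ y ≡ true
      y₁ = far Z₁ (proj₂ la) v₁ a₁
      yU : U y ≡ true
      yU rewrite y₁ = refl
      vU : U v ≡ false
      vU rewrite v₁ | v₂ = refl
      vU′ : U′ v ≡ false
      vU′ rewrite vU | v₃ = refl
      three : d U′ ≤ 3
      three = union-tight conn U Z₃ vU v₃ yU (far Z₃ (proj₂ la) v₃ a₃)
        (union-tight conn Z₁ Z₂ v₁ v₂ y₁ (far Z₂ (proj₂ la) v₂ a₂) d₁ d₂) d₃
      in₁ : ∀ {u} → Z₁ u ≡ true → U′ u ≡ true
      in₁ p rewrite p = refl
      in₂ : ∀ {u} → Z₂ u ≡ true → U′ u ≡ true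
      in₂ {u} p rewrite p | Boolₚ.∨-zeroʳ (Z₁ u) = refl
      in₃ : ∀ {u} → Z₃ u ≡ true → U′ u ≡ true
      in₃ {u} p rewrite p = Boolₚ.∨-zeroʳ (U u)
      crossing : ∀ {e w} → Link v e w → U′ w ≡ true → cross U′ e ≡ true
      crossing l p = cross-link U′ (link-sym l) p vU′
      f₀ = crossing (proj₂ la) (in₁ y₁)
      f₁ = crossing (proj₂ l₁) (in₁ (far Z₁ (proj₂ l₁) v₁ q₁))
      f₂ = crossing (proj₂ l₂) (in₂ (far Z₂ (proj₂ l₂) v₂ q₂))
      f₃ = crossing (proj₂ l₃) (in₃ (far Z₃ (proj₂ l₃) v₃ q₃))
      c : E → Bool
      c = cross U′
      g₁ = ∖-intro c f₁ n₁
      g₂ = ∖-intro (c ∖ a) (∖-intro c f₂ n₂) n₂₁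
      g₃ = ∖-intro ((c ∖ a) ∖ b₁) (∖-intro (c ∖ a) (∖-intro c f₃ n₃) n₃₁) n₃₂
      four : 4 ≤ d U′
      four = ≤-trans (m≤m+n 4 _) (≤-reflexive (sym (trans (count-∖ c a f₀) (cong suc
        (trans (count-∖ (c ∖ a) b₁ g₁) (cong suc
        (trans (count-∖ ((c ∖ a) ∖ b₁) b₂ g₂) (cong suc (count-∖ (((c ∖ a) ∖ b₁) ∖ b₂) b₃ g₃)))))))))
    go : ∃[ ea ] ∃[ eb ] (At ea v × At eb v × ea ≢ eb × ¬ Tight ea eb)
    go with tight? a b₁ | tight? a b₂ | tight? a b₃
    ... | no t | _ | _ = a , b₁ , link-atˡ (proj₂ la) , link-atˡ (proj₂ l₁) , (n₁ ∘ sym) , t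
    ... | _ | no t | _ = a , b₂ , link-atˡ (proj₂ la) , link-atˡ (proj₂ l₂) , (n₂ ∘ sym) , t
    ... | _ | _ | no t = a , b₃ , link-atˡ (proj₂ la) , link-atˡ (proj₂ l₃) , (n₃ ∘ sym) , t
    ... | yes t₁ | yes t₂ | yes t₃ = ⊥-elim (contra t₁ t₂ t₃)

  other-vertex : 2 ≤ #V → ∀ (v : V) → ∃[ w ] w ≢ v
  other-vertex = lem
    where
    lem : ∀ {n} → 2 ≤ n → ∀ (v : Fin n) → ∃[ w ] w ≢ v
    lem (s≤s (s≤s _)) zero    = suc zero , λ ()
    lem (s≤s (s≤s _)) (suc v) = zero , λ ()

  degree≥3 : Conn3 → 2 ≤ #V → ∀ v → 3 ≤ degree v
  degree≥3 conn two v with other-vertex two v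
  ... | w , w≢v = conn (λ u → does (u ≟ v)) {v} {w} (yes′ v) (no′ w≢v)
    where
    yes′ : ∀ u → does (u ≟ u) ≡ true
    yes′ u with u ≟ u
    ... | yes _ = refl
    ... | no  q = ⊥-elim (q refl)
    no′ : ∀ {u w} → u ≢ w → does (u ≟ w) ≡ false
    no′ {u} {w} q with u ≟ w
    ... | yes p = ⊥-elim (q p)
    ... | no  _ = refl

  loop-uncrossed : ∀ (Z : V → Bool) {e} → initial e ≡ terminal e → cross Z e ≡ true → ⊥
  loop-uncrossed Z {e} p h with () ← trans (sym h) (trans (cong (λ u → Z u xor Z (terminal e)) p) (Boolₚ.xor-same (Z (terminal e))))

  -- A loop crosses no cut, hence forms no tight pair, and one of its ends can be moved together
  -- with an end of another edge.
  loop-pair : Conn3 → 2 ≤ #V → ∀ e → initial e ≡ terminal e →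
    ∃[ eb ] (At eb (initial e) × e ≢ eb × ¬ Tight e eb)
  loop-pair conn two e p with pick-one (cross (λ u → does (u ≟ initial e))) (degree≥3 conn two (initial e))
  ... | eb , c , _ with link-cross (λ u → does (u ≟ initial e)) c
  ... | u , w , l , q , _ with u ≟ initial e
  ... | yes refl = eb , link-atˡ l , (λ { refl → loop-uncrossed (λ u → does (u ≟ initial e)) p c }) ,
                   λ { (S , h , _) → loop-uncrossed (lookup S) p h }
  ... | no _ with () ← q

Cubic : OrientedGraph → Set
Cubic G = (∀ v → Cuts.degree G v ≡ 3) × (∀ e → initial e ≢ terminal e)
  where open OrientedGraph G

min-edges : ∀ {G} → let open OrientedGraph G in Cuts.Conn3 G → 2 ≤ #V → #V * 3 ≤ #E * 2
min-edges {G} conn two = ≤-trans (≤-reflexive (sym (Cuts.∑-const G (OrientedGraph.#V G) 3)))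
  (≤-trans (∑-mono (Pairing.degree≥3 G conn two)) (Cuts.handshake-≤ G))

Reducible : OrientedGraph → Set
Reducible G = ∃[ v ] ∃[ ea ] ∃[ eb ] (Links.At G ea v × Links.At G eb v × ea ≢ eb × ¬ Pairing.Tight G ea eb)

cubic-or-reducible : ∀ G → Cuts.Conn3 G → 2 ≤ OrientedGraph.#V G → Cubic G ⊎ Reducible G
cubic-or-reducible G conn two with any? (λ e → OrientedGraph.initial G e ≟ OrientedGraph.terminal G e)
                                 | any? (λ v → 4 ≤? Cuts.degree G v)
... | yes (e , p) | _ with Pairing.loop-pair G conn two e p
...   | eb , at-b , e≢ , ¬t = inj₂ (_ , e , eb , inj₁ refl , at-b , e≢ , ¬t)
cubic-or-reducible G conn two | no _ | yes (v , q) = inj₂ (v , Pairing.pair G conn v q)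
cubic-or-reducible G conn two | no ¬l | no ¬q = inj₁
  ((λ v → ≤-antisym (≤-pred (≰⇒> λ p → ¬q (v , p))) (Pairing.degree≥3 G conn two v)) , λ e p → ¬l (e , p))

CubicGood : Set
CubicGood = ∀ G → Cuts.Conn3 G → Cubic G → 2 ≤ OrientedGraph.#V G →
  11 ≤ OrientedGraph.#E G ∸ OrientedGraph.#V G → Good G

module _ (cubic-good : CubicGood) where

  -- `k` bounds 2 |E| - 3 |V|, which a split lowers by one and which `min-edges` keeps from becoming
  -- negative. So the splitting ends at a cubic graph.
  reduce : ∀ k G → let open OrientedGraph G in
    Cuts.Conn3 G → 2 ≤ #V → 11 ≤ #E ∸ #V → #E * 2 ≤ k + #V * 3 → Good G
  reduce-cases : ∀ k G → let open OrientedGraph G in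
    Cuts.Conn3 G → 2 ≤ #V → 11 ≤ #E ∸ #V → #E * 2 ≤ k + #V * 3 → Cubic G ⊎ Reducible G → Good G

  reduce k G conn two big m = reduce-cases k G conn two big m (cubic-or-reducible G conn two)

  reduce-cases k G conn two big m (inj₁ cubic) = cubic-good G conn cubic two big
  reduce-cases k G conn two big m (inj₂ (v , ea , eb , at-a , at-b , a≢b , ¬t)) =
    good-split G v at-a at-b a≢b (fuel k m)
    where
    open OrientedGraph G
    open SplitPair G v at-a at-b a≢b
    open Split G v mi mt
    conn′ : Cuts.Conn3 split
    conn′ = conn3-split conn (Pairing.untight G ¬t)
    two′ : 2 ≤ suc #V
    two′ = m≤n⇒m≤1+n two
    fuel : ∀ k → #E * 2 ≤ k + #V * 3 → Good split
    fuel zero    m = ⊥-elim (1+n≰n (≤-trans (≤-pred (≤-pred (min-edges {split} conn′ two′))) m))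
    fuel (suc k) m = reduce k split conn′ two′ big
      (≤-trans (s≤s (s≤s m)) (≤-reflexive (trans (cong (3 +_) (+-comm k (#V * 3))) (+-comm (3 + #V * 3) k))))

-- Decomposition of cubic graphs

add : ∀ {n} → Fin n → (Fin n → Bool) → Fin n → Bool
add x S v = S v ∨ does (v ≟ x)

add-here : ∀ {n} (x : Fin n) S → add x S x ≡ true
add-here x S with x ≟ x
... | yes _ = Boolₚ.∨-zeroʳ (S x)
... | no  q = ⊥-elim (q refl)

add-old : ∀ {n} (x : Fin n) S {v} → S v ≡ true → add x S v ≡ true
add-old x S p rewrite p = refl

add-elim : ∀ {n} (x : Fin n) S {v} → add x S v ≡ true → S v ≡ true ⊎ v ≡ x
add-elim x S {v} h with S v | v ≟ x
... | true  | _     = inj₁ refl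
... | false | yes p = inj₂ p
... | false | no  _ with () ← h

∧-left : ∀ a {b} → a ∧ b ≡ true → a ≡ true
∧-left true h = refl

∧-right : ∀ a {b} → a ∧ b ≡ true → b ≡ true
∧-right true h = h

true≢false : ∀ {A : Set} {b} → b ≡ true → b ≡ false → A
true≢false refl ()

count-⊂ : ∀ {n} {p q : Fin n → Bool} → (∀ {i} → p i ≡ true → q i ≡ true) →
  ∀ j → q j ≡ true → p j ≡ false → suc (count p) ≤ count q
count-⊂ {p = p} {q} sub j qj pj = ≤-trans (≤-reflexive (sym (count-toggle-on p j pj))) (∑-mono le)
  where
  le : ∀ i → ⟦ toggle p j i ⟧ ≤ ⟦ q i ⟧
  le i with i ≟ j
  ... | yes refl rewrite pj | qj = ≤-refl
  ... | no  _ with p i in eq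
  ...   | true  rewrite sub eq = ≤-refl
  ...   | false = z≤n

count-pos : ∀ {n} (p : Fin n → Bool) i → p i ≡ true → 1 ≤ count p
count-pos p i h = ≤-trans (s≤s z≤n) (≤-reflexive (sym (count-∖ p i h)))

module CubicGraph (G : OrientedGraph) (conn3 : Cuts.Conn3 G) (cubic : Cubic G) where
  open OrientedGraph G
  open Cuts G

  VSet : Set
  VSet = V → Bool

  link≢ : ∀ {a e c} → Link a e c → a ≢ c
  link≢ (along p q)   refl = proj₂ cubic _ (trans p (sym q))
  link≢ (against p q) refl = proj₂ cubic _ (trans p (sym q))

  link-target : ∀ {a e c c′} → Link a e c → Link a e c′ → c ≡ c′
  link-target l l′ with at-link l′ (link-atʳ l)
  ... | inj₁ p = ⊥-elim (link≢ l (sym p))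
  ... | inj₂ p = p

  opaque
    link? : ∀ a e c → Dec (Link a e c)
    link? a e c with initial e ≟ a | terminal e ≟ c | initial e ≟ c | terminal e ≟ a
    ... | yes p | yes q | _ | _ = yes (along p q)
    ... | _ | _ | yes p | yes q = yes (against p q)
    ... | no p | _ | no q | _ = no λ { (along x _) → p x ; (against x _) → q x }
    ... | no p | _ | _ | no q = no λ { (along x _) → p x ; (against _ x) → q x }
    ... | _ | no p | no q | _ = no λ { (along _ x) → p x ; (against x _) → q x }
    ... | _ | no p | _ | no q = no λ { (along _ x) → p x ; (against _ x) → q x }

  record Star (x : V) (e₁ e₂ e₃ : E) : Set where
    constructor star
    field
      at₁ : At e₁ x
      at₂ : At e₂ x
      at₃ : At e₃ x
      e₁≢e₂ : e₁ ≢ e₂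
      e₁≢e₃ : e₁ ≢ e₃
      e₂≢e₃ : e₂ ≢ e₃
      only : ∀ {e} → At e x → e ≡ e₁ ⊎ e ≡ e₂ ⊎ e ≡ e₃

  rotate : ∀ {x a b c} → Star x a b c → Star x b c a
  rotate (star p q r ab ac bc all) = star q r p bc (ab ∘ sym) (ac ∘ sym)
    λ a → [ inj₂ ∘ inj₂ , [ inj₁ , inj₂ ∘ inj₁ ]′ ]′ (all a)

  swap₂₃ : ∀ {x a b c} → Star x a b c → Star x a c b
  swap₂₃ (star p q r ab ac bc all) = star p r q ac ab (bc ∘ sym)
    λ a → [ inj₁ , [ inj₂ ∘ inj₂ , inj₂ ∘ inj₁ ]′ ]′ (all a)

  only-two : ∀ {x a b c} → Star x a b c → ∀ {e} → At e x → e ≢ a → e ≢ b → e ≡ c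
  only-two s at p q with Star.only s at
  ... | inj₁ r        = ⊥-elim (p r)
  ... | inj₂ (inj₁ r) = ⊥-elim (q r)
  ... | inj₂ (inj₂ r) = r

  opaque
    star-of : ∀ x → ∃[ e₁ ] ∃[ e₂ ] ∃[ e₃ ] Star x e₁ e₂ e₃
    star-of x with pick-one (cross (λ u → does (u ≟ x))) (≤-reflexive (sym (proj₁ cubic x)))
    ... | a , pa , h₂ with pick-one (cross (λ u → does (u ≟ x)) ∖ a) h₂
    ... | b , pb , h₁ with pick-one ((cross (λ u → does (u ≟ x)) ∖ a) ∖ b) h₁
    ... | c , pc , _ with ∖-true (cross (λ u → does (u ≟ x))) pb | ∖-true (cross (λ u → does (u ≟ x)) ∖ a) pc
    ... | pb′ , b≢a | pc′ , c≢b with ∖-true (cross (λ u → does (u ≟ x))) pc′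
    ... | pc″ , c≢a = a , b , c , star (at pa) (at pb′) (at pc″) (b≢a ∘ sym) (c≢a ∘ sym) (c≢b ∘ sym) complete
      where
      δ : E → Bool
      δ = cross (λ u → does (u ≟ x))
      at : ∀ {e} → δ e ≡ true → At e x
      at {e} h with initial e ≟ x | terminal e ≟ x
      ... | yes p | _     = inj₁ p
      ... | no  _ | yes q = inj₂ q
      ... | no  _ | no  _ with () ← h
      ta : ∀ {e} → At e x → δ e ≡ true
      ta {e} h with initial e ≟ x | terminal e ≟ x
      ... | yes p | yes q = ⊥-elim (proj₂ cubic e (trans p (sym q)))
      ... | yes p | no  _ = refl
      ... | no  _ | yes q = refl
      ta {e} (inj₁ h) | no p | no _ = ⊥-elim (p h)
      ta {e} (inj₂ h) | no _ | no q = ⊥-elim (q h)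
      none : count (((δ ∖ a) ∖ b) ∖ c) ≡ 0
      none = ℕₚ.suc-injective (ℕₚ.suc-injective (ℕₚ.suc-injective (trans (sym three) (proj₁ cubic x))))
        where
        three : count δ ≡ 3 + count (((δ ∖ a) ∖ b) ∖ c)
        three = trans (count-∖ δ a pa) (cong suc
          (trans (count-∖ (δ ∖ a) b pb) (cong suc (count-∖ ((δ ∖ a) ∖ b) c pc))))
      complete : ∀ {e} → At e x → e ≡ a ⊎ e ≡ b ⊎ e ≡ c
      complete {e} h with e ≟ a | e ≟ b | e ≟ c
      ... | yes p | _ | _ = inj₁ p
      ... | _ | yes p | _ = inj₂ (inj₁ p)
      ... | _ | _ | yes p = inj₂ (inj₂ p)
      ... | no p | no q | no r = true≢false
        (∖-intro ((δ ∖ a) ∖ b) (∖-intro (δ ∖ a) (∖-intro δ (ta h) p) q) r) (count-0 (((δ ∖ a) ∖ b) ∖ c) none e)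

  opaque
    third : ∀ {x g o} → At g x → At o x → g ≢ o → ∃[ f ] Star x g o f
    third {x} ag ao g≢o with star-of x
    ... | a , b , c , s with Star.only s ag | Star.only s ao
    ... | inj₁ refl        | inj₁ refl        = ⊥-elim (g≢o refl)
    ... | inj₁ refl        | inj₂ (inj₁ refl) = c , s
    ... | inj₁ refl        | inj₂ (inj₂ refl) = b , swap₂₃ s
    ... | inj₂ (inj₁ refl) | inj₁ refl        = c , rotate (rotate (swap₂₃ s))
    ... | inj₂ (inj₁ refl) | inj₂ (inj₁ refl) = ⊥-elim (g≢o refl)
    ... | inj₂ (inj₁ refl) | inj₂ (inj₂ refl) = a , rotate s
    ... | inj₂ (inj₂ refl) | inj₁ refl        = b , rotate (rotate s)
    ... | inj₂ (inj₂ refl) | inj₂ (inj₁ refl) = a , rotate (swap₂₃ s)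
    ... | inj₂ (inj₂ refl) | inj₂ (inj₂ refl) = ⊥-elim (g≢o refl)

  -- Within S, the set Z is a union of components.
  Closed : VSet → VSet → Set
  Closed S Z = ∀ e → S (initial e) ≡ true → S (terminal e) ≡ true → Z (initial e) ≡ Z (terminal e)

  closed? : ∀ S Z → Dec (Closed S Z)
  closed? S Z = all? λ e → (S (initial e) Boolₚ.≟ true) →-dec
                           ((S (terminal e) Boolₚ.≟ true) →-dec (Z (initial e) Boolₚ.≟ Z (terminal e)))

  closed-link : ∀ {S Z a e c} → Closed S Z → Link a e c → S a ≡ true → S c ≡ true → Z a ≡ Z c
  closed-link cl (along refl refl)   p q = cl _ p q
  closed-link cl (against refl refl) p q = sym (cl _ q p)

  closed-intro : ∀ {S Z} →
    (∀ {a e c} → Link a e c → S a ≡ true → S c ≡ true → Z a ≡ true → Z c ≡ true) → Closed S Z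
  closed-intro {S} {Z} f e p q with Z (initial e) in i | Z (terminal e) in t
  ... | true  | true  = refl
  ... | false | false = refl
  ... | true  | false = trans (sym (f (along {e = e} refl refl) p q i)) t
  ... | false | true  = trans (sym i) (f (against {e = e} refl refl) q p t)

  -- Connectedness of the subgraph induced on `S`, tested on unions of components instead of by
  -- walks. When `S` grows or shrinks, only the test set has to be restricted or extended.
  Conn : VSet → Set
  Conn S = ∀ Z → Closed S Z → ∀ {u w} → S u ≡ true → S w ≡ true → Z u ≡ true → Z w ≡ true

  conn-resp : ∀ {S T} → (∀ v → S v ≡ T v) → Conn S → Conn T
  conn-resp eq c Z cl {u} {w} p q = c Z (λ e a b → cl e (trans (sym (eq _)) a) (trans (sym (eq _)) b))
    (trans (eq u) p) (trans (eq w) q)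

  opaque
    closed-or-edge : ∀ (S Z : VSet) → Closed S Z ⊎
      ∃[ a ] ∃[ e ] ∃[ c ] (Link a e c × S a ≡ true × S c ≡ true × Z a ≡ true × Z c ≡ false)
    closed-or-edge S Z with any? (λ a → any? λ e → any? λ c →
      link? a e c ×-dec ((S a Boolₚ.≟ true) ×-dec ((S c Boolₚ.≟ true) ×-dec ((Z a Boolₚ.≟ true) ×-dec (Z c Boolₚ.≟ false)))))
    ... | yes w = inj₂ w
    ... | no ¬w = inj₁ (closed-intro λ {a} {e} {c} l p q r → Boolₚ.¬-not λ s → ¬w (a , e , c , l , p , q , r , s))

  -- Connected components

  opaque
    Separated : VSet → V → V → Set
    Separated S x y = ∃[ Z ] (Closed S (lookup Z) × lookup Z x ≡ true × lookup Z y ≡ false)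

    separated? : ∀ S x y → Dec (Separated S x y)
    separated? S x y = anySubset? λ Z →
      closed? S (lookup Z) ×-dec ((lookup Z x Boolₚ.≟ true) ×-dec (lookup Z y Boolₚ.≟ false))

    -- The component of `x` as the intersection of all closed sets that contain `x`; these are
    -- finitely many, so membership is Boolean.
    comp : VSet → V → VSet
    comp S x y = not (does (separated? S x y))

    comp-least : ∀ {S x y} → comp S x y ≡ true → ∀ Z → Closed S Z → Z x ≡ true → Z y ≡ true
    comp-least {S} {x} {y} h Z cl zx with separated? S x y
    ... | yes _ with () ← h
    ... | no ¬s = Boolₚ.¬-not λ zy → ¬s (tabulate Z ,
        (λ e p q → trans (lookup∘tabulate Z _) (trans (cl e p q) (sym (lookup∘tabulate Z _)))) ,
        trans (lookup∘tabulate Z x) zx , trans (lookup∘tabulate Z y) zy)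

    comp-greatest : ∀ {S x y} → (∀ Z → Closed S Z → Z x ≡ true → Z y ≡ true) → comp S x y ≡ true
    comp-greatest {S} {x} {y} f with separated? S x y
    ... | yes (Z , cl , zx , zy) = true≢false (f (lookup Z) cl zx) zy
    ... | no _ = refl

    comp-self : ∀ S x → comp S x x ≡ true
    comp-self S x = comp-greatest {S} {x} {x} λ _ _ p → p

    comp-closed : ∀ S x → Closed S (comp S x)
    comp-closed S x = closed-intro λ {a} {e} {c} l p q h → comp-greatest {S} {x} {c} λ Z cl zx →
      trans (sym (closed-link {S} {Z} cl l p q)) (comp-least {S} {x} {a} h Z cl zx)

  comp-⊆ : ∀ {S x y} → S x ≡ true → comp S x y ≡ true → S y ≡ true
  comp-⊆ {S} {x} {y} sx h = comp-least {S} {x} {y} h S (λ e p q → trans p (sym q)) sx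

  -- The part of the component on which `Z` agrees with `Z x` is closed in `S` and contains `x`, so
  -- it is the whole component.
  comp-conn : ∀ S x → Conn (comp S x)
  comp-conn S x Z cl {u} {w} cu cw zu = back (Z x) zu (agree cu) (agree cw)
    where
    C Y : VSet
    C = comp S x
    Y v = C v ∧ not (Z v xor Z x)
    closedY : Closed S Y
    closedY e p q with comp-closed S x e p q
    ... | eq with C (initial e) in ci | C (terminal e) in ct
    ...   | false | false = refl
    ...   | true  | true rewrite cl e ci ct = refl
    agree : ∀ {v} → C v ≡ true → not (Z v xor Z x) ≡ true
    agree {v} h = ∧-right (C v) (comp-least {S} {x} {v} h Y closedY here-x)
      where
      here-x : Y x ≡ true
      here-x rewrite comp-self S x | Boolₚ.xor-same (Z x) = refl
    back : ∀ b {c d} → c ≡ true → not (c xor b) ≡ true → not (d xor b) ≡ true → d ≡ true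
    back true  {d = true} _ _ _ = refl
    back true  {d = false} _ _ ()
    back false refl () _

  rest : VSet → VSet → VSet
  rest K U v = not (K v) ∧ not (U v)

  rest-intro : ∀ K U {v} → K v ≡ false → U v ≡ false → rest K U v ≡ true
  rest-intro K U p q rewrite p | q = refl

  rest-∉K : ∀ K U {v} → rest K U v ≡ true → K v ≡ false
  rest-∉K K U {v} h with K v
  ... | false = refl

  rest-∉U : ∀ K U {v} → rest K U v ≡ true → U v ≡ false
  rest-∉U K U {v} h with K v | U v
  ... | false | false = refl

  data Place (K U : VSet) (v : V) : Set where
    inK : K v ≡ true → Place K U v
    inU : U v ≡ true → Place K U v
    inR : rest K U v ≡ true → Place K U v

  place : ∀ K U v → Place K U v
  place K U v with K v in k | U v in u
  ... | true  | _     = inK k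
  ... | false | true  = inU u
  ... | false | false = inR (rest-intro K U k u)

  add-false : ∀ (x : V) (S : VSet) {v} → S v ≡ false → v ≢ x → add x S v ≡ false
  add-false x S {v} p q with v ≟ x
  ... | yes r = ⊥-elim (q r)
  ... | no  _ rewrite p = refl

  add-out : ∀ (x : V) (S : VSet) {v} → add x S v ≡ false → S v ≡ false × v ≢ x
  add-out x S {v} h with S v | v ≟ x
  ... | false | no q = refl , q
  ... | true  | _ with () ← h
  ... | false | yes _ with () ← h

  Disjoint : VSet → VSet → Set
  Disjoint K U = ∀ {v : V} → K v ≡ true → U v ≡ false

  Neighbour : VSet → V → Set
  Neighbour K x = ∃[ o ] ∃[ k ] (Link x o k × K k ≡ true)

  opaque
    neighbour? : ∀ K x → Dec (Neighbour K x)
    neighbour? K x = any? λ o → any? λ k → link? x o k ×-dec (K k Boolₚ.≟ true)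

  Enters : VSet → E → VSet → Set
  Enters U s C = ∃[ w ] ∃[ y ] (Link w s y × U w ≡ true × C y ≡ true)

  OneEntry : VSet → VSet → Set
  OneEntry U C = ∀ {s s′ : E} → Enters U s C → Enters U s′ C → s ≡ s′

  -- K cannot be enlarged by an adjacent vertex in such a way that a component
  -- with two edges to U remains.
  Minimal : VSet → VSet → Set
  Minimal K U = ∀ {a} → rest K U a ≡ true → Neighbour K a →
    ∀ (C : VSet) → (∀ {v} → C v ≡ true → rest (add a K) U v ≡ true) → Closed (rest (add a K) U) C → Conn C → OneEntry U C

  -- `K` is the later part, and `U` the earlier part together with the vertices already passed. At
  -- `x`, the edge `g` leads back, `o` to `K` and `f` onward; the last condition of `last` says that
  -- the path exhausts `rest K U`.
  data Path (K : VSet) : VSet → E → V → Set where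
    last : ∀ {U g x o f k u} → K x ≡ false → U x ≡ false → Star x g o f →
      Link x o k → K k ≡ true → Link x f u → U u ≡ true →
      (∀ {v : V} → rest K U v ≡ true → v ≡ x) → Path K U g x
    cons : ∀ {U g x o f k y} → K x ≡ false → U x ≡ false → Star x g o f →
      Link x o k → K k ≡ true → Link x f y → Path K (add x U) f y → Path K U g x

  module _ {K U : VSet} (disj : Disjoint K U) (connR : Conn (rest K U)) (minimal : Minimal K U)
           {w : V} {g : E} {x : V} (gl : Link w g x) (Uw : U w ≡ true) (Rx : rest K U x ≡ true)
           {w₂ : V} {g₂ : E} {y : V} (gl₂ : Link w₂ g₂ y) (Uw₂ : U w₂ ≡ true) (Ry : rest K U y ≡ true) (g≢g₂ : g ≢ g₂) where

    private
      R : VSet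
      R = rest K U

      M : V → VSet
      M a = rest (add a K) U

      M-intro : ∀ a {v} → R v ≡ true → v ≢ a → M a v ≡ true
      M-intro a r n = rest-intro (add a K) U (add-false a K (rest-∉K K U r) n) (rest-∉U K U r)

      M-R : ∀ a {v} → M a v ≡ true → R v ≡ true × v ≢ a
      M-R a {v} m with add-out a K (rest-∉K (add a K) U m)
      ... | p , q = rest-intro K U p (rest-∉U (add a K) U m) , q

      R-K : ∀ {v} {A : Set} → R v ≡ true → K v ≡ true → A
      R-K r k = true≢false k (rest-∉K K U r)

      R-U : ∀ {v} {A : Set} → R v ≡ true → U v ≡ true → A
      R-U r u = true≢false u (rest-∉U K U r)

    -- Otherwise take a ∈ R adjacent to K such that the component of x in R - a
    -- is as small as possible.  It has a single edge to U, a single edge to a,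
    -- hence an edge to K, whose end a′ does better than a.
    attached : ∀ n {a o k} → R a ≡ true → Link a o k → K k ≡ true →
      count (comp (M a) x) ≤ n → Neighbour K x
    attached n {a} {o} {k} Ra lo Kk size with neighbour? K x
    ... | yes p = p
    ... | no ¬x = ⊥-elim (main (closed-or-edge R C))
      where
      x≢a : x ≢ a
      x≢a refl = ¬x (o , k , lo , Kk)
      C : VSet
      C = comp (M a) x
      Cx : C x ≡ true
      Cx = comp-self (M a) x
      C-M : ∀ {v} → C v ≡ true → M a v ≡ true
      C-M {v} = comp-⊆ {M a} {x} {v} (M-intro a Rx x≢a)
      C-R : ∀ {v} → C v ≡ true → R v ≡ true
      C-R c = proj₁ (M-R a (C-M c))
      C-≢ : ∀ {v} → C v ≡ true → v ≢ a
      C-≢ c = proj₂ (M-R a (C-M c))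
      C-link : ∀ {p e q} → Link p e q → C p ≡ true → R q ≡ true → q ≢ a → C q ≡ true
      C-link l c r n = trans (sym (closed-link {M a} {C} (comp-closed (M a) x) l (C-M c) (M-intro a r n))) c
      one : OneEntry U C
      one = minimal Ra (o , k , lo , Kk) C C-M (comp-closed (M a) x) (comp-conn (M a) x)
      Cy : C y ≡ false
      Cy = Boolₚ.¬-not λ c → g≢g₂ (one (w , x , gl , Uw , Cx) (w₂ , y , gl₂ , Uw₂ , c))
      main : Closed R C ⊎ ∃[ p ] ∃[ f₁ ] ∃[ q ] (Link p f₁ q × R p ≡ true × R q ≡ true × C p ≡ true × C q ≡ false) → ⊥
      main (inj₁ cl) = C-≢ (connR C cl Rx Ra Cx) refl
      main (inj₂ (p , f₁ , q , l₁ , Rp , Rq , Cp , ¬Cq)) with q ≟ a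
      ... | no q≢a = true≢false (C-link l₁ Cp Rq q≢a) ¬Cq
      ... | yes refl with third (link-atʳ l₁) (link-atˡ lo) f₁≢o
        where
        f₁≢o : f₁ ≢ o
        f₁≢o refl with at-link lo (link-atˡ l₁)
        ... | inj₁ refl = link≢ l₁ refl
        ... | inj₂ refl = R-K Rp Kk
      ... | f₂ , s = cut (cut3 conn3 C Cx (Boolₚ.¬-not λ c → R-U (C-R c) Uw) g f₁)
        where
        -- If `f₂` led into `C` as well, `a` would have edges to `C` and `K` only, so `C` and `a`
        -- would make up `R`. Then `y` would be `a`, which has no edge left for `g₂`.
        f₂-out : ∀ {p₂} → Link a f₂ p₂ → C p₂ ≡ true → ⊥
        f₂-out {p₂} l₂ Cp₂ with add-elim a C (connR Z closedZ Rx Ry (add-old a C Cx))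
          where
          Z : VSet
          Z = add a C
          closedZ : Closed R Z
          closedZ = closed-intro λ {b} {e} {c} l Rb Rc Zb → step l Rb Rc Zb
            where
            step : ∀ {b e c} → Link b e c → R b ≡ true → R c ≡ true → Z b ≡ true → Z c ≡ true
            go : ∀ {b e c} → Dec (c ≡ a) → Link b e c → R b ≡ true → R c ≡ true → C b ≡ true ⊎ b ≡ a → Z c ≡ true
            go (yes refl) l Rb Rc Zb = add-here a C
            go (no c≢a) l Rb Rc (inj₁ Cb) = add-old a C (C-link l Cb Rc c≢a)
            go (no c≢a) l Rb Rc (inj₂ refl) with Star.only s (link-atˡ l)
            ... | inj₁ refl        = subst (λ v → Z v ≡ true) (link-target (link-sym l₁) l) (add-old a C Cp)
            ... | inj₂ (inj₁ refl) = R-K Rc (subst (λ v → K v ≡ true) (link-target lo l) Kk)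
            ... | inj₂ (inj₂ refl) = subst (λ v → Z v ≡ true) (link-target l₂ l) (add-old a C Cp₂)
            step {b} {e} {c} l Rb Rc Zb = go (c ≟ a) l Rb Rc (add-elim a C Zb)
        ... | inj₁ c = true≢false c Cy
        ... | inj₂ refl with Star.only s (link-atʳ gl₂)
        ...   | inj₁ refl        = R-U Rp (subst (λ v → U v ≡ true) (link-target (link-sym gl₂) (link-sym l₁)) Uw₂)
        ...   | inj₂ (inj₁ refl) = true≢false (subst (λ v → U v ≡ true) (link-target (link-sym gl₂) lo) Uw₂) (disj Kk)
        ...   | inj₂ (inj₂ refl) = R-U (C-R Cp₂) (subst (λ v → U v ≡ true) (link-target (link-sym gl₂) l₂) Uw₂)
        cut : ∃[ e ] ∃[ b ] ∃[ c ] (Link b e c × C b ≡ true × C c ≡ false × e ≢ g × e ≢ f₁) → ⊥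
        cut (e , b , c , l , Cb , ¬Cc , e≢g , e≢f₁) with place K U c
        ... | inU Uc = e≢g (one (c , b , link-sym l , Uc , Cb) (w , x , gl , Uw , Cx))
        cut (e , b , c , l , Cb , ¬Cc , e≢g , e≢f₁) | inR Rc with c ≟ a
        ...   | no c≢a = true≢false (C-link l Cb Rc c≢a) ¬Cc
        ...   | yes refl with Star.only s (link-atʳ l)
        ...     | inj₁ p = e≢f₁ p
        ...     | inj₂ (inj₁ refl) = R-K (C-R Cb) (subst (λ v → K v ≡ true) (link-target lo (link-sym l)) Kk)
        ...     | inj₂ (inj₂ refl) = f₂-out (link-sym l) Cb
        cut (e , b , c , l , Cb , ¬Cc , e≢g , e≢f₁) | inK Kc = better n size
          where
          C′ : VSet
          C′ = comp (M b) x
          x≢b : x ≢ b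
          x≢b refl = ¬x (e , c , l , Kc)
          C′x : C′ x ≡ true
          C′x = comp-self (M b) x
          C′-M : ∀ {v} → C′ v ≡ true → M b v ≡ true
          C′-M {v} = comp-⊆ {M b} {x} {v} (M-intro b Rx x≢b)
          C′-≢ : ∀ {v} → C′ v ≡ true → v ≢ b
          C′-≢ h = proj₂ (M-R b (C′-M h))
          C′-link : ∀ {p e q} → Link p e q → C′ p ≡ true → R q ≡ true → q ≢ b → C′ q ≡ true
          C′-link l c r n = trans (sym (closed-link {M b} {C′} (comp-closed (M b) x) l (C′-M c) (M-intro b r n))) c
          Rb : R b ≡ true
          Rb = C-R Cb
          ¬C′a : C′ a ≡ false
          -- Otherwise the union of `C` and `C′` is closed in `R`, hence contains `y`. Then `y` lies
          -- in `C′`, which is entered by both `g` and `g₂`, against minimality.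
          ¬C′a = Boolₚ.¬-not λ C′a → g≢g₂ (minimal Rb (e , c , l , Kc) C′ C′-M (comp-closed (M b) x) (comp-conn (M b) x)
              (w , x , gl , Uw , C′x) (w₂ , y , gl₂ , Uw₂ , C′y C′a))
            where
            C′y : C′ a ≡ true → C′ y ≡ true
            C′y C′a with C y in cy | connR (λ v → C v ∨ C′ v) (closed-intro step) Rx Ry (cong (_∨ C′ x) Cx)
              where
              ∨-elim : ∀ p q → p ∨ q ≡ true → p ≡ true ⊎ q ≡ true
              ∨-elim true  q h = inj₁ refl
              ∨-elim false q h = inj₂ h
              step : ∀ {p e q} → Link p e q → R p ≡ true → R q ≡ true → C p ∨ C′ p ≡ true → C q ∨ C′ q ≡ true
              step {p} {e} {q} l Rp Rq h with C q in cq
              ... | true = refl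
              ... | false with ∨-elim (C p) (C′ p) h
              ...   | inj₁ Cp with q ≟ a
              ...     | yes refl = C′a
              ...     | no q≢a = true≢false (C-link l Cp Rq q≢a) cq
              step {p} {e} {q} l Rp Rq h | false | inj₂ C′p = C′-link l C′p Rq λ { refl → true≢false Cb cq }
            ... | true  | _ = true≢false cy Cy
            ... | false | h = h
          -- `C′` avoids `a`, so it stays inside `C`, and it lacks the vertex `b` of `C`.
          smaller : suc (count C′) ≤ count C
          smaller = count-⊂ C′⊆C b Cb (Boolₚ.¬-not λ h → C′-≢ h refl)
            where
            step : ∀ {p e q} → Link p e q → M b p ≡ true → M b q ≡ true → C′ p ∧ C p ≡ true → C′ q ∧ C q ≡ true
            step {p} {e} {q} l Mp Mq h = cong₂ _∧_ C′q (C-link l (∧-right (C′ p) h) (proj₁ (M-R b Mq)) λ { refl → true≢false C′q ¬C′a })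
              where
              C′q : C′ q ≡ true
              C′q = C′-link l (∧-left (C′ p) h) (proj₁ (M-R b Mq)) (proj₂ (M-R b Mq))
            C′⊆C : ∀ {v} → C′ v ≡ true → C v ≡ true
            C′⊆C {v} h = ∧-right (C′ v) (comp-least {M b} {x} {v} h (λ v → C′ v ∧ C v)
              (closed-intro step) (cong₂ _∧_ C′x Cx))
          better : ∀ n → count C ≤ n → ⊥
          better zero    size = 1+n≰n (≤-trans smaller (≤-trans size z≤n))
          better (suc n) size = ¬x (attached n Rb l Kc (≤-pred (≤-trans smaller size)))

  transport : ∀ (S : VSet) {u v} → u ≡ v → S u ≡ true → S v ≡ true
  transport S refl p = p

  isolated : ∀ {S x} → Conn S → S x ≡ true → (∀ {e c} → Link x e c → S c ≡ true → ⊥) →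
    ∀ {v} → S v ≡ true → v ≡ x
  isolated {S} {x} conn Sx none {v} Sv with v ≟ x | conn (λ u → does (u ≟ x)) (closed-intro step) Sx Sv here-x
    where
    here-x : does (x ≟ x) ≡ true
    here-x with x ≟ x
    ... | yes _ = refl
    ... | no  q = ⊥-elim (q refl)
    step : ∀ {b e c} → Link b e c → S b ≡ true → S c ≡ true → does (b ≟ x) ≡ true → does (c ≟ x) ≡ true
    step {b} l Sb Sc h with b ≟ x
    ... | yes refl = ⊥-elim (none l Sc)
    ... | no _ with () ← h
  ... | yes p | _ = p
  ... | no _ | ()

  rest-∉ : ∀ K U {v} {A : Set} → rest K U v ≡ true → K v ≡ true ⊎ U v ≡ true → A
  rest-∉ K U r (inj₁ k) = true≢false k (rest-∉K K U r)
  rest-∉ K U r (inj₂ u) = true≢false u (rest-∉U K U r)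

  exits : ∀ {x g o f w k z} → Star x g o f → Link x g w → Link x o k → Link x f z →
    ∀ {e c} → Link x e c → (e ≡ g × c ≡ w) ⊎ (e ≡ o × c ≡ k) ⊎ (e ≡ f × c ≡ z)
  exits s lg lo lf l with Star.only s (link-atˡ l)
  ... | inj₁ refl        = inj₁ (refl , link-target l lg)
  ... | inj₂ (inj₁ refl) = inj₂ (inj₁ (refl , link-target l lo))
  ... | inj₂ (inj₂ refl) = inj₂ (inj₂ (refl , link-target l lf))

  -- The situation after walking along the path from w through x to z.
  module Step {K U : VSet} (disj : Disjoint K U) (connR : Conn (rest K U)) (minimal : Minimal K U)
    {w : V} {g : E} {x : V} {o : E} {k : V} {f : E} {z : V} (gl : Link w g x) (Uw : U w ≡ true) (Rx : rest K U x ≡ true)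
    (s : Star x g o f) (lo : Link x o k) (Kk : K k ≡ true) (lf : Link x f z) (Rz : rest K U z ≡ true) where

    U′ : VSet
    U′ = add x U

    exit : ∀ {e c} → Link x e c → (e ≡ g × c ≡ w) ⊎ (e ≡ o × c ≡ k) ⊎ (e ≡ f × c ≡ z)
    exit = exits s (link-sym gl) lo lf

    exit-R : ∀ {e c} → Link x e c → rest K U c ≡ true → e ≡ f × c ≡ z
    exit-R l Rc with exit l
    ... | inj₁ (_ , refl)        = rest-∉ K U Rc (inj₂ Uw)
    ... | inj₂ (inj₁ (_ , refl)) = rest-∉ K U Rc (inj₁ Kk)
    ... | inj₂ (inj₂ p)          = p

    R′-intro : ∀ {v} → rest K U v ≡ true → v ≢ x → rest K U′ v ≡ true
    R′-intro r n = rest-intro K U′ (rest-∉K K U r) (add-false x U (rest-∉U K U r) n)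

    R′-elim : ∀ {v} → rest K U′ v ≡ true → rest K U v ≡ true × v ≢ x
    R′-elim r with add-out x U (rest-∉U K U′ r)
    ... | p , q = rest-intro K U (rest-∉K K U′ r) p , q

    z≢x : z ≢ x
    z≢x p = link≢ lf (sym p)

    disj′ : Disjoint K U′
    disj′ k = add-false x U (disj k) λ { refl → rest-∉ K U Rx (inj₁ k) }

    -- The only edge at `x` within `rest K U` is `f`, so `x` is a leaf and can be removed. The test
    -- set is extended to `x` by its value at `z`.
    connR′ : Conn (rest K U′)
    connR′ Z cl {u} {v} Ru Rv Zu = lower v (proj₂ (R′-elim Rv))
      (connR Z⁺ (closed-intro λ {b} {e} {c} → step {b} {e} {c})
        (proj₁ (R′-elim Ru)) (proj₁ (R′-elim Rv)) (lift u (proj₂ (R′-elim Ru)) Zu))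
      where
      ext : ∀ {v} → Dec (v ≡ x) → Bool
      ext {v} (yes _) = Z z
      ext {v} (no  _) = Z v
      Z⁺ : VSet
      Z⁺ v = ext (v ≟ x)
      lift : ∀ v → v ≢ x → Z v ≡ true → Z⁺ v ≡ true
      lift v n h with v ≟ x
      ... | yes p = ⊥-elim (n p)
      ... | no  _ = h
      lower : ∀ v → v ≢ x → Z⁺ v ≡ true → Z v ≡ true
      lower v n h with v ≟ x
      ... | yes p = ⊥-elim (n p)
      ... | no  _ = h
      step : ∀ {b e c} → Link b e c → rest K U b ≡ true → rest K U c ≡ true → Z⁺ b ≡ true → Z⁺ c ≡ true
      step {b} {e} {c} l Rb Rc h with b ≟ x | c ≟ x
      ... | yes refl | yes refl = h
      ... | yes refl | no  n    = transport Z (sym (proj₂ (exit-R l Rc))) h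
      ... | no n     | yes refl = transport Z (proj₂ (exit-R (link-sym l) Rb)) h
      ... | no n     | no m     = trans (sym (closed-link {rest K U′} {Z} cl l (R′-intro Rb n) (R′-intro Rc m))) h

    neighbour-x : Neighbour K x
    neighbour-x = o , k , lo , Kk

    -- If `C` contains `z`, then `C` with `x` is entered from `U` by `g` alone, so `f` is the only
    -- entry of `C` from `U′`. If not, `C` is not adjacent to `x`, and minimality with respect to
    -- `U` applies to `C` itself.
    minimal′ : Minimal K U′
    minimal′ {a} Ra nb C C⊆ cl conn {e} {e′} = go (C z Boolₚ.≟ true)
      where
      M : VSet
      M = rest (add a K) U
      M-intro : ∀ {v} → rest (add a K) U′ v ≡ true → M v ≡ true
      M-intro r = rest-intro (add a K) U (rest-∉K (add a K) U′ r) (proj₁ (add-out x U (rest-∉U (add a K) U′ r)))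
      M′-intro : ∀ {v} → M v ≡ true → v ≢ x → rest (add a K) U′ v ≡ true
      M′-intro m n = rest-intro (add a K) U′ (rest-∉K (add a K) U m) (add-false x U (rest-∉U (add a K) U m) n)
      M-R : ∀ {v} → M v ≡ true → rest K U v ≡ true
      M-R m = rest-intro K U (proj₁ (add-out a K (rest-∉K (add a K) U m))) (rest-∉U (add a K) U m)
      C-M : ∀ {v} → C v ≡ true → M v ≡ true
      C-M c = M-intro (C⊆ c)
      C≢x : ∀ {v} → C v ≡ true → v ≢ x
      C≢x c = proj₂ (add-out x U (rest-∉U (add a K) U′ (C⊆ c)))
      Mx : M x ≡ true
      Mx = rest-intro (add a K) U (add-false a K (rest-∉K K U Rx) λ p → proj₂ (R′-elim Ra) (sym p)) (rest-∉U K U Rx)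
      C-link : ∀ {p e q} → Link p e q → C p ≡ true → M q ≡ true → q ≢ x → C q ≡ true
      C-link l c m n = trans (sym (closed-link {rest (add a K) U′} {C} cl l (C⊆ c) (M′-intro m n))) c
      is-f : ∀ {e v} → Link x e v → C v ≡ true → e ≡ f × v ≡ z
      is-f l c = exit-R l (M-R (C-M c))
      go : Dec (C z ≡ true) → Enters U′ e C → Enters U′ e′ C → e ≡ e′
      go (no ¬Cz) p q = minimal (proj₁ (R′-elim Ra)) nb C C-M closedM conn (fromU p) (fromU q)
        where
        fromU : ∀ {e} → Enters U′ e C → Enters U e C
        fromU (u , y , l , U′u , Cy) with add-elim x U U′u
        ... | inj₁ Uu = u , y , l , Uu , Cy
        ... | inj₂ refl = ⊥-elim (¬Cz (transport C (proj₂ (is-f l Cy)) Cy))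
        closedM : Closed M C
        closedM = closed-intro λ {b} {e} {c} l Mb Mc Cb → step l Mc Cb (c ≟ x)
          where
          step : ∀ {b e c} → Link b e c → M c ≡ true → C b ≡ true → Dec (c ≡ x) → C c ≡ true
          step l Mc Cb (yes refl) = ⊥-elim (¬Cz (transport C (proj₂ (is-f (link-sym l) Cb)) Cb))
          step l Mc Cb (no n) = C-link l Cb Mc n
      go (yes Cz) p q = trans (isf p) (sym (isf q))
        where
        C⁺ : VSet
        C⁺ = add x C
        C⁺-M : ∀ {v} → C⁺ v ≡ true → M v ≡ true
        C⁺-M {v} h with add-elim x C h
        ... | inj₁ c = C-M c
        ... | inj₂ refl = Mx
        closed⁺ : Closed M C⁺
        closed⁺ = closed-intro λ {b} {e} {c} l Mb Mc Cb → step l Mc (add-elim x C Cb) (c ≟ x)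
          where
          step : ∀ {b e c} → Link b e c → M c ≡ true → C b ≡ true ⊎ b ≡ x → Dec (c ≡ x) → C⁺ c ≡ true
          step l Mc _ (yes refl) = add-here x C
          step l Mc (inj₁ Cb) (no n) = add-old x C (C-link l Cb Mc n)
          step l Mc (inj₂ refl) (no n) = add-old x C (transport C (sym (proj₂ (exit-R l (M-R Mc)))) Cz)
        conn⁺ : Conn C⁺
        conn⁺ Z clZ {u} {v} Cu Cv Zu = from (add-elim x C Cv) (to (add-elim x C Cu) Zu)
          where
          clC : Closed C Z
          clC e p q = clZ e (add-old x C p) (add-old x C q)
          xz : Z x ≡ Z z
          xz = closed-link {C⁺} {Z} clZ lf (add-here x C) (add-old x C Cz)
          to : ∀ {u} → C u ≡ true ⊎ u ≡ x → Z u ≡ true → Z z ≡ true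
          to (inj₁ c) h = conn Z clC c Cz h
          to (inj₂ refl) h = trans (sym xz) h
          from : ∀ {u} → C u ≡ true ⊎ u ≡ x → Z z ≡ true → Z u ≡ true
          from (inj₁ c) h = conn Z clC Cz c h
          from (inj₂ refl) h = trans xz h
        isf : ∀ {e} → Enters U′ e C → e ≡ f
        isf {e} (u , y , l , U′u , Cy) with add-elim x U U′u
        ... | inj₂ refl = proj₁ (is-f l Cy)
        ... | inj₁ Uu with minimal (proj₁ (R′-elim Ra)) nb C⁺ C⁺-M closed⁺ conn⁺
                             (u , y , l , Uu , add-old x C Cy) (w , x , gl , Uw , add-here x C)
        ...   | refl with at-link gl (link-atʳ l)
        ...     | inj₁ refl = rest-∉ K U (M-R (C-M Cy)) (inj₂ Uw)
        ...     | inj₂ refl = ⊥-elim (C≢x Cy refl)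

    module _ {w₂ : V} {g₂ : E} {y : V} (gl₂ : Link w₂ g₂ y) (Uw₂ : U w₂ ≡ true) (Ry : rest K U y ≡ true) (g≢g₂ : g ≢ g₂) where

      y≢x : y ≢ x
      y≢x refl with exit (link-sym gl₂)
      ... | inj₁ (p , _)           = g≢g₂ (sym p)
      ... | inj₂ (inj₁ (_ , refl)) = true≢false Uw₂ (disj Kk)
      ... | inj₂ (inj₂ (_ , refl)) = rest-∉ K U Rz (inj₂ Uw₂)

      f≢g₂ : f ≢ g₂
      f≢g₂ refl with at-link lf (link-atˡ gl₂)
      ... | inj₁ refl = rest-∉ K U Rx (inj₂ Uw₂)
      ... | inj₂ refl = rest-∉ K U Rz (inj₂ Uw₂)

      -- Minimality for the vertex `x` shows that `g₂` is the only edge from `U` into the remaining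
      -- set, and `f` is the only one from `x`. A third edge of this cut must lead to `K`.
      new-neighbour : ∃[ a ] (rest K U′ a ≡ true × Neighbour K a)
      new-neighbour = found (cut3 conn3 (rest K U′) {y} {x} (R′-intro Ry y≢x)
          (Boolₚ.¬-not λ r → proj₂ (R′-elim r) refl) f g₂)
        where
        found : ∃[ e ] ∃[ b ] ∃[ c ] (Link b e c × rest K U′ b ≡ true × rest K U′ c ≡ false × e ≢ f × e ≢ g₂) →
          ∃[ a ] (rest K U′ a ≡ true × Neighbour K a)
        found (e , b , c , l , Rb , ¬Rc , e≢f , e≢g₂) with place K U′ c
        ... | inK Kc = b , Rb , e , c , l , Kc
        ... | inR Rc = true≢false Rc ¬Rc
        ... | inU U′c with add-elim x U U′c
        ...   | inj₂ refl = ⊥-elim (e≢f (proj₁ (exit-R (link-sym l) (proj₁ (R′-elim Rb)))))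
        ...   | inj₁ Uc = ⊥-elim (e≢g₂ (minimal Rx neighbour-x (rest K U′) sub
                  (λ e p q → trans (sup p) (sym (sup q))) connR′
                  (c , b , link-sym l , Uc , Rb) (w₂ , y , gl₂ , Uw₂ , R′-intro Ry y≢x)))
          where
          sub : ∀ {v} → rest K U′ v ≡ true → rest (add x K) U v ≡ true
          sub r with R′-elim r
          ... | p , n = rest-intro (add x K) U (add-false x K (rest-∉K K U p) n) (rest-∉U K U p)
          sup : ∀ {v} → rest (add x K) U v ≡ true → rest K U′ v ≡ true
          sup r with add-out x K (rest-∉K (add x K) U r)
          ... | p , n = R′-intro (rest-intro K U p (rest-∉U (add x K) U r)) n

  -- `attached` provides the edge `o`, and the third edge `f` decides. Once `f` leaves the remaining
  -- set, that set is `x` alone by connectedness, and `f` leads to `U`, since `g₂` must end at `x`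
  -- too.
  build : ∀ n {K U} → count (rest K U) ≤ n → Disjoint K U → Conn (rest K U) → Minimal K U →
    ∀ {w g x} → Link w g x → U w ≡ true → rest K U x ≡ true →
    ∀ {w₂ g₂ y} → Link w₂ g₂ y → U w₂ ≡ true → rest K U y ≡ true → g ≢ g₂ →
    ∃[ a ] (rest K U a ≡ true × Neighbour K a) → Path K U g x
  build zero {K} {U} size disj connR minimal {x = x} gl Uw Rx gl₂ Uw₂ Ry g≢g₂ _ =
    ⊥-elim (1+n≰n (≤-trans (count-pos (rest K U) x Rx) size))
  build (suc n) {K} {U} size disj connR minimal {w} {g} {x} gl Uw Rx {w₂} {g₂} {y} gl₂ Uw₂ Ry g≢g₂ (a , Ra , o′ , k′ , lo′ , Kk′)
    with attached disj connR minimal gl Uw Rx gl₂ Uw₂ Ry g≢g₂ _ Ra lo′ Kk′ ≤-refl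
  ... | o , k , lo , Kk with third (link-atʳ gl) (link-atˡ lo) g≢o
    where
    g≢o : g ≢ o
    g≢o refl with link-target (link-sym gl) lo
    ... | refl = true≢false Uw (disj Kk)
  ... | f , s with at-other (Star.at₃ s)
  ... | z , lf with place K U z
  ... | inR Rz = cons (rest-∉K K U Rx) (rest-∉U K U Rx) s lo Kk lf
      (build n smaller disj′ connR′ minimal′ lf (add-here x U) (R′-intro Rz z≢x)
        gl₂ (add-old x U Uw₂) (R′-intro Ry (y≢x gl₂ Uw₂ Ry g≢g₂)) (f≢g₂ gl₂ Uw₂ Ry g≢g₂)
        (new-neighbour gl₂ Uw₂ Ry g≢g₂))
    where
    open Step disj connR minimal gl Uw Rx s lo Kk lf Rz
    smaller : count (rest K U′) ≤ n
    smaller = ≤-pred (≤-trans (count-⊂ (λ r → proj₁ (R′-elim r)) x Rx (Boolₚ.¬-not λ r → proj₂ (R′-elim r) refl)) size)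
  ... | inU Uz = last (rest-∉K K U Rx) (rest-∉U K U Rx) s lo Kk lf Uz (isolated {rest K U} connR Rx none)
    where
    none : ∀ {e c} → Link x e c → rest K U c ≡ true → ⊥
    none l Rc with exits s (link-sym gl) lo lf l
    ... | inj₁ (_ , refl)        = rest-∉ K U Rc (inj₂ Uw)
    ... | inj₂ (inj₁ (_ , refl)) = rest-∉ K U Rc (inj₁ Kk)
    ... | inj₂ (inj₂ (_ , refl)) = rest-∉ K U Rc (inj₂ Uz)
  ... | inK Kz = ⊥-elim (absurd (isolated {rest K U} connR Rx none Ry))
    where
    none : ∀ {e c} → Link x e c → rest K U c ≡ true → ⊥
    none l Rc with exits s (link-sym gl) lo lf l
    ... | inj₁ (_ , refl)        = rest-∉ K U Rc (inj₂ Uw)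
    ... | inj₂ (inj₁ (_ , refl)) = rest-∉ K U Rc (inj₁ Kk)
    ... | inj₂ (inj₂ (_ , refl)) = rest-∉ K U Rc (inj₁ Kz)
    absurd : y ≡ x → ⊥
    absurd refl with exits s (link-sym gl) lo lf (link-sym gl₂)
    ... | inj₁ (p , _)           = g≢g₂ (sym p)
    ... | inj₂ (inj₁ (_ , refl)) = true≢false Uw₂ (disj Kk)
    ... | inj₂ (inj₂ (_ , refl)) = true≢false Uw₂ (disj Kz)

  -- The vertices outside K, in the order in which they were removed: a vertex,
  -- then paths, each of which attaches to the earlier vertices at its two ends
  -- and all of whose vertices are adjacent to the later ones.
  data Decomp : VSet → Set where
    first : ∀ {K} x → K x ≡ false → (∀ {v} → v ≢ x → K v ≡ true) → Decomp K
    next : ∀ {K L U w g x} → Decomp L → (∀ v → L v ≡ not (U v)) → Disjoint K U →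
      Link w g x → U w ≡ true → Path K U g x → Decomp K

  TwoEntries : VSet → VSet → Set
  TwoEntries U C = ∃[ s ] ∃[ s′ ] (Enters U s C × Enters U s′ C × s ≢ s′)

  opaque
    enters? : ∀ U s C → Dec (Enters U s C)
    enters? U s C = any? λ w → any? λ y → link? w s y ×-dec ((U w Boolₚ.≟ true) ×-dec (C y Boolₚ.≟ true))

    twoEntries? : ∀ U C → Dec (TwoEntries U C)
    twoEntries? U C = any? λ s → any? λ s′ → enters? U s C ×-dec (enters? U s′ C ×-dec ¬? (s ≟ s′))

  Splittable : VSet → VSet → Set
  Splittable K U = ∃[ a ] ∃[ y ] (rest K U a ≡ true × Neighbour K a × rest (add a K) U y ≡ true ×
    TwoEntries U (comp (rest (add a K) U) y))

  opaque
    splittable? : ∀ K U → Dec (Splittable K U)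
    splittable? K U = any? λ a → any? λ y → (rest K U a Boolₚ.≟ true) ×-dec (neighbour? K a ×-dec
      ((rest (add a K) U y Boolₚ.≟ true) ×-dec twoEntries? U (comp (rest (add a K) U) y)))

  unsplittable⇒minimal : ∀ {K U} → ¬ Splittable K U → Minimal K U
  unsplittable⇒minimal {K} {U} ¬s {a} Ra nb C C⊆ cl conn {e} {e′} (w , y , l , Uw , Cy) (w′ , y′ , l′ , Uw′ , Cy′)
    with e ≟ e′
  ... | yes p = p
  ... | no  p = ⊥-elim (¬s (a , y , Ra , nb , C⊆ Cy , e , e′ ,
      (w , y , l , Uw , comp-self M y) , (w′ , y′ , l′ , Uw′ , inD) , p))
    where
    M D : VSet
    M = rest (add a K) U
    D = comp M y
    inD : D y′ ≡ true
    inD = conn D (λ s p q → comp-closed M y s (C⊆ p) (C⊆ q)) Cy Cy′ (comp-self M y)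

  -- Components of `rest K U` outside `Y` still hang on `K`, because the complement of `U` is
  -- connected. Formally, the remaining vertices at which `Z` differs from `Z k₀` form a closed set
  -- of that complement which misses `k₀`.
  co-connected : ∀ {U K Y k₀} → Conn (not ∘ U) → Conn K → Disjoint K U → K k₀ ≡ true →
    (∀ {v} → Y v ≡ true → rest K U v ≡ true) → Closed (rest K U) Y → Conn (rest U Y)
  co-connected {U} {K} {Y} {k₀} connL connK disj Kk₀ Y⊆ clY Z clZ {u} {v} Ru Rv Zu =
    trans (agree Rv) (trans (sym (agree Ru)) Zu)
    where
    K′ : VSet
    K′ = rest U Y
    K⊆ : ∀ {v} → K v ≡ true → K′ v ≡ true
    K⊆ k = rest-intro U Y (disj k) (Boolₚ.¬-not λ y → true≢false k (rest-∉K K U (Y⊆ y)))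
    constK : ∀ {v} → K v ≡ true → Z v ≡ Z k₀
    constK {v} k with Z v in zv | Z k₀ in zk
    ... | true  | true  = refl
    ... | false | false = refl
    ... | true  | false = trans (sym (connK Z (λ e p q → clZ e (K⊆ p) (K⊆ q)) k Kk₀ zv)) zk
    ... | false | true  = trans (sym zv) (connK Z (λ e p q → clZ e (K⊆ p) (K⊆ q)) Kk₀ k zk)
    Q : VSet
    Q v = K′ v ∧ (Z v xor Z k₀)
    xor-eq : ∀ {a b} → a xor b ≡ true → a ≡ b → ⊥
    xor-eq {true}  () refl
    xor-eq {false} () refl
    closedQ : Closed (not ∘ U) Q
    closedQ = closed-intro step
      where
      notU : ∀ {v} → not (U v) ≡ true → U v ≡ false
      notU {v} h with U v
      ... | false = refl
      step : ∀ {p e q} → Link p e q → not (U p) ≡ true → not (U q) ≡ true → Q p ≡ true → Q q ≡ true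
      step {p} {e} {q} l Lp Lq Qp = go (Y q Boolₚ.≟ true)
        where
        K′p : K′ p ≡ true
        K′p = ∧-left (K′ p) Qp
        Rp : rest K U p ≡ true
        Rp = rest-intro K U (Boolₚ.¬-not λ k → xor-eq (∧-right (K′ p) Qp) (constK k)) (notU Lp)
        go : Dec (Y q ≡ true) → Q q ≡ true
        go (yes Yq) = true≢false (trans (closed-link {rest K U} {Y} clY l Rp (Y⊆ Yq)) Yq) (rest-∉U U Y K′p)
        go (no ¬Yq) = cong₂ _∧_ K′q (trans (cong (_xor Z k₀) (sym (closed-link {K′} {Z} clZ l K′p K′q))) (∧-right (K′ p) Qp))
          where
          K′q : K′ q ≡ true
          K′q = rest-intro U Y (notU Lq) (Boolₚ.¬-not ¬Yq)
    agree : ∀ {v} → K′ v ≡ true → Z v ≡ Z k₀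
    agree {v} Kv with Z v xor Z k₀ in eq
    ... | true  = ⊥-elim (xor-eq {Z k₀} (∧-right (K′ k₀) (connL Q closedQ (cong not (rest-∉K U Y Kv)) (cong not (disj Kk₀))
                    (cong₂ _∧_ Kv eq))) refl)
    ... | false = xor-false eq
      where
      xor-false : ∀ {a b} → a xor b ≡ false → a ≡ b
      xor-false {true}  {true}  _ = refl
      xor-false {false} {false} _ = refl

  record Candidate (U K : VSet) : Set where
    field
      connK : Conn K
      k₀    : V
      Kk₀   : K k₀ ≡ true
      disj  : Disjoint K U
      connR : Conn (rest K U)
      two   : TwoEntries U (rest K U)

  -- One component with two entries is kept as the future path; all others are handed over to `K`.
  candidate : ∀ {U K k₀ y} → Conn (not ∘ U) → Conn K → Disjoint K U → K k₀ ≡ true →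
    rest K U y ≡ true → TwoEntries U (comp (rest K U) y) →
    ∃[ K′ ] (Candidate U K′ × (∀ {v} → rest K′ U v ≡ true → rest K U v ≡ true))
  candidate {U} {K} {k₀} {y} connL connK disj Kk₀ Ry (s , s′ , p , p′ , s≢s′) = rest U Y , record
    { connK = co-connected {U} {K} {Y} connL connK disj Kk₀ Y⊆ (comp-closed (rest K U) y)
    ; k₀    = k₀
    ; Kk₀   = rest-intro U Y (disj Kk₀) (Boolₚ.¬-not λ h → true≢false Kk₀ (rest-∉K K U (Y⊆ h)))
    ; disj  = rest-∉K U Y
    ; connR = conn-resp same (comp-conn (rest K U) y)
    ; two   = s , s′ , move p , move p′ , s≢s′
    } , λ {v} r → Y⊆ {v} (trans (same v) r)
    where
    Y : VSet
    Y = comp (rest K U) y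
    Y⊆ : ∀ {v} → Y v ≡ true → rest K U v ≡ true
    Y⊆ {v} = comp-⊆ {rest K U} {y} {v} Ry
    same : ∀ v → Y v ≡ rest (rest U Y) U v
    same v with U v in u | Y v in eq
    ... | false | true  = refl
    ... | false | false = refl
    ... | true  | false = refl
    ... | true  | true  = true≢false u (rest-∉U K U (Y⊆ {v} eq))
    move : ∀ {s} → Enters U s Y → Enters U s (rest (rest U Y) U)
    move (w , v , l , Uw , h) = w , v , l , Uw , trans (sym (same v)) h

  NextPath : VSet → Set
  NextPath U = ∃[ K ] ∃[ w ] ∃[ g ] ∃[ x ] (Conn K × (∃[ k ] K k ≡ true) × Disjoint K U ×
    Link w g x × U w ≡ true × rest K U x ≡ true × Path K U g x)

  -- Every splitting moves a vertex to `K` and shrinks the rest. So a minimal candidate is reached,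
  -- and `build` turns its rest into a path.
  grow : ∀ n {U K} → Conn (not ∘ U) → Candidate U K → count (rest K U) ≤ n → NextPath U
  grow-cases : ∀ n {U K} → Conn (not ∘ U) → Candidate U K → count (rest K U) ≤ n → Dec (Splittable K U) → NextPath U

  grow n {U} {K} connL c size = grow-cases n connL c size (splittable? K U)

  grow-cases zero {U} {K} connL c size (yes (a , _ , Ra , _)) = ⊥-elim (1+n≰n (≤-trans (count-pos (rest K U) a Ra) size))
  grow-cases (suc n) {U} {K} connL c size (yes (a , y , Ra , (o , k , lo , Kk) , My , two)) =
    continue (candidate {U} {add a K} connL connK⁺ disj⁺ (add-old a K Kk₀) My two)
    where
    open Candidate c using (connK; k₀; Kk₀; disj)
    disj⁺ : Disjoint (add a K) U
    disj⁺ h with add-elim a K h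
    ... | inj₁ p = disj p
    ... | inj₂ refl = rest-∉U K U Ra
    connK⁺ : Conn (add a K)
    connK⁺ Z clZ {u} {v} Ku Kv Zu = from (add-elim a K Kv) (to (add-elim a K Ku) Zu)
      where
      clK : Closed K Z
      clK e p q = clZ e (add-old a K p) (add-old a K q)
      ak : Z a ≡ Z k
      ak = closed-link {add a K} {Z} clZ lo (add-here a K) (add-old a K Kk)
      to : ∀ {u} → K u ≡ true ⊎ u ≡ a → Z u ≡ true → Z k ≡ true
      to (inj₁ p) h = connK Z clK p Kk h
      to (inj₂ refl) h = trans (sym ak) h
      from : ∀ {u} → K u ≡ true ⊎ u ≡ a → Z k ≡ true → Z u ≡ true
      from (inj₁ p) h = connK Z clK Kk p h
      from (inj₂ refl) h = trans ak h
    M-R : ∀ {v} → rest (add a K) U v ≡ true → rest K U v ≡ true × v ≢ a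
    M-R m with add-out a K (rest-∉K (add a K) U m)
    ... | p , n = rest-intro K U p (rest-∉U (add a K) U m) , n
    continue : ∃[ K′ ] (Candidate U K′ × (∀ {v} → rest K′ U v ≡ true → rest (add a K) U v ≡ true)) → NextPath U
    continue (K′ , c′ , sub) = grow n connL c′ (≤-pred (≤-trans
      (count-⊂ (λ r → proj₁ (M-R (sub r))) a Ra (Boolₚ.¬-not λ r → proj₂ (M-R (sub r)) refl)) size))
  grow-cases n {U} {K} connL c size (no ¬s) = go two (closed-or-edge (not ∘ U) K)
    where
    open Candidate c
    notU : ∀ {v} → not (U v) ≡ true → U v ≡ false
    notU {v} h with U v
    ... | false = refl
    go : TwoEntries U (rest K U) → Closed (not ∘ U) K ⊎ ∃[ a ] ∃[ e ] ∃[ c ]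
      (Link a e c × not (U a) ≡ true × not (U c) ≡ true × K a ≡ true × K c ≡ false) → NextPath U
    go (s , s′ , (w , x , l , Uw , Rx) , (w′ , y , l′ , Uw′ , Ry) , s≢s′) (inj₁ cl) =
      true≢false (connL K cl (cong not (disj Kk₀)) (cong not (rest-∉U K U Rx)) Kk₀) (rest-∉K K U Rx)
    go (s , s′ , (w , x , l , Uw , Rx) , (w′ , y , l′ , Uw′ , Ry) , s≢s′) (inj₂ (k , e , a , l″ , _ , La , Kk , ¬Ka)) =
      K , w , s , x , connK , (k₀ , Kk₀) , disj , l , Uw , Rx ,
      build _ ≤-refl disj connR (unsplittable⇒minimal ¬s) l Uw Rx l′ Uw′ Ry s≢s′
        (a , rest-intro K U ¬Ka (notU La) , e , k , link-sym l″ , Kk)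

  some-crossing : ∀ (Z : VSet) {u w} → Z u ≡ true → Z w ≡ false →
    ∃[ e ] ∃[ a ] ∃[ c ] (Link a e c × Z a ≡ true × Z c ≡ false)
  some-crossing Z p q with pick-one (cross Z) (≤-trans (s≤s z≤n) (conn3 Z p q))
  ... | e , h , _ with link-cross Z h
  ... | a , c , l , za , zc = e , a , c , l , za , zc

  single : V → VSet
  single r v = does (v ≟ r)

  single-here : ∀ r → single r r ≡ true
  single-here r with r ≟ r
  ... | yes _ = refl
  ... | no  q = ⊥-elim (q refl)

  single-elim : ∀ r {v} → single r v ≡ true → v ≡ r
  single-elim r {v} h with v ≟ r
  ... | yes p = p
  ... | no _ with () ← h

  single-false : ∀ r {v} → v ≢ r → single r v ≡ false
  single-false r n = Boolₚ.¬-not λ h → n (single-elim r h)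

  -- `K` is tried as an end `r` of an edge `g₁` from `U`. If the component `C` of `l` has at most
  -- one entry `g`, both other edges of `r` lead into `C`. So `C` and `r` make up the complement of
  -- `U`, and at most `g₁` and `g` leave it, which is too few.
  first-candidate : ∀ {U u₀ l₀} → Conn (not ∘ U) → U u₀ ≡ true → U l₀ ≡ false →
    (∀ r → ∃[ l ] (U l ≡ false × l ≢ r)) → ∃[ K ] Candidate U K
  first-candidate {U} {u₀} {l₀} connL Uu₀ ¬Ul₀ other with some-crossing U Uu₀ ¬Ul₀
  ... | g₁ , u , r , l₁ , Uu , ¬Ur with other r
  ... | l , ¬Ul , l≢r with twoEntries? U (comp (rest (single r) U) l)
  ... | yes two with candidate {U} {single r} {r} connL connr disjr (single-here r)
                       (rest-intro (single r) U (single-false r l≢r) ¬Ul) two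
    where
    connr : Conn (single r)
    connr Z cl p q h = transport Z (trans (single-elim r p) (sym (single-elim r q))) h
    disjr : Disjoint (single r) U
    disjr h = subst (λ v → U v ≡ false) (sym (single-elim r h)) ¬Ur
  ... | K , c , _ = K , c
  first-candidate {U} {u₀} {l₀} connL Uu₀ ¬Ul₀ other | g₁ , u , r , l₁ , Uu , ¬Ur | l , ¬Ul , l≢r | no ¬two =
    ⊥-elim (contradiction (enter? (any? λ s → enters? U s C)))
    where
    M C L : VSet
    M = rest (single r) U
    C = comp M l
    L = not ∘ U
    M-intro : ∀ {v} → U v ≡ false → v ≢ r → M v ≡ true
    M-intro p n = rest-intro (single r) U (single-false r n) p
    Cl : C l ≡ true
    Cl = comp-self M l
    C-M : ∀ {v} → C v ≡ true → M v ≡ true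
    C-M {v} = comp-⊆ {M} {l} {v} (M-intro ¬Ul l≢r)
    C-U : ∀ {v} → C v ≡ true → U v ≡ false
    C-U c = rest-∉U (single r) U (C-M c)
    C-link : ∀ {p e q} → Link p e q → C p ≡ true → U q ≡ false → q ≢ r → C q ≡ true
    C-link lk c p n = trans (sym (closed-link {M} {C} (comp-closed M l) lk (C-M c) (M-intro p n))) c
    enter? : Dec (∃[ s ] Enters U s C) → ∃[ g ] (∀ {s} → Enters U s C → s ≡ g)
    -- Without any entry, `g₁` is a placeholder for the edge to be excluded.
    enter? (no ¬e) = g₁ , λ e → ⊥-elim (¬e (_ , e))
    enter? (yes (g , e)) = g , eq
      where
      eq : ∀ {s} → Enters U s C → s ≡ g
      eq {s} e′ with s ≟ g
      ... | yes p = p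
      ... | no  n = ⊥-elim (¬two (s , g , e′ , e , n))
    contradiction : ∃[ g ] (∀ {s} → Enters U s C → s ≡ g) → ⊥
    contradiction (g , only-g) with star-of r
    ... | a , b , c , st = at-r (edge-position (Star.only st (link-atʳ l₁)))
      where
      edge-position : g₁ ≡ a ⊎ g₁ ≡ b ⊎ g₁ ≡ c → ∃[ f₂ ] ∃[ f₃ ] Star r g₁ f₂ f₃
      edge-position (inj₁ refl)        = b , c , st
      edge-position (inj₂ (inj₁ refl)) = c , a , rotate st
      edge-position (inj₂ (inj₂ refl)) = a , b , rotate (rotate st)
      g₁-out : ∀ {v} → Link r g₁ v → U v ≡ false → ⊥
      g₁-out lk p with link-target lk (link-sym l₁)
      ... | refl = true≢false Uu p
      at-r : ∃[ f₂ ] ∃[ f₃ ] Star r g₁ f₂ f₃ → ⊥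
      -- Excluding `g` and `f₂` leaves `f₃`, and excluding `g` and `f₃` leaves `f₂`: both lead from
      -- `r` into `C`.
      at-r (f₂ , f₃ , s) = fin (to-C f₂ (into f₂)) (to-C f₃ (into f₃))
        where
        into : ∀ f → ∃[ e ] ∃[ p ] ∃[ q ] (Link p e q × C p ≡ true × C q ≡ false × e ≢ g × e ≢ f)
        into f = cut3 conn3 C Cl (Boolₚ.¬-not λ h → true≢false Uu (C-U h)) g f
        to-C : ∀ f → ∃[ e ] ∃[ p ] ∃[ q ] (Link p e q × C p ≡ true × C q ≡ false × e ≢ g × e ≢ f) →
          ∃[ e ] ∃[ p ] (Link r e p × C p ≡ true × e ≢ f)
        to-C f (e , p , q , lk , Cp , ¬Cq , e≢g , e≢f) with U q in Uq | q ≟ r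
        ... | true  | _        = ⊥-elim (e≢g (only-g (q , p , link-sym lk , Uq , Cp)))
        ... | false | yes refl = e , p , link-sym lk , Cp , e≢f
        ... | false | no n     = true≢false (C-link lk Cp Uq n) ¬Cq
        fin : ∃[ e ] ∃[ p ] (Link r e p × C p ≡ true × e ≢ f₂) → ∃[ e ] ∃[ p ] (Link r e p × C p ≡ true × e ≢ f₃) → ⊥
        fin (e₃ , p₃ , lk₃ , Cp₃ , n₃) (e₂ , p₂ , lk₂ , Cp₂ , n₂) with Star.only s (link-atˡ lk₃) | Star.only s (link-atˡ lk₂)
        ... | inj₁ refl | _ = g₁-out lk₃ (C-U Cp₃)
        ... | inj₂ (inj₁ q) | _ = n₃ q
        ... | inj₂ (inj₂ _) | inj₁ refl = g₁-out lk₂ (C-U Cp₂)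
        ... | inj₂ (inj₂ _) | inj₂ (inj₂ q) = n₂ q
        ... | inj₂ (inj₂ refl) | inj₂ (inj₁ refl) = last-cut (cut3 conn3 L (cong not ¬Ul) (cong not Uu) g₁ g)
          where
          from-r : ∀ {e v} → Link r e v → U v ≡ false → C v ≡ true
          from-r lk p with exits s (link-sym l₁) lk₂ lk₃ lk
          ... | inj₁ (refl , _)        = ⊥-elim (g₁-out lk p)
          ... | inj₂ (inj₁ (_ , refl)) = Cp₂
          ... | inj₂ (inj₂ (_ , refl)) = Cp₃
          notU : ∀ {v} → not (U v) ≡ true → U v ≡ false
          notU {v} h with U v
          ... | false = refl
          whole : ∀ {v} → L v ≡ true → C v ≡ true ⊎ v ≡ r
          whole Lv = add-elim r C (connL (add r C) (closed-intro λ {a} {e} {c} lk La Lc h → stp lk (notU Lc) (add-elim r C h) (c ≟ r))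
              (cong not ¬Ul) Lv (add-old r C Cl))
            where
            stp : ∀ {a e c} → Link a e c → U c ≡ false → C a ≡ true ⊎ a ≡ r → Dec (c ≡ r) → add r C c ≡ true
            stp lk p _ (yes refl) = add-here r C
            stp lk p (inj₁ Ca) (no n) = add-old r C (C-link lk Ca p n)
            stp lk p (inj₂ refl) (no n) = add-old r C (from-r lk p)
          last-cut : ∃[ e ] ∃[ p ] ∃[ q ] (Link p e q × L p ≡ true × L q ≡ false × e ≢ g₁ × e ≢ g) → ⊥
          last-cut (e , p , q , lk , Lp , ¬Lq , e≢g₁ , e≢g) with whole Lp
          ... | inj₁ Cp = e≢g (only-g (q , p , link-sym lk , Uq , Cp))
            where
            Uq : U q ≡ true
            Uq with U q
            ... | true = refl
          ... | inj₂ refl with exits s (link-sym l₁) lk₂ lk₃ lk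
          ...   | inj₁ (p , _)           = e≢g₁ p
          ...   | inj₂ (inj₁ (_ , refl)) = true≢false (cong not (C-U Cp₂)) ¬Lq
          ...   | inj₂ (inj₂ (_ , refl)) = true≢false (cong not (C-U Cp₃)) ¬Lq

  decompose-from : ∀ n {L u₀ l₀} → count L ≤ n → Conn L → L u₀ ≡ false → L l₀ ≡ true → Decomp L →
    ∃[ K ] ∃[ r ] (K r ≡ true × (∀ {v} → K v ≡ true → v ≡ r) × Decomp K)
  decompose-from zero {L} {u₀} {l₀} size connL ¬Lu Ll D = ⊥-elim (1+n≰n (≤-trans (count-pos L l₀ Ll) size))
  decompose-from (suc n) {L} {u₀} {l₀} size connL ¬Lu Ll D with any? (λ r → all? λ v → (L v Boolₚ.≟ true) →-dec (v ≟ r))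
  ... | yes (r , only) = L , r , transport L (only l₀ Ll) Ll , (λ {v} → only v) , D
  ... | no ¬single with first-candidate {not ∘ L} {u₀} {l₀}
          (conn-resp (λ v → sym (Boolₚ.not-involutive (L v))) connL) (cong not ¬Lu) (cong not Ll) other
    where
    other : ∀ r → ∃[ l ] (not (L l) ≡ false × l ≢ r)
    other r with any? (λ l → (L l Boolₚ.≟ true) ×-dec ¬? (l ≟ r))
    ... | yes (l , p , q) = l , cong not p , q
    ... | no ¬o = ⊥-elim (¬single (r , λ v Lv → single-elim r (Boolₚ.¬-not λ h → ¬o (v , Lv , λ { refl → true≢false (single-here r) h }))))
  ... | K , c with grow _ (conn-resp (λ v → sym (Boolₚ.not-involutive (L v))) connL) c ≤-refl
  ... | K′ , w , g , x , connK′ , (k , Kk) , disj , lg , Uw , Rx , path =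
      decompose-from n (≤-pred (≤-trans (count-⊂ K′⊆L x Lx (rest-∉K K′ (not ∘ L) Rx)) size))
        connK′ (Boolₚ.¬-not λ h → true≢false (K′⊆L h) ¬Lu) Kk
        (next D (λ v → sym (Boolₚ.not-involutive (L v))) disj lg Uw path)
    where
    K′⊆L : ∀ {v} → K′ v ≡ true → L v ≡ true
    K′⊆L {v} h with L v | disj h
    ... | true | _ = refl
    Lx : L x ≡ true
    Lx with L x | rest-∉U K′ (not ∘ L) Rx
    ... | true | _ = refl

  decompose : 2 ≤ #V → ∃[ K ] ∃[ r ] (K r ≡ true × (∀ {v} → K v ≡ true → v ≡ r) × Decomp K)
  decompose two = start (vertex two)
    where
    vertex : ∀ {n} → 2 ≤ n → Fin n
    vertex (s≤s _) = zero
    start : V → ∃[ K ] ∃[ r ] (K r ≡ true × (∀ {v} → K v ≡ true → v ≡ r) × Decomp K)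
    start x with Pairing.other-vertex G two x | star-of x
    ... | y , y≢x | f₁ , f₂ , f₃ , s = decompose-from _ {L} {x} {y} ≤-refl connL
        (cong not (single-here x)) (cong not (single-false x y≢x))
        (first x (cong not (single-here x)) λ n → cong not (single-false x n))
      where
      L : VSet
      L = not ∘ single x
      -- a component of L has three edges to x, so it contains the end of f₃
      hits : ∀ Z → Closed L Z → ∀ {u} → L u ≡ true → Z u ≡ true → ∃[ v ] (Link v f₃ x × Z v ≡ true)
      hits Z cl {u} Lu Zu with cut3 conn3 (λ v → L v ∧ Z v) {u} {x} (cong₂ _∧_ Lu Zu) Zx f₁ f₂
        where
        Zx : L x ∧ Z x ≡ false
        Zx rewrite single-here x = refl
      ... | e , a , c , l , h , h′ , n₁ , n₂ with L a in La | Z a in Za | L c in Lc | c ≟ x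
      ...   | true | true | _ | yes refl = a , subst (λ e → Link a e x) (only-two s (link-atʳ l) n₁ n₂) l , Za
      ...   | true | true | true  | no _ = true≢false (trans (sym (closed-link {L} {Z} cl l La Lc)) Za) h′
      ...   | true | true | false | no n = true≢false (cong not (single-false x n)) Lc
      hits Z cl {u} Lu Zu | e , a , c , l , () , h′ , n₁ , n₂ | true | false | _ | _
      hits Z cl {u} Lu Zu | e , a , c , l , () , h′ , n₁ , n₂ | false | _ | _ | _
      connL : Conn L
      connL Z cl {u} {v} Lu Lv Zu with hits Z cl Lu Zu | Z v in Zv
      ... | _ | true = refl
      -- A closed set and its complement within `L`, both nonempty, would both contain the end of
      -- `f₃`.
      ... | a , l , Za | false with hits (not ∘ Z) (λ e p q → cong not (cl e p q)) Lv (cong not Zv)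
      ...   | b , l′ , ¬Zb with link-target (link-sym l) (link-sym l′)
      ...     | refl = ⊥-elim (clash Za ¬Zb)
        where
        clash : ∀ {b} → b ≡ true → not b ≡ true → ⊥
        clash refl ()

-- Lifting from ℤ₃ to ℤ₆

module _ {A B : Set} where

  count-weaken : ∀ {N M} {P : (A → B) → Set} → N ≤ M → Count M P → Count N P
  count-weaken le (Φ , inj , p) = (λ i → Φ (inject≤ i le)) , (λ eq → inject≤-injective le le _ _ (inj eq)) , (λ i → p _)

  count-map : ∀ {N} {P Q : (A → B) → Set} → (∀ {φ} → P φ → Q φ) → Count N P → Count N Q
  count-map f (Φ , inj , p) = Φ , inj , λ i → f (p i)

  count-one : ∀ {P : (A → B) → Set} φ → P φ → Count 1 P
  count-one φ p = (λ _ → φ) , (λ { {zero} {zero} _ → refl }) , λ _ → p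

  count-+ : ∀ {N M} {P Q R : (A → B) → Set} → Count N P → Count M Q →
    (∀ {φ ψ} → P φ → Q ψ → ¬ φ ≗ ψ) → (∀ {φ} → P φ → R φ) → (∀ {φ} → Q φ → R φ) → Count (N + M) R
  count-+ {N} {M} {P} {Q} {R} (Φ , injΦ , p) (Ψ , injΨ , q) apart f g =
    (λ i → choose (splitAt N i)) , (λ {i} {j} eq → trans (sym (join-splitAt N M i))
      (trans (cong (Fin.join N M) (inj (splitAt N i) (splitAt N j) eq)) (join-splitAt N M j))) , λ i → ok (splitAt N i)
    where
    choose : Fin N ⊎ Fin M → A → B
    choose = [ Φ , Ψ ]′
    inj : ∀ i j → choose i ≗ choose j → i ≡ j
    inj (inj₁ i) (inj₁ j) eq = cong inj₁ (injΦ eq)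
    inj (inj₁ i) (inj₂ j) eq = ⊥-elim (apart (p i) (q j) eq)
    inj (inj₂ i) (inj₁ j) eq = ⊥-elim (apart (p j) (q i) (sym ∘ eq))
    inj (inj₂ i) (inj₂ j) eq = cong inj₂ (injΨ eq)
    ok : ∀ i → R (choose i)
    ok (inj₁ i) = f (p i)
    ok (inj₂ j) = g (q j)

infixl 6 _+₂_ _+₃_

_+₂_ : Fin 2 → Fin 2 → Fin 2
a +₂ b = (toℕ a + toℕ b) mod 2

-₂_ : Fin 2 → Fin 2
-₂ a = (2 ∸ toℕ a) mod 2

ℤ₂ : AbelianGroup 0ℓ 0ℓ
ℤ₂ = record
  { Carrier = Fin 2 ; _≈_ = _≡_ ; _∙_ = _+₂_ ; ε = zero ; _⁻¹ = -₂_
  ; isAbelianGroup = record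
    { isGroup = record
      { isMonoid = record
        { isSemigroup = record
          { isMagma = record { isEquivalence = isEquivalence ; ∙-cong = cong₂ _+₂_ }
          ; assoc = from-yes (all? λ a → all? λ b → all? λ c → (a +₂ b) +₂ c ≟ a +₂ (b +₂ c))
          }
        ; identity = from-yes (all? λ a → zero +₂ a ≟ a) , from-yes (all? λ a → a +₂ zero ≟ a)
        }
      ; inverse = from-yes (all? λ a → (-₂ a) +₂ a ≟ zero) , from-yes (all? λ a → a +₂ (-₂ a) ≟ zero)
      ; ⁻¹-cong = cong -₂_
      }
    ; comm = from-yes (all? λ a → all? λ b → a +₂ b ≟ b +₂ a)
    }
  }

_+₃_ : Fin 3 → Fin 3 → Fin 3
a +₃ b = (toℕ a + toℕ b) mod 3

-₃_ : Fin 3 → Fin 3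
-₃ a = (3 ∸ toℕ a) mod 3

ℤ₃ : AbelianGroup 0ℓ 0ℓ
ℤ₃ = record
  { Carrier = Fin 3 ; _≈_ = _≡_ ; _∙_ = _+₃_ ; ε = zero ; _⁻¹ = -₃_
  ; isAbelianGroup = record
    { isGroup = record
      { isMonoid = record
        { isSemigroup = record
          { isMagma = record { isEquivalence = isEquivalence ; ∙-cong = cong₂ _+₃_ }
          ; assoc = from-yes (all? λ a → all? λ b → all? λ c → (a +₃ b) +₃ c ≟ a +₃ (b +₃ c))
          }
        ; identity = from-yes (all? λ a → zero +₃ a ≟ a) , from-yes (all? λ a → a +₃ zero ≟ a)
        }
      ; inverse = from-yes (all? λ a → (-₃ a) +₃ a ≟ zero) , from-yes (all? λ a → a +₃ (-₃ a) ≟ zero)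
      ; ⁻¹-cong = cong -₃_
      }
    ; comm = from-yes (all? λ a → all? λ b → a +₃ b ≟ b +₃ a)
    }
  }

opaque
  mod2 : Fin 6 → Fin 2
  mod2 a = toℕ a mod 2

  mod3 : Fin 6 → Fin 3
  mod3 a = toℕ a mod 3

  -- 3 and 4 are idempotents of `ℤ₆`: 3 is 1 mod 2 and 0 mod 3, while 4 is 0 mod 2 and 1 mod 3.
  crt : Fin 2 → Fin 3 → Fin 6
  crt a b = (3 * toℕ a + 4 * toℕ b) mod 6

  mod2-crt : ∀ a b → mod2 (crt a b) ≡ a
  mod2-crt = from-yes (all? λ a → all? λ b → mod2 (crt a b) ≟ a)

  mod3-crt : ∀ a b → mod3 (crt a b) ≡ b
  mod3-crt = from-yes (all? λ a → all? λ b → mod3 (crt a b) ≟ b)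

  crt-mod : ∀ a → crt (mod2 a) (mod3 a) ≡ a
  crt-mod = from-yes (all? λ a → crt (mod2 a) (mod3 a) ≟ a)

  mod2-+ : ∀ a b → mod2 (a +₆ b) ≡ mod2 a +₂ mod2 b
  mod2-+ = from-yes (all? λ a → all? λ b → mod2 (a +₆ b) ≟ mod2 a +₂ mod2 b)

  mod3-+ : ∀ a b → mod3 (a +₆ b) ≡ mod3 a +₃ mod3 b
  mod3-+ = from-yes (all? λ a → all? λ b → mod3 (a +₆ b) ≟ mod3 a +₃ mod3 b)

  mod2-0 : mod2 zero ≡ zero
  mod2-0 = refl

  mod3-0 : mod3 zero ≡ zero
  mod3-0 = refl

  mod2-neg : ∀ a → mod2 (-₆ a) ≡ -₂ mod2 a
  mod2-neg = from-yes (all? λ a → mod2 (-₆ a) ≟ -₂ mod2 a)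

  mod3-neg : ∀ a → mod3 (-₆ a) ≡ -₃ mod3 a
  mod3-neg = from-yes (all? λ a → mod3 (-₆ a) ≟ -₃ mod3 a)

module Homomorphism (Γ Δ : AbelianGroup 0ℓ 0ℓ) (f : AbelianGroup.Carrier Γ → AbelianGroup.Carrier Δ)
  (hom : IsGroupHomomorphism (AbelianGroup.rawGroup Γ) (AbelianGroup.rawGroup Δ) f) where
  open AbelianGroup Γ using () renaming (_∙_ to _∙₁_; _⁻¹ to _⁻¹₁)
  open AbelianGroup Δ using (∙-cong; ⁻¹-cong) renaming (trans to ≈-trans; refl to ≈-refl; _≈_ to _≈₂_)
  open IsGroupHomomorphism hom using () renaming (homo to f-∙; ε-homo to f-ε; ⁻¹-homo to f-⁻¹)
  private
    module S₁ = Sums (AbelianGroup.commutativeMonoid Γ)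
    module S₂ = Sums (AbelianGroup.commutativeMonoid Δ)

  f-sum : ∀ {n} (t : Fin n → AbelianGroup.Carrier Γ) → f (S₁.sum t) ≈₂ S₂.sum (f ∘ t)
  f-sum {zero}  t = f-ε
  f-sum {suc n} t = ≈-trans (f-∙ _ _) (∙-cong ≈-refl (f-sum (t ∘ suc)))

  f-pick : ∀ b a → f (S₁.pick b a) ≈₂ S₂.pick b (f a)
  f-pick true  a = ≈-refl
  f-pick false a = f-ε

  f-bd : ∀ G φ v → f (Boundary.bd Γ G φ v) ≈₂ Boundary.bd Δ G (f ∘ φ) v
  f-bd G φ v = ≈-trans (f-sum (λ e → B₁.out φ v e ∙₁ (B₁.into φ v e) ⁻¹₁)) (S₂.sum-cong-≋ λ e → ≈-trans (f-∙ _ _)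
    (∙-cong (f-pick (does (initial e ≟ v)) (φ e)) (≈-trans (f-⁻¹ _) (⁻¹-cong (f-pick (does (terminal e ≟ v)) (φ e))))))
    where
    open OrientedGraph G
    module B₁ = Boundary Γ G

mod2-hom : IsGroupHomomorphism (AbelianGroup.rawGroup ℤ₆) (AbelianGroup.rawGroup ℤ₂) mod2
mod2-hom = record
  { isMonoidHomomorphism = record
    { isMagmaHomomorphism = record { isRelHomomorphism = record { cong = cong mod2 } ; homo = mod2-+ }
    ; ε-homo = mod2-0 }
  ; ⁻¹-homo = mod2-neg }

mod3-hom : IsGroupHomomorphism (AbelianGroup.rawGroup ℤ₆) (AbelianGroup.rawGroup ℤ₃) mod3
mod3-hom = record
  { isMonoidHomomorphism = record
    { isMagmaHomomorphism = record { isRelHomomorphism = record { cong = cong mod3 } ; homo = mod3-+ }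
    ; ε-homo = mod3-0 }
  ; ⁻¹-homo = mod3-neg }

module Mod2 = Homomorphism ℤ₆ ℤ₂ mod2 mod2-hom
module Mod3 = Homomorphism ℤ₆ ℤ₃ mod3 mod3-hom

module Lift (G : OrientedGraph) (b : OrientedGraph.V G → Fin 6) (total : Boundary.sum ℤ₆ G b ≡ zero) where
  open OrientedGraph G
  private
    module B₂ = Boundary ℤ₂ G
    module B₃ = Boundary ℤ₃ G
    module B₆ = Boundary ℤ₆ G

  b₃ : V → Fin 3
  b₃ v = mod3 (b v)

  b₃-total : B₃.sum b₃ ≡ zero
  b₃-total = trans (sym (Mod3.f-sum b)) (trans (cong mod3 total) mod3-0)

  crt-bd : ∀ {z h} → (∀ v → B₂.bd z v ≡ mod2 (b v)) → (∀ v → B₃.bd h v ≡ b₃ v) →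
    ∀ v → B₆.bd (λ e → crt (z e) (h e)) v ≡ b v
  crt-bd {z} {h} p q v = trans (sym (crt-mod _)) (trans (cong₂ crt
    (trans (Mod2.f-bd G k v) (trans (B₂.bd-cong v λ e → mod2-crt (z e) (h e)) (p v)))
    (trans (Mod3.f-bd G k v) (trans (B₃.bd-cong v λ e → mod3-crt (z e) (h e)) (q v)))) (crt-mod (b v)))
    where
    k : E → Fin 6
    k e = crt (z e) (h e)

  module _ (r : V) (h : E → Fin 3) (bd-h : ∀ (v : V) → B₃.bd h v ≡ b₃ v) (D : E → Set) (D-alive : ∀ {e : E} → D e → h e ≢ zero)
           (conn : ∀ (u v : V) → EqClosure (B₂.Linked D) u v) where

    -- `F` holds the live edges whose ℤ₂-part is still open. At the other live edges outside `D` it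
    -- is prescribed by `g`, which tells solutions apart.
    Extends : (E → Fin 2) → List E → (E → Fin 6) → Set
    Extends g F k = NowhereZero G b k × (∀ e → mod3 (k e) ≡ h e) × (∀ {e} → ¬ D e → h e ≢ zero → e ∉ F → mod2 (k e) ≡ g e)

    lift : ∀ g → ∃[ k ] Extends g [] k
    lift g with B₂.extend D conn r {mod2 ∘ b} (trans (sym (Mod2.f-sum b)) (trans (cong mod2 total) mod2-0)) g′
      where
      g′ : E → Fin 2
      -- Where `h` vanishes, the ℤ₂-part has to be 1 to make the element of `ℤ₆` nonzero.
      g′ e with h e
      ... | zero  = 1F
      ... | suc _ = g e
    ... | z , bd-z , off = k , (crt-bd {z} {h} bd-z bd-h , nonzero) , (λ e → mod3-crt (z e) (h e)) , agree
      where
      k : E → Fin 6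
      k e = crt (z e) (h e)
      nonzero : ∀ e → k e ≢ zero
      nonzero e p with h e in eq | off e | mod2-crt (z e) (h e) | mod3-crt (z e) (h e)
      ... | suc _ | _ | _ | q with () ← trans (sym q) (trans (cong mod3 p) mod3-0)
      ... | zero | o | q | _ with () ← trans (sym (o λ de → D-alive de eq)) (trans (sym q) (trans (cong mod2 p) mod2-0))
      agree : ∀ {e} → ¬ D e → h e ≢ zero → e ∉ [] → mod2 (k e) ≡ g e
      agree {e} ¬d ≢0 _ with h e | off e ¬d | mod2-crt (z e) (h e)
      ... | zero  | _ | _ = ⊥-elim (≢0 refl)
      ... | suc _ | o | q = trans q o

    -- Both values at an edge of `F` can be prescribed, since corrections run along `D` only; each
    -- edge yields a factor 2.
    lift-count : ∀ F → Unique F → All (λ e → h e ≢ zero × ¬ D e) F → ∀ g → Count (2 ^ length F) (Extends g F)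
    lift-count [] _ _ g with lift g
    ... | k , p = count-one k p
    lift-count (f ∷ F) (f∉ ∷ uniq) ((f≢0 , ¬Df) ∷ alive) g =
      subst (λ N → Count N (Extends g (f ∷ F))) (cong (2 ^ length F +_) (sym (+-identityʳ _)))
        (count-+ {P = Extends (set zero) F} {Q = Extends (set 1F) F}
          (lift-count F uniq alive (set zero)) (lift-count F uniq alive (set 1F)) apart (weaken zero) (weaken 1F))
      where
      set : Fin 2 → E → Fin 2
      set a e = if does (e ≟ f) then a else g e
      set-f : ∀ a → set a f ≡ a
      set-f a with f ≟ f
      ... | yes _ = refl
      ... | no  q = ⊥-elim (q refl)
      set-other : ∀ a {e} → e ≢ f → set a e ≡ g e
      set-other a {e} n with e ≟ f
      ... | yes p = ⊥-elim (n p)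
      ... | no  _ = refl
      f∉F : f ∉ F
      f∉F m = All.lookup f∉ m refl
      weaken : ∀ a {k} → Extends (set a) F k → Extends g (f ∷ F) k
      weaken a (nz , m3 , m2) = nz , m3 , λ {e} ¬d ≢0 e∉ →
        trans (m2 ¬d ≢0 (e∉ ∘ there)) (set-other a λ p → e∉ (here p))
      apart : ∀ {k k′} → Extends (set zero) F k → Extends (set 1F) F k′ → ¬ k ≗ k′
      apart (_ , _ , p) (_ , _ , q) eq with () ← trans (sym (trans (p ¬Df f≢0 f∉F) (set-f zero)))
        (trans (cong mod2 (eq f)) (trans (q ¬Df f≢0 f∉F) (set-f 1F)))

-- Assignments in ℤ₃

-- A permutation of ℤ₃, so it vanishes for exactly one argument. For a path, the argument is the
-- value at `g`, and the maps are the values at its other edges.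
Separating : (Fin 3 → Fin 3) → Set
Separating p = ∀ {c c′} → c ≢ c′ → p c ≢ p c′

nonzero-one : ∀ {p} → Separating p → ∃[ c ] (c ≢ 0F × p c ≢ 0F)
nonzero-one {p} inj with p 1F ≟ 0F
... | no  n = 1F , (λ ()) , n
... | yes z = 2F , (λ ()) , λ z′ → inj {1F} {2F} (λ ()) (trans z (sym z′))

nonzero-two : ∀ {p} → Separating p → (p 1F ≢ 0F × p 2F ≢ 0F) ⊎
  ∃[ c₁ ] ∃[ c₂ ] (c₁ ≢ 0F × c₂ ≢ 0F × p c₁ ≡ 0F × p c₂ ≢ 0F × p 0F ≢ 0F)
nonzero-two {p} inj with p 1F ≟ 0F | p 2F ≟ 0F
... | no n₁ | no n₂ = inj₁ (n₁ , n₂)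
... | yes z | _ = inj₂ (1F , 2F , (λ ()) , (λ ()) , z ,
      (λ z′ → inj {1F} {2F} (λ ()) (trans z (sym z′))) , λ z′ → inj {1F} {0F} (λ ()) (trans z (sym z′)))
... | no n | yes z = inj₂ (2F , 1F , (λ ()) , (λ ()) , z , n , λ z′ → inj {2F} {0F} (λ ()) (trans z (sym z′)))

-- If `p` and `q` vanish at different nonzero arguments, neither vanishes at 0, and the zero of `p`
-- is not one of `q`. Otherwise some nonzero argument suits both.
nonzero-both : ∀ {p q} → Separating p → Separating q →
  (∃[ c ] (c ≢ 0F × p c ≢ 0F × q c ≢ 0F)) ⊎
  ((∃[ c ] (c ≢ 0F × p c ≡ 0F × q c ≢ 0F)) × p 0F ≢ 0F × q 0F ≢ 0F)
nonzero-both {p} {q} injp injq with p 1F ≟ 0F | q 1F ≟ 0F | p 2F ≟ 0F | q 2F ≟ 0F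
... | no a | no b | _ | _ = inj₁ (1F , (λ ()) , a , b)
... | _ | _ | no a | no b = inj₁ (2F , (λ ()) , a , b)
... | yes a | _ | yes b | _ = ⊥-elim (injp {1F} {2F} (λ ()) (trans a (sym b)))
... | _ | yes a | _ | yes b = ⊥-elim (injq {1F} {2F} (λ ()) (trans a (sym b)))
... | yes a | no b | no _ | yes d = inj₂ ((1F , (λ ()) , a , b) ,
      (λ z → injp {1F} {0F} (λ ()) (trans a (sym z))) , λ z → injq {2F} {0F} (λ ()) (trans d (sym z)))
... | no _ | yes b | yes c | no d = inj₂ ((2F , (λ ()) , c , d) ,
      (λ z → injp {2F} {0F} (λ ()) (trans c (sym z))) , λ z → injq {1F} {0F} (λ ()) (trans b (sym z)))

nonzero-pair : ∀ {p} → Separating p → ∃[ c ] ∃[ c′ ] (c ≢ c′ × p c ≢ 0F × p c′ ≢ 0F)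
nonzero-pair inj with nonzero-two inj
... | inj₁ (n₁ , n₂) = 1F , 2F , (λ ()) , n₁ , n₂
... | inj₂ (_ , c₂ , _ , c₂≢0 , _ , n₂ , n₀) = c₂ , 0F , c₂≢0 , n₂ , n₀

enumerate : ∀ {n} (p : Fin n → Bool) → ∃[ l ] (Unique l × All (λ i → p i ≡ true) l × length l ≡ count p)
enumerate {zero}  p = [] , [] , [] , refl
enumerate {suc n} p with enumerate (p ∘ suc) | p zero in eq
... | l , u , a , len | false = map suc l , Uniqueₚ.map⁺ suc-injective u , Allₚ.map⁺ a , trans (length-map suc l) len
... | l , u , a , len | true  = zero ∷ map suc l , Allₚ.map⁺ (All.tabulate λ _ ()) ∷ Uniqueₚ.map⁺ suc-injective u ,
      eq ∷ Allₚ.map⁺ a , cong suc (trans (length-map suc l) len)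

-- Continuing an assignment along a path

module Choices (G : OrientedGraph) (conn3 : Cuts.Conn3 G) (cubic : Cubic G) (two : 2 ≤ OrientedGraph.#V G)
               (b : OrientedGraph.V G → Fin 6) (total : Boundary.sum ℤ₆ G b ≡ zero) where
  open OrientedGraph G
  open Cuts G
  open CubicGraph G conn3 cubic
  open Lift G b total
  open Boundary ℤ₃ G using (bd; bd-local; bd-0; bd-last; bd-unique; solve-at)

  Touches : VSet → E → Set
  Touches K s = ∃[ v ] (At s v × K v ≡ true)

  Avoids : VSet → E → Set
  Avoids S s = ∀ {v} → At s v → S v ≡ true → ⊥

  head-∉K : ∀ {K U g x} → Path K U g x → K x ≡ false
  head-∉K (last p _ _ _ _ _ _ _)   = p
  head-∉K (cons p _ _ _ _ _ _) = p

  head-∉U : ∀ {K U g x} → Path K U g x → U x ≡ false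
  head-∉U (last _ p _ _ _ _ _ _)   = p
  head-∉U (cons _ p _ _ _ _ _) = p

  head-R : ∀ {K U g x} → Path K U g x → rest K U x ≡ true
  head-R {K} {U} p = rest-intro K U (head-∉K p) (head-∉U p)

  disjoint-add : ∀ {K U x} → Disjoint K U → K x ≡ false → Disjoint K (add x U)
  disjoint-add {K} {U} {x} disj p k = add-false x U (disj k) λ { refl → true≢false k p }

  R-elim : ∀ K U x {v} → rest K (add x U) v ≡ true → rest K U v ≡ true × v ≢ x
  R-elim K U x r with add-out x U (rest-∉U K (add x U) r)
  ... | p , q = rest-intro K U (rest-∉K K (add x U) r) p , q

  R-cases : ∀ K U x {v} → rest K U v ≡ true → v ≡ x ⊎ rest K (add x U) v ≡ true
  R-cases K U x {v} r = go (v ≟ x)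
    where
    go : Dec (v ≡ x) → v ≡ x ⊎ rest K (add x U) v ≡ true
    go (yes p) = inj₁ p
    go (no n)  = inj₂ (rest-intro K (add x U) (rest-∉K K U r) (add-false x U (rest-∉U K U r) n))

  opaque
    -- At each vertex the onward edge `f` settles the boundary, and the recursive call preserves it,
    -- as it does with its own entry edge. The last of these edges goes to `U`, where no condition
    -- is imposed yet.
    solve : ∀ {K U g x w} → Path K U g x → Disjoint K U → Link w g x → U w ≡ true → ∀ (h : E → Fin 3) →
      ∃[ h′ ] ((∀ {v} → rest K U v ≡ true → bd h′ v ≡ b₃ v) × h′ g ≡ h g ×
               (∀ {s} → Touches K s → h′ s ≡ h s) × (∀ {s} → Avoids (rest K U) s → h′ s ≡ h s))
    solve {K} {U} {g} {x} (last {f = f} {u = u} ∉K ∉U s lo Kk lf Uu only) disj gl Uw h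
      with solve-at lf (link≢ lf) h (b₃ x)
    ... | h′ , bd-x , off = h′ , (λ r → subst (λ v → bd h′ v ≡ b₃ v) (sym (only r)) bd-x)
        , off g (Star.e₁≢e₃ s)
        , (λ {s} touch → off s λ { refl → f-touch touch })
        , λ {s} avoid → off s λ { refl → avoid (link-atˡ lf) (rest-intro K U ∉K ∉U) }
      where
      f-touch : Touches K f → ⊥
      f-touch (v , at , k) with at-link lf at
      ... | inj₁ refl = true≢false k ∉K
      ... | inj₂ refl = true≢false Uu (disj k)
    solve {K} {U} {g} {x} {w} (cons {o = o} {f = f} {y = y} ∉K ∉U s lo Kk lf path) disj gl Uw h
      with solve-at lf (link≢ lf) h (b₃ x)
    ... | h₁ , bd-x , off with solve path (disjoint-add {K} {U} disj ∉K) lf (add-here x U) h₁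
    ...   | h₂ , bd₂ , h₂f , h₂touch , h₂avoid = h₂ , bd-all , trans h₂g (off g (Star.e₁≢e₃ s))
          , (λ {s} touch → trans (h₂touch touch) (off s λ { refl → f-touch touch }))
          , λ {s} avoid → trans (h₂avoid λ at r → avoid at (proj₁ (R-elim K U x r)))
                                (off s λ { refl → avoid (link-atˡ lf) (rest-intro K U ∉K ∉U) })
      where
      f-touch : Touches K f → ⊥
      f-touch (v , at , k) with at-link lf at
      ... | inj₁ refl = true≢false k ∉K
      ... | inj₂ refl = true≢false k (head-∉K path)
      h₂g : h₂ g ≡ h₁ g
      h₂g = h₂avoid λ at r → outside (at-link gl at) r
        where
        outside : ∀ {v} → v ≡ w ⊎ v ≡ x → rest K (add x U) v ≡ true → ⊥
        outside (inj₁ refl) r = true≢false (add-old x U Uw) (rest-∉U K (add x U) r)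
        outside (inj₂ refl) r = proj₂ (R-elim K U x r) refl
      at-x : ∀ e → At e x → h₂ e ≡ h₁ e
      at-x e at with Star.only s at
      ... | inj₁ refl        = h₂g
      ... | inj₂ (inj₁ refl) = h₂touch (_ , link-atʳ lo , Kk)
      ... | inj₂ (inj₂ refl) = h₂f
      bd-all : ∀ {v} → rest K U v ≡ true → bd h₂ v ≡ b₃ v
      bd-all r with R-cases K U x r
      ... | inj₁ refl = trans (bd-local at-x) bd-x
      ... | inj₂ r′   = bd₂ r′

    -- A disagreement at `g` passes on to `f`: with equal values at `o` and `f`, `bd-unique` would
    -- force equality at `g`.
    separated : ∀ {K U g x w} → Path K U g x → Disjoint K U → Link w g x → ∀ {h k : E → Fin 3} →
      (∀ {v} → rest K U v ≡ true → bd h v ≡ bd k v) → (∀ {s} → Touches K s → h s ≡ k s) → h g ≢ k g →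
      ∀ {s v} → At s v → rest K U v ≡ true → Avoids K s → h s ≢ k s
    separated {K} {U} {g} {x} {w} path disj gl {h} {k} bd-eq touch g≢ = go path
      where
      step : ∀ {o f k₀} → rest K U x ≡ true → Star x g o f → Link x o k₀ → K k₀ ≡ true → h f ≢ k f
      step {o} {f} Rx s lo Kk hf = g≢ (bd-unique (link-sym gl) (link≢ (link-sym gl)) {h} {k} (bd-eq Rx) agree)
        where
        agree : ∀ e → At e x → e ≢ g → h e ≡ k e
        agree e at n with Star.only s at
        ... | inj₁ p           = ⊥-elim (n p)
        ... | inj₂ (inj₁ refl) = touch (_ , link-atʳ lo , Kk)
        ... | inj₂ (inj₂ refl) = hf
      at-x : ∀ {o f k₀ e} → rest K U x ≡ true → Star x g o f → Link x o k₀ → K k₀ ≡ true → At e x → Avoids K e → h e ≢ k e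
      at-x Rx s lo Kk at av with Star.only s at
      ... | inj₁ refl        = g≢
      ... | inj₂ (inj₁ refl) = ⊥-elim (av (link-atʳ lo) Kk)
      ... | inj₂ (inj₂ refl) = step Rx s lo Kk
      go : Path K U g x → ∀ {s v} → At s v → rest K U v ≡ true → Avoids K s → h s ≢ k s
      go (last ∉K ∉U s lo Kk lf Uu only) at r av with only r
      ... | refl = at-x r s lo Kk at av
      go p@(cons {y = y} ∉K ∉U s lo Kk lf path) at r av with R-cases K U x r
      ... | inj₁ refl = at-x r s lo Kk at av
      ... | inj₂ r′ = separated path (disjoint-add {K} {U} disj ∉K) lf {h} {k} (λ r → bd-eq (proj₁ (R-elim K U x r))) touch
                        (step (head-R p) s lo Kk) at r′ av

  record Ends (K U : VSet) (g : E) : Set where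
    field
      {x′ u′} : V
      e′      : E
      e′-link : Link x′ e′ u′
      Rx′     : rest K U x′ ≡ true
      Uu′     : U u′ ≡ true
      g≢e′    : g ≢ e′
      entries : ∀ {v s u} → Link v s u → rest K U v ≡ true → U u ≡ true → s ≡ g ⊎ s ≡ e′

  opaque
    ends : ∀ {K U g x w} → Path K U g x → Disjoint K U → Link w g x → U w ≡ true → Ends K U g
    ends {K} {U} {g} {x} {w} (last {o = o} {f = f} {u = u} ∉K ∉U s lo Kk lf Uu only) disj gl Uw = record
      { e′ = f ; e′-link = lf ; Rx′ = rest-intro K U ∉K ∉U ; Uu′ = Uu ; g≢e′ = Star.e₁≢e₃ s ; entries = ent }
      where
      ent : ∀ {v s u} → Link v s u → rest K U v ≡ true → U u ≡ true → s ≡ g ⊎ s ≡ f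
      ent l r Uu with only r
      ... | refl with Star.only s (link-atˡ l)
      ...   | inj₁ p = inj₁ p
      ...   | inj₂ (inj₂ p) = inj₂ p
      ...   | inj₂ (inj₁ refl) with link-target l lo
      ...     | refl = true≢false Uu (disj Kk)
    ends {K} {U} {g} {x} {w} (cons {o = o} {f = f} {k = k} {y = y} ∉K ∉U s lo Kk lf path) disj gl Uw
      with ends path (disjoint-add {K} {U} disj ∉K) lf (add-here x U)
    ... | en = record
      { e′ = e′ ; e′-link = e′-link ; Rx′ = R-x′ ; Uu′ = U-u′ ; g≢e′ = g≢ ; entries = ent }
      where
      open Ends en
      R-x′ : rest K U x′ ≡ true
      R-x′ = proj₁ (R-elim K U x Rx′)
      exit : ∀ {e c} → Link x e c → (e ≡ g × c ≡ w) ⊎ (e ≡ o × c ≡ k) ⊎ (e ≡ f × c ≡ y)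
      exit = exits s (link-sym gl) lo lf
      U-u′ : U u′ ≡ true
      -- The final edge cannot return to a vertex already passed, whose three edges are accounted
      -- for.
      U-u′ with add-elim x U Uu′
      ... | inj₁ p = p
      ... | inj₂ refl with exit (link-sym e′-link)
      ...   | inj₁ (_ , refl)        = true≢false Uw (rest-∉U K U R-x′)
      ...   | inj₂ (inj₁ (_ , refl)) = true≢false Kk (rest-∉K K U R-x′)
      ...   | inj₂ (inj₂ (p , _))    = ⊥-elim (g≢e′ (sym p))
      g≢ : g ≢ e′
      g≢ refl with at-link gl (link-atˡ e′-link)
      ... | inj₁ refl = true≢false Uw (rest-∉U K U R-x′)
      ... | inj₂ refl = proj₂ (R-elim K U x Rx′) refl
      ent : ∀ {v s u} → Link v s u → rest K U v ≡ true → U u ≡ true → s ≡ g ⊎ s ≡ e′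
      ent l r Uu with R-cases K U x r
      ... | inj₁ refl with exit l
      ...   | inj₁ (p , _)           = inj₁ p
      ...   | inj₂ (inj₁ (_ , refl)) = true≢false Uu (disj Kk)
      ...   | inj₂ (inj₂ (_ , refl)) = true≢false Uu (head-∉U-old path)
        where
        head-∉U-old : Path K (add x U) f y → U y ≡ false
        head-∉U-old p = proj₁ (add-out x U (head-∉U p))
      ent l r Uu | inj₂ r′ with entries l r′ (add-old x U Uu)
      ... | inj₂ p = inj₂ p
      ... | inj₁ refl with at-link lf (link-atʳ l)
      ...   | inj₁ refl = true≢false Uu ∉U
      ...   | inj₂ refl = true≢false Uu (proj₁ (add-out x U (head-∉U path)))

    later-edge : ∀ {K U g x w} → Path K U g x → Disjoint K U → Link w g x → U w ≡ true → ∀ {v} → rest K U v ≡ true →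
      ∃[ o ] ∃[ k ] (Link v o k × K k ≡ true × (∀ {o′ k′} → Link v o′ k′ → K k′ ≡ true → o′ ≡ o))
    later-edge {K} {U} {g} {x} {w} path disj gl Uw = go path
      where
      at-x : ∀ {o f k z} → Star x g o f → Link x o k → K k ≡ true → Link x f z → K z ≡ false →
        ∃[ o ] ∃[ k ] (Link x o k × K k ≡ true × (∀ {o′ k′} → Link x o′ k′ → K k′ ≡ true → o′ ≡ o))
      at-x {o} {f} {k} {z} s lo Kk lf ¬Kz = o , k , lo , Kk , unique
        where
        unique : ∀ {o′ k′} → Link x o′ k′ → K k′ ≡ true → o′ ≡ o
        unique l Kk′ with exits s (link-sym gl) lo lf l
        ... | inj₁ (_ , refl)        = true≢false Uw (disj Kk′)
        ... | inj₂ (inj₁ (p , _))    = p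
        ... | inj₂ (inj₂ (_ , refl)) = true≢false Kk′ ¬Kz
      go : Path K U g x → ∀ {v} → rest K U v ≡ true →
        ∃[ o ] ∃[ k ] (Link v o k × K k ≡ true × (∀ {o′ k′} → Link v o′ k′ → K k′ ≡ true → o′ ≡ o))
      go (last ∉K ∉U s lo Kk lf Uu only) r with only r
      ... | refl = at-x s lo Kk lf (Boolₚ.¬-not λ k → true≢false Uu (disj k))
      go (cons ∉K ∉U s lo Kk lf path) r with R-cases K U x r
      ... | inj₁ refl = at-x s lo Kk lf (head-∉K path)
      ... | inj₂ r′   = later-edge path (disjoint-add {K} {U} disj ∉K) lf (add-here x U) r′

    -- An edge of the path whose ends have different colours is a place where two pieces of the
    -- treated part can be joined.
    colouring : ∀ {K U g x} → Path K U g x → ∀ (κ : V → Bool) →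
      (∃[ v ] ∃[ s ] ∃[ v′ ] (Link v s v′ × rest K U v ≡ true × rest K U v′ ≡ true × κ v ≡ true × κ v′ ≡ false)) ⊎
      (∀ {v} → rest K U v ≡ true → κ v ≡ κ x)
    colouring (last ∉K ∉U s lo Kk lf Uu only) κ = inj₂ λ r → cong κ (only r)
    colouring {K} {U} {g} {x} (cons {f = f} {y = y} ∉K ∉U s lo Kk lf path) κ with colouring path κ
    ... | inj₁ (v , e , v′ , l , Rv , Rv′ , p) = inj₁ (v , e , v′ , l , proj₁ (R-elim K U x Rv) , proj₁ (R-elim K U x Rv′) , p)
    ... | inj₂ same = compare (κ x) (κ y) refl refl
      where
      Rx : rest K U x ≡ true
      Rx = rest-intro K U ∉K ∉U
      Ry : rest K U y ≡ true
      Ry = proj₁ (R-elim K U x (head-R path))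
      equal : κ x ≡ κ y → ∀ {v} → rest K U v ≡ true → κ v ≡ κ x
      equal p r with R-cases K U x r
      ... | inj₁ refl = refl
      ... | inj₂ r′   = trans (same r′) (sym p)
      compare : ∀ a b → κ x ≡ a → κ y ≡ b →
        (∃[ v ] ∃[ s ] ∃[ v′ ] (Link v s v′ × rest K U v ≡ true × rest K U v′ ≡ true × κ v ≡ true × κ v′ ≡ false)) ⊎
        (∀ {v} → rest K U v ≡ true → κ v ≡ κ x)
      compare true  true  p q = inj₂ (equal (trans p (sym q)))
      compare false false p q = inj₂ (equal (trans p (sym q)))
      compare true  false p q = inj₁ (x , f , y , lf , Rx , Ry , p , q)
      compare false true  p q = inj₁ (y , f , x , link-sym lf , Ry , Rx , q , p)

  -- States of the treated part

  Joined : VSet → (E → Set) → V → V → Set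
  Joined K D u v = ∃[ s ] (Link u s v × K u ≡ true × K v ≡ true × D s)

  _~[_,_]_ : V → VSet → (E → Set) → V → Set
  u ~[ K , D ] v = EqClosure (Joined K D) u v

  join : ∀ {K D u s v} → Link u s v → K u ≡ true → K v ≡ true → D s → u ~[ K , D ] v
  join l p q d = fwd (_ , l , p , q , d) ◅ ε

  ~-sym : ∀ {K D u v} → u ~[ K , D ] v → v ~[ K , D ] u
  ~-sym = EqC.symmetric _

  ~-map : ∀ {K D L D′ u v} → (∀ {v} → K v ≡ true → L v ≡ true) → (∀ {s} → Touches K s → D s → D′ s) →
    u ~[ K , D ] v → u ~[ L , D′ ] v
  ~-map {K} {D} {L} {D′} sub f = EqC.gmap id λ { (s , l , p , q , d) → s , l , sub p , sub q , f (_ , link-atˡ l , p) d }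

  Live : (E → Fin 3) → E → Set
  Live h s = h s ≢ zero

  Balanced : VSet → (E → Fin 3) → Set
  Balanced K h = ∀ {v} → K v ≡ true → bd h v ≡ b₃ v

  -- Only the edges with an end in `K` are decided. Assignments that differ at such an edge have
  -- disjoint sets of solutions, so their counts add up.
  Completes : VSet → (E → Fin 3) → (E → Fin 6) → Set
  Completes K h k = NowhereZero G b k × (∀ {s} → Touches K s → mod3 (k s) ≡ h s)

  record Alive (K : VSet) (h : E → Fin 3) : Set where
    field
      balanced  : Balanced K h
      alive     : ∀ {u s v} → Link u s v → K u ≡ true → K v ≡ false → Live h s
      connected : ∀ {u v} → K u ≡ true → K v ≡ true → u ~[ K , Live h ] v

  -- The edge `s₀` may vanish. It leaves `K`, so connectedness within `K` does not involve it.
  record Dead (K : VSet) (h : E → Fin 3) (s₀ : E) : Set where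
    field
      balanced  : Balanced K h
      {u₀ v₀}   : V
      link₀     : Link u₀ s₀ v₀
      Ku₀       : K u₀ ≡ true
      ¬Kv₀      : K v₀ ≡ false
      alive     : ∀ {u s v} → Link u s v → K u ≡ true → K v ≡ false → s ≢ s₀ → Live h s
      connected : ∀ {u v} → K u ≡ true → K v ≡ true → u ~[ K , Live h ] v

  -- The state after a dead edge has met a path with a single vertex: there may be two pieces, but
  -- each has a live edge to the untreated part, where they can still be joined.
  record Two (K : VSet) (h : E → Fin 3) : Set where
    field
      balanced  : Balanced K h
      colour    : V → Bool
      alive     : ∀ {u s v} → Link u s v → K u ≡ true → K v ≡ false → Live h s
      connected : ∀ {u v} → K u ≡ true → K v ≡ true → colour u ≡ colour v → u ~[ K , Live h ] v
      leaves    : ∀ β → ∃[ u ] ∃[ s ] ∃[ v ] (Link u s v × K u ≡ true × K v ≡ false × colour u ≡ β)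

  module Finish {K : VSet} {x : V} (∉K : K x ≡ false) (others : ∀ {v : V} → v ≢ x → K v ≡ true) where

    out-K : ∀ {v} → K v ≡ false → v ≡ x
    out-K {v} p with v ≟ x
    ... | yes q = q
    ... | no  n = true≢false (others n) p

    opaque
      -- The boundary at `x` is right automatically, by `bd-last`; `Lift` then applies.
      finish : ∀ {h} → Balanced K h → (F : List E) → Unique F → All (Live h) F →
        (∀ {u v} → u ~[ (λ _ → true) , (λ s → Live h s × s ∉ F) ] v) → Count (2 ^ length F) (Completes K h)
      finish {h} bal F uniq live conn =
        count-map {P = Extends x h bd-all D proj₁ conn-D (λ _ → zero) F} {Q = Completes K h}
          (λ { (nz , m3 , _) → nz , λ {s} _ → m3 s })
          (lift-count x h bd-all D proj₁ conn-D F uniq (All.tabulate λ m → All.lookup live m , λ d → proj₂ d m) (λ _ → zero))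
        where
        D : E → Set
        D s = Live h s × s ∉ F
        conn-D : ∀ u v → EqClosure (Boundary.Linked ℤ₂ G D) u v
        conn-D u v = EqC.gmap id (λ { (s , l , _ , _ , d) → s , d , l }) conn
        bd-all : ∀ v → bd h v ≡ b₃ v
        bd-all v with v ≟ x
        ... | yes refl = bd-last {b₃} b₃-total h x λ u n → bal (others n)
        ... | no  n    = bal (others n)

    everywhere : ∀ {D : E → Set} → (∀ {u v} → K u ≡ true → K v ≡ true → u ~[ K , D ] v) →
      ∀ {a s} → Link a s x → K a ≡ true → D s → ∀ {u v} → u ~[ (λ _ → true) , D ] v
    everywhere {D} conn {a} l Ka Ds {u} {v} = to-a u ◅◅ ~-sym (to-a v)
      where
      to-a : ∀ u → u ~[ (λ _ → true) , D ] a
      to-a u with u ≟ x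
      ... | yes refl = join (link-sym l) refl refl Ds
      ... | no n     = ~-map {K} {D} (λ _ → refl) (λ _ d → d) (conn (others n) Ka)

    finish-0 : ∀ {h} → Balanced K h → (∀ {u v} → u ~[ (λ _ → true) , Live h ] v) → Count 1 (Completes K h)
    finish-0 {h} bal conn = finish bal [] [] [] λ {u} {v} →
      ~-map {λ _ → true} {Live h} (λ _ → refl) (λ _ d → d , λ ()) (conn {u} {v})

    x-link : ∀ {u s v} → Link u s v → K v ≡ false → Link u s x
    x-link l p = subst (Link _ _) (out-K p) l

    finish-alive : ∀ {h} → Alive K h → ∀ {k} → K k ≡ true → Count 1 (Completes K h)
    finish-alive A Kk with some-crossing K Kk ∉K
    ... | s , a , c , l , Ka , ¬Kc = finish-0 balanced (everywhere connected (x-link l ¬Kc) Ka (alive l Ka ¬Kc))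
      where open Alive A

    finish-dead : ∀ {h s₀} → Dead K h s₀ → Count 1 (Completes K h)
    finish-dead {s₀ = s₀} A with cut3 conn3 K (Dead.Ku₀ A) ∉K s₀ s₀
    ... | s , a , c , l , Ka , ¬Kc , n , _ = finish-0 balanced (everywhere connected (x-link l ¬Kc) Ka (alive l Ka ¬Kc n))
      where open Dead A

    finish-two : ∀ {h} → Two K h → Count 1 (Completes K h)
    finish-two {h} A with Two.leaves A true | Two.leaves A false
    ... | a , s , c , l , Ka , ¬Kc , ca | a′ , s′ , c′ , l′ , Ka′ , ¬Kc′ , ca′ =
      finish-0 balanced λ {u} {v} → to-x u ◅◅ ~-sym (to-x v)
      where
      open Two A
      to-x : ∀ u → u ~[ (λ _ → true) , Live h ] x
      to-x u with u ≟ x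
      ... | yes refl = ε
      ... | no n with colour u in cu
      ...   | true  = ~-map {K} {Live h} (λ _ → refl) (λ _ d → d) (connected (others n) Ka (trans cu (sym ca)))
                      ◅◅ join (x-link l ¬Kc) refl refl (alive l Ka ¬Kc)
      ...   | false = ~-map {K} {Live h} (λ _ → refl) (λ _ d → d) (connected (others n) Ka′ (trans cu (sym ca′)))
                      ◅◅ join (x-link l′ ¬Kc′) refl refl (alive l′ Ka′ ¬Kc′)

  -- `K` is the treated part before the path `R`, and `L` the treated part after it. What leaves `L`
  -- is `g`, `e′` and the edges from `K` that pass over the path.
  module Pass {K L U : VSet} {w : V} {g : E} {x : V} (L≡ : ∀ (v : V) → L v ≡ not (U v)) (disj : Disjoint K U)
              (gl : Link w g x) (Uw : U w ≡ true) (path : Path K U g x) where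

    R : VSet
    R = rest K U

    open Ends (ends path disj gl Uw) public

    Rx : R x ≡ true
    Rx = head-R path

    K⊆L : ∀ {v} → K v ≡ true → L v ≡ true
    K⊆L {v} k = trans (L≡ v) (cong not (disj k))

    R⊆L : ∀ {v} → R v ≡ true → L v ≡ true
    R⊆L {v} r = trans (L≡ v) (cong not (rest-∉U K U r))

    U-∉L : ∀ {v} → U v ≡ true → L v ≡ false
    U-∉L {v} u = trans (L≡ v) (cong not u)

    U-∉K : ∀ {v} → U v ≡ true → K v ≡ false
    U-∉K u = Boolₚ.¬-not λ k → true≢false u (disj k)

    ∉L-U : ∀ {v} → L v ≡ false → U v ≡ true
    ∉L-U {v} p = trans (sym (Boolₚ.not-involutive (U v))) (cong not (trans (sym (L≡ v)) p))

    L-cases : ∀ {v} → L v ≡ true → K v ≡ true ⊎ R v ≡ true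
    L-cases {v} l with place K U v
    ... | inK k = inj₁ k
    ... | inR r = inj₂ r
    ... | inU u = true≢false l (U-∉L u)

    L-leaves : ∀ {u s v} → Link u s v → L u ≡ true → L v ≡ false →
      (K u ≡ true × K v ≡ false) ⊎ (R u ≡ true × (s ≡ g ⊎ s ≡ e′))
    L-leaves l Lu ¬Lv with L-cases Lu
    ... | inj₁ k = inj₁ (k , U-∉K (∉L-U ¬Lv))
    ... | inj₂ r = inj₂ (r , entries l r (∉L-U ¬Lv))

    Kw : K w ≡ false
    Kw = U-∉K Uw

    later : ∀ {v} → R v ≡ true →
      ∃[ o ] ∃[ k ] (Link v o k × K k ≡ true × (∀ {o′ k′} → Link v o′ k′ → K k′ ≡ true → o′ ≡ o))
    later = later-edge path disj gl Uw

    avoids : ∀ {u s v} → Link u s v → K u ≡ false → K v ≡ false → Avoids K s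
    avoids l p q at k with at-link l at
    ... | inj₁ refl = true≢false k p
    ... | inj₂ refl = true≢false k q

    g-avoids : Avoids K g
    g-avoids = avoids gl Kw (rest-∉K K U Rx)

    e′-avoids : Avoids K e′
    e′-avoids = avoids e′-link (rest-∉K K U Rx′) (U-∉K Uu′)

    -- The assignments that continue h along the path, indexed by their value at g.
    module Family (h : E → Fin 3) (bal : Balanced K h) where

      start : Fin 3 → E → Fin 3
      start c s = if does (s ≟ g) then c else h s

      start-g : ∀ c → start c g ≡ c
      start-g c with g ≟ g
      ... | yes _ = refl
      ... | no  q = ⊥-elim (q refl)

      start-other : ∀ c {s} → s ≢ g → start c s ≡ h s
      start-other c {s} n with s ≟ g
      ... | yes p = ⊥-elim (n p)
      ... | no  _ = refl

      opaque
        H : Fin 3 → E → Fin 3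
        H c = proj₁ (solve path disj gl Uw (start c))

        H-g : ∀ c → H c g ≡ c
        H-g c = trans (proj₁ (proj₂ (proj₂ (solve path disj gl Uw (start c))))) (start-g c)

        H-touch : ∀ c {s} → Touches K s → H c s ≡ h s
        H-touch c {s} touch = trans (proj₁ (proj₂ (proj₂ (proj₂ (solve path disj gl Uw (start c))))) touch)
          (start-other c λ { refl → g-avoids (proj₁ (proj₂ touch)) (proj₂ (proj₂ touch)) })

        H-R : ∀ c {v} → R v ≡ true → bd (H c) v ≡ b₃ v
        H-R c = proj₁ (proj₂ (solve path disj gl Uw (start c)))

      H-balanced : ∀ c → Balanced L (H c)
      H-balanced c l with L-cases l
      ... | inj₁ k = trans (bd-local λ s at → H-touch c (_ , at , k)) (bal k)
      ... | inj₂ r = H-R c r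

      H-separating : ∀ {s v} → At s v → R v ≡ true → Avoids K s → Separating (λ c → H c s)
      H-separating at r av {c} {c′} n = separated path disj gl {H c} {H c′}
        (λ r → trans (H-R c r) (sym (H-R c′ r))) (λ touch → trans (H-touch c touch) (sym (H-touch c′ touch)))
        (λ eq → n (trans (sym (H-g c)) (trans eq (H-g c′)))) at r av

      H-e′ : Separating (λ c → H c e′)
      H-e′ = H-separating (link-atˡ e′-link) Rx′ e′-avoids

      H-g≢0 : ∀ {c} → c ≢ zero → Live (H c) g
      H-g≢0 {c} n eq = n (trans (sym (H-g c)) eq)

      H-live : ∀ c {s} → Touches K s → Live h s → Live (H c) s
      H-live c touch live eq = live (trans (sym (H-touch c touch)) eq)

      lift-~ : ∀ c {u v} → u ~[ K , Live h ] v → u ~[ L , Live (H c) ] v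
      lift-~ c = ~-map K⊆L (λ touch → H-live c touch)

      attach : ∀ c {v o k} → R v ≡ true → Link v o k → K k ≡ true → Live h o → v ~[ L , Live (H c) ] k
      attach c r l k live = join l (R⊆L r) (K⊆L k) (H-live c (_ , link-atʳ l , k) live)

      connect : ∀ c → (∀ {u v} → K u ≡ true → K v ≡ true → u ~[ L , Live (H c) ] v) →
        (∀ {v} → R v ≡ true → ∃[ k ] (K k ≡ true × v ~[ L , Live (H c) ] k)) →
        ∀ {u v} → L u ≡ true → L v ≡ true → u ~[ L , Live (H c) ] v
      connect c conn att Lu Lv with to Lu | to Lv
        where
        to : ∀ {v} → L v ≡ true → ∃[ k ] (K k ≡ true × v ~[ L , Live (H c) ] k)
        to Lv with L-cases Lv
        ... | inj₁ k = _ , k , ε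
        ... | inj₂ r = att r
      ... | k , Kk , p | k′ , Kk′ , q = p ◅◅ conn Kk Kk′ ◅◅ ~-sym q

      completes : ∀ c {k} → Completes L (H c) k → Completes K h k
      completes c (nz , m) = nz , λ { (v , at , k) → trans (m (v , at , K⊆L k)) (H-touch c (v , at , k)) }

      value : ∀ c {k} → Completes L (H c) k → mod3 (k g) ≡ c
      value c (_ , m) = trans (m (_ , link-atʳ gl , R⊆L Rx)) (H-g c)

      opaque
        count-two : ∀ {c c′ N M} → c ≢ c′ → Count N (Completes L (H c)) → Count M (Completes L (H c′)) →
          Count (N + M) (Completes K h)
        count-two {c} {c′} n p q = count-+ {P = Completes L (H c)} {Q = Completes L (H c′)} {R = Completes K h} p q
          (λ x y eq → n (trans (sym (value c x)) (trans (cong mod3 (eq g)) (value c′ y)))) (completes c) (completes c′)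

        -- The intermediate predicate remembers that the second and third families do not take the
        -- value `c` at `g`.
        count-three : ∀ {c c′ c″ N M O} → c ≢ c′ → c ≢ c″ → c′ ≢ c″ → Count N (Completes L (H c)) →
          Count M (Completes L (H c′)) → Count O (Completes L (H c″)) → Count (N + (M + O)) (Completes K h)
        count-three {c} {c′} {c″} n n′ n″ p q r = count-+
          {P = Completes L (H c)} {Q = λ k → Completes K h k × mod3 (k g) ≢ c} {R = Completes K h} p
          (count-+ {P = Completes L (H c′)} {Q = Completes L (H c″)} {R = λ k → Completes K h k × mod3 (k g) ≢ c} q r
            (λ x y eq → n″ (trans (sym (value c′ x)) (trans (cong mod3 (eq g)) (value c″ y))))
            (λ x → completes c′ x , λ eq → n (trans (sym eq) (value c′ x)))
            (λ x → completes c″ x , λ eq → n′ (trans (sym eq) (value c″ x))))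
          (λ { x (_ , y) eq → y (trans (sym (cong mod3 (eq g))) (value c x)) }) (completes c) proj₁

        count-single : ∀ c {N} → Count N (Completes L (H c)) → Count N (Completes K h)
        count-single c = count-map {P = Completes L (H c)} {Q = Completes K h} (completes c)

      module _ (live : ∀ {u : V} {s : E} {v : V} → Link u s v → K u ≡ true → K v ≡ false → L v ≡ false → Live h s) where

        new-alive : ∀ {c} → Live (H c) g → Live (H c) e′ →
          ∀ {u s v} → Link u s v → L u ≡ true → L v ≡ false → Live (H c) s
        new-alive {c} p q l Lu ¬Lv with L-leaves l Lu ¬Lv
        ... | inj₁ (Ku , ¬Kv)      = H-live c (_ , link-atˡ l , Ku) (live l Ku ¬Kv ¬Lv)
        ... | inj₂ (_ , inj₁ refl) = p
        ... | inj₂ (_ , inj₂ refl) = q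

        to-alive : ∀ {c} → (∀ {u v} → L u ≡ true → L v ≡ true → u ~[ L , Live (H c) ] v) →
          Live (H c) g → Live (H c) e′ → Alive L (H c)
        to-alive {c} conn p q = record { balanced = H-balanced c ; connected = conn ; alive = new-alive p q }

        to-dead-g : ∀ {c} → (∀ {u v} → L u ≡ true → L v ≡ true → u ~[ L , Live (H c) ] v) →
          Live (H c) e′ → Dead L (H c) g
        to-dead-g {c} conn q = record
          { balanced = H-balanced c ; link₀ = link-sym gl ; Ku₀ = R⊆L Rx ; ¬Kv₀ = U-∉L Uw
          ; alive = alive ; connected = conn }
          where
          alive : ∀ {u s v} → Link u s v → L u ≡ true → L v ≡ false → s ≢ g → Live (H c) s
          alive l Lu ¬Lv n with L-leaves l Lu ¬Lv
          ... | inj₁ (Ku , ¬Kv)      = H-live c (_ , link-atˡ l , Ku) (live l Ku ¬Kv ¬Lv)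
          ... | inj₂ (_ , inj₁ p)    = ⊥-elim (n p)
          ... | inj₂ (_ , inj₂ refl) = q

        to-dead-e′ : ∀ {c} → (∀ {u v} → L u ≡ true → L v ≡ true → u ~[ L , Live (H c) ] v) →
          Live (H c) g → Dead L (H c) e′
        to-dead-e′ {c} conn p = record
          { balanced = H-balanced c ; link₀ = e′-link ; Ku₀ = R⊆L Rx′ ; ¬Kv₀ = U-∉L Uu′
          ; alive = alive ; connected = conn }
          where
          alive : ∀ {u s v} → Link u s v → L u ≡ true → L v ≡ false → s ≢ e′ → Live (H c) s
          alive l Lu ¬Lv n with L-leaves l Lu ¬Lv
          ... | inj₁ (Ku , ¬Kv)      = H-live c (_ , link-atˡ l , Ku) (live l Ku ¬Kv ¬Lv)
          ... | inj₂ (_ , inj₁ refl) = p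
          ... | inj₂ (_ , inj₂ q)    = ⊥-elim (n q)

    module _ {p q q′ : ℕ} (countA : ∀ {h : E → Fin 3} → Alive L h → Count p (Completes L h))
             (countG : ∀ {h : E → Fin 3} → Dead L h g → Count q (Completes L h))
             (countE : ∀ {h : E → Fin 3} → Dead L h e′ → Count q′ (Completes L h)) where

      opaque
        -- If the value 0 at `g` makes `e′` vanish too, both other values keep everything alive.
        -- Otherwise one value is harmless, one kills only `g`, and one kills only `e′`.
        alive-step : ∀ {h} → Alive K h → Count (p + p) (Completes K h) ⊎ Count (p + (q + q′)) (Completes K h)
        alive-step {h} A = go (nonzero-two H-e′)
          where
          open Alive A
          open Family h balanced
          conn : ∀ c {u v} → L u ≡ true → L v ≡ true → u ~[ L , Live (H c) ] v
          conn c = connect c (λ Ku Kv → lift-~ c (connected Ku Kv)) att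
            where
            att : ∀ {v} → R v ≡ true → ∃[ k ] (K k ≡ true × v ~[ L , Live (H c) ] k)
            att r with later r
            ... | o , k , l , Kk , _ = k , Kk , attach c r l Kk (alive (link-sym l) Kk (rest-∉K K U r))
          live : ∀ {u s v} → Link u s v → K u ≡ true → K v ≡ false → L v ≡ false → Live h s
          live l p q _ = alive l p q
          go : (H 1F e′ ≢ 0F × H 2F e′ ≢ 0F) ⊎
               ∃[ c₁ ] ∃[ c₂ ] (c₁ ≢ 0F × c₂ ≢ 0F × H c₁ e′ ≡ 0F × H c₂ e′ ≢ 0F × H 0F e′ ≢ 0F) →
               Count (p + p) (Completes K h) ⊎ Count (p + (q + q′)) (Completes K h)
          go (inj₁ (n₁ , n₂)) = inj₁ (count-two {1F} {2F} (λ ())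
            (countA (to-alive live (conn 1F) (H-g≢0 λ ()) n₁)) (countA (to-alive live (conn 2F) (H-g≢0 λ ()) n₂)))
          go (inj₂ (c₁ , c₂ , c₁≢0 , c₂≢0 , z₁ , n₂ , n₀)) = inj₂ (count-three {c₂} {0F} {c₁} c₂≢0
            (λ { refl → n₂ z₁ }) (λ z → c₁≢0 (sym z))
            (countA (to-alive live (conn c₂) (H-g≢0 c₂≢0) n₂))
            (countG (to-dead-g live (conn 0F) n₀))
            (countE (to-dead-e′ live (conn c₁) (H-g≢0 c₁≢0))))

    opaque
      -- The dead edge passes over the path, so every vertex of the path is attached by its own live
      -- edge to `K`. A value that keeps `g` and `e′` alive leaves `s₀` as the only exception.
      dead-far : ∀ {N h s₀} (A : Dead K h s₀) → L (Dead.v₀ A) ≡ false →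
        (∀ {h} → Dead L h s₀ → Count N (Completes L h)) → Count N (Completes K h)
      dead-far {N} {h} {s₀} A ¬Lv₀ cnt = go (nonzero-one H-e′)
        where
        open Dead A
        open Family h balanced
        go : ∃[ c ] (c ≢ 0F × H c e′ ≢ 0F) → Count N (Completes K h)
        go (c , c≢0 , n) = count-single c (cnt record
          { balanced = H-balanced c ; link₀ = link₀ ; Ku₀ = K⊆L Ku₀ ; ¬Kv₀ = ¬Lv₀ ; alive = alive′ ; connected = conn })
          where
          alive′ : ∀ {u s v} → Link u s v → L u ≡ true → L v ≡ false → s ≢ s₀ → Live (H c) s
          alive′ l Lu ¬Lv m with L-leaves l Lu ¬Lv
          ... | inj₁ (Ku , ¬Kv)      = H-live c (_ , link-atˡ l , Ku) (alive l Ku ¬Kv m)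
          ... | inj₂ (_ , inj₁ refl) = H-g≢0 c≢0
          ... | inj₂ (_ , inj₂ refl) = n
          conn : ∀ {u v} → L u ≡ true → L v ≡ true → u ~[ L , Live (H c) ] v
          conn = connect c (λ Ku Kv → lift-~ c (connected Ku Kv)) att
            where
            att : ∀ {v} → R v ≡ true → ∃[ k ] (K k ≡ true × v ~[ L , Live (H c) ] k)
            att {v} r with later r
            ... | o , k , l , Kk , _ = k , Kk , attach c r l Kk (alive (link-sym l) Kk (rest-∉K K U r) o≢)
              where
              o≢ : o ≢ s₀
              o≢ refl with at-link link₀ (link-atˡ l)
              ... | inj₁ refl = true≢false Ku₀ (rest-∉K K U r)
              ... | inj₂ refl = true≢false (R⊆L r) ¬Lv₀

    module _ {p q q′ : ℕ} (countA : ∀ {h : E → Fin 3} → Alive L h → Count p (Completes L h))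
             (countG : ∀ {h : E → Fin 3} → Dead L h g → Count q (Completes L h))
             (countE : ∀ {h : E → Fin 3} → Dead L h e′ → Count q′ (Completes L h)) where

      opaque
        -- A vertex v of the path that is cut off from the later vertices can
        -- be joined to a neighbour on the path, unless this kills g or e′; in
        -- that case both of these choices work.
        reattach : ∀ {h} (bal : Balanced K h) →
          (∀ {u s v} → Link u s v → K u ≡ true → K v ≡ false → L v ≡ false → Live h s) →
          ∀ {v s v′} → Link v s v′ → R v ≡ true → R v′ ≡ true →
          (∀ c → Live (Family.H h bal c) s → ∀ {u v} → L u ≡ true → L v ≡ true → u ~[ L , Live (Family.H h bal c) ] v) →
          Count p (Completes K h) ⊎ Count (q + q′) (Completes K h)
        reattach {h} bal live {v} {s} {v′} l Rv Rv′ conn =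
          go (nonzero-both H-e′ (H-separating (link-atˡ l) Rv (avoids l (rest-∉K K U Rv) (rest-∉K K U Rv′))))
          where
          open Family h bal
          go : (∃[ c ] (c ≢ 0F × H c e′ ≢ 0F × H c s ≢ 0F)) ⊎
               ((∃[ c ] (c ≢ 0F × H c e′ ≡ 0F × H c s ≢ 0F)) × H 0F e′ ≢ 0F × H 0F s ≢ 0F) →
               Count p (Completes K h) ⊎ Count (q + q′) (Completes K h)
          go (inj₁ (c , c≢0 , n , m)) = inj₁ (count-single c (countA (to-alive live (conn c m) (H-g≢0 c≢0) n)))
          go (inj₂ ((c , c≢0 , z , m) , n₀ , m₀)) = inj₂ (count-two {0F} {c} (λ e → c≢0 (sym e))
            (countG (to-dead-g live (conn 0F m₀) n₀)) (countE (to-dead-e′ live (conn c m) (H-g≢0 c≢0))))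

        -- If the path has another vertex, the end of `s₀` has a neighbour on it and `reattach`
        -- applies. Otherwise the path is a single vertex that may have lost its only edge to `K`;
        -- it becomes a colour class by itself.
        dead-near : ∀ {h s₀} (A : Dead K h s₀) → R (Dead.v₀ A) ≡ true →
          (∀ {h} → Two L h → Count 1 (Completes L h)) →
          (Count p (Completes K h) ⊎ Count (q + q′) (Completes K h)) ⊎
          ((∀ {v} → R v ≡ true → v ≡ Dead.v₀ A) × Count 1 (Completes K h))
        dead-near {h} {s₀} A Rv₀ countT = cases (colouring path (single v₀))
          where
          open Dead A
          open Family h balanced
          live : ∀ {u s v} → Link u s v → K u ≡ true → K v ≡ false → L v ≡ false → Live h s
          live l Ku ¬Kv ¬Lv = alive l Ku ¬Kv λ { refl → absurd (at-link link₀ (link-atʳ l)) ¬Kv ¬Lv }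
            where
            absurd : ∀ {v} → v ≡ u₀ ⊎ v ≡ v₀ → K v ≡ false → L v ≡ false → ⊥
            absurd (inj₁ refl) ¬Kv _ = true≢false Ku₀ ¬Kv
            absurd (inj₂ refl) _ ¬Lv = true≢false (R⊆L Rv₀) ¬Lv
          other : ∀ c {v} → R v ≡ true → v ≢ v₀ → ∃[ k ] (K k ≡ true × v ~[ L , Live (H c) ] k)
          other c {v} r n with later r
          ... | o , k , l , Kk , _ = k , Kk , attach c r l Kk (alive (link-sym l) Kk (rest-∉K K U r) o≢)
            where
            o≢ : o ≢ s₀
            o≢ refl with at-link link₀ (link-atˡ l)
            ... | inj₁ refl = true≢false Ku₀ (rest-∉K K U r)
            ... | inj₂ p = n p
          cases : (∃[ v ] ∃[ s ] ∃[ v′ ] (Link v s v′ × R v ≡ true × R v′ ≡ true × single v₀ v ≡ true × single v₀ v′ ≡ false)) ⊎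
                  (∀ {v} → R v ≡ true → single v₀ v ≡ single v₀ x) →
                  (Count p (Completes K h) ⊎ Count (q + q′) (Completes K h)) ⊎
                  ((∀ {v} → R v ≡ true → v ≡ v₀) × Count 1 (Completes K h))
          cases (inj₁ (v , s , v′ , l , Rv , Rv′ , isv , isn)) = inj₁ (reattach balanced live l Rv Rv′ conn)
            where
            conn : ∀ c → Live (H c) s → ∀ {u v} → L u ≡ true → L v ≡ true → u ~[ L , Live (H c) ] v
            conn c ls = connect c (λ Ku Kv → lift-~ c (connected Ku Kv)) att
              where
              att : ∀ {u} → R u ≡ true → ∃[ k ] (K k ≡ true × u ~[ L , Live (H c) ] k)
              att {u} r with u ≟ v₀ | other c Rv′ (λ e → true≢false (subst (λ z → single v₀ z ≡ true) (sym e) (single-here v₀)) isn)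
              ... | no n | _ = other c r n
              ... | yes refl | k , Kk , pth with single-elim v₀ {v} isv
              ...   | refl = k , Kk , join l (R⊆L Rv) (R⊆L Rv′) ls ◅◅ pth
          cases (inj₂ same) = inj₂ (only , split (nonzero-one H-e′))
            where
            only : ∀ {v} → R v ≡ true → v ≡ v₀
            only r = single-elim v₀ {_} (trans (same r) (trans (sym (same Rv₀)) (single-here v₀)))
            split : ∃[ c ] (c ≢ 0F × H c e′ ≢ 0F) → Count 1 (Completes K h)
            split (c , c≢0 , n) = count-single c (countT record
              { balanced = H-balanced c ; colour = single v₀ ; alive = new-alive live (H-g≢0 c≢0) n
              ; connected = conn ; leaves = leaves })
              where
              conn : ∀ {u v} → L u ≡ true → L v ≡ true → single v₀ u ≡ single v₀ v → u ~[ L , Live (H c) ] v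
              conn {u} {v} Lu Lv eq with L-cases Lu | L-cases Lv
              ... | inj₁ Ku | inj₁ Kv = lift-~ c (connected Ku Kv)
              ... | inj₂ Ru | inj₂ Rv = subst (λ z → u ~[ L , Live (H c) ] z) (trans (only Ru) (sym (only Rv))) ε
              ... | inj₁ Ku | inj₂ Rv with only Rv
              ...   | refl = true≢false Ku (subst (λ z → K z ≡ false) (sym (single-elim v₀ (trans eq (single-here v₀)))) ¬Kv₀)
              conn {u} {v} Lu Lv eq | inj₂ Ru | inj₁ Kv with only Ru
              ...   | refl = true≢false Kv (subst (λ z → K z ≡ false) (sym (single-elim v₀ (trans (sym eq) (single-here v₀)))) ¬Kv₀)
              leaves : ∀ β → ∃[ u ] ∃[ s ] ∃[ v ] (Link u s v × L u ≡ true × L v ≡ false × single v₀ u ≡ β)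
              leaves true = x , g , w , link-sym gl , R⊆L Rx , U-∉L Uw , subst (λ z → single v₀ z ≡ true) (sym (only Rx)) (single-here v₀)
              -- `K` has a leaving edge other than `s₀`. It cannot end at `v₀`, whose only edge to
              -- `K` is `s₀`, so it leads to `U`.
              leaves false with cut3 conn3 K Ku₀ ¬Kv₀ s₀ s₀
              ... | s , a , d , l , Ka , ¬Kd , s≢ , _ with place K U d
              ...   | inK Kd = true≢false Kd ¬Kd
              ...   | inU Ud = a , s , d , l , K⊆L Ka , U-∉L Ud , single-false v₀ {a} λ { refl → true≢false Ka ¬Kv₀ }
              ...   | inR Rd with only Rd | later Rd
              ...     | refl | o , k , lo , Kk , unique = ⊥-elim (s≢ (trans (unique (link-sym l) Ka) (sym (unique (link-sym link₀) Ku₀))))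

        -- Each vertex of the path takes the colour of its neighbour in `K`. If both colours occur,
        -- `reattach` joins the classes along an edge of the path. If not, the classes persist: `g`
        -- leaves the one that contains the path, and the edges that left the other one lead to `U`.
        two-step : 1 ≤ p → 1 ≤ q → (∀ {h} → Two L h → Count 1 (Completes L h)) →
          ∀ {h} → Two K h → Count 1 (Completes K h)
        two-step 1≤p 1≤q countT {h} A = cases (colouring path κ)
          where
          open Two A
          open Family h balanced
          Red : V → Set
          Red v = ∃[ o ] ∃[ k ] (Link v o k × K k ≡ true × colour k ≡ true)
          red? : ∀ v → Dec (Red v)
          red? v = any? λ o → any? λ k → link? v o k ×-dec ((K k Boolₚ.≟ true) ×-dec (colour k Boolₚ.≟ true))
          κ : V → Bool
          κ v = if K v then colour v else does (red? v)
          κ-K : ∀ {v} → K v ≡ true → κ v ≡ colour v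
          κ-K k rewrite k = refl
          κ-R : ∀ {v o k} → R v ≡ true → Link v o k → K k ≡ true → κ v ≡ colour k
          κ-R {v} {o} {k} r l Kk with K v | rest-∉K K U r | red? v
          ... | false | refl | no ¬red = sym (Boolₚ.¬-not λ ck → ¬red (o , k , l , Kk , ck))
          ... | false | refl | yes (o′ , k′ , l′ , Kk′ , ck′) with later r
          ...   | _ , _ , _ , _ , unique with unique l Kk | unique l′ Kk′
          ...     | refl | refl = sym (trans (cong colour (link-target l l′)) ck′)
          live : ∀ {u s v} → Link u s v → K u ≡ true → K v ≡ false → L v ≡ false → Live h s
          live l p q _ = alive l p q
          toK : ∀ c {v} → R v ≡ true → ∃[ k ] (K k ≡ true × κ v ≡ colour k × v ~[ L , Live (H c) ] k)
          toK c r with later r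
          ... | o , k , l , Kk , _ = k , Kk , κ-R r l Kk , attach c r l Kk (alive (link-sym l) Kk (rest-∉K K U r))
          cases : (∃[ v ] ∃[ s ] ∃[ v′ ] (Link v s v′ × R v ≡ true × R v′ ≡ true × κ v ≡ true × κ v′ ≡ false)) ⊎
                  (∀ {v} → R v ≡ true → κ v ≡ κ x) → Count 1 (Completes K h)
          cases (inj₁ (v , s , v′ , l , Rv , Rv′ , red , blue)) = atLeastOne (reattach balanced live l Rv Rv′ conn)
            where
            atLeastOne : Count p (Completes K h) ⊎ Count (q + q′) (Completes K h) → Count 1 (Completes K h)
            atLeastOne (inj₁ n) = count-weaken {P = Completes K h} 1≤p n
            atLeastOne (inj₂ n) = count-weaken {P = Completes K h} (≤-trans 1≤q (m≤m+n q q′)) n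
            conn : ∀ c → Live (H c) s → ∀ {u v} → L u ≡ true → L v ≡ true → u ~[ L , Live (H c) ] v
            conn c ls = connect c connK λ r → proj₁ (toK c r) , proj₁ (proj₂ (toK c r)) , proj₂ (proj₂ (proj₂ (toK c r)))
              where
              bridge : ∃[ k ] ∃[ k′ ] (K k ≡ true × K k′ ≡ true × colour k ≡ true × colour k′ ≡ false × k ~[ L , Live (H c) ] k′)
              bridge with toK c Rv | toK c Rv′
              ... | k , Kk , ck , pk | k′ , Kk′ , ck′ , pk′ = k , k′ , Kk , Kk′ , trans (sym ck) red , trans (sym ck′) blue ,
                ~-sym pk ◅◅ join l (R⊆L Rv) (R⊆L Rv′) ls ◅◅ pk′
              connK : ∀ {u v} → K u ≡ true → K v ≡ true → u ~[ L , Live (H c) ] v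
              connK {u} {v} Ku Kv with colour u in cu | colour v in cv | bridge
              ... | true  | true  | _ = lift-~ c (connected Ku Kv (trans cu (sym cv)))
              ... | false | false | _ = lift-~ c (connected Ku Kv (trans cu (sym cv)))
              ... | true  | false | k , k′ , Kk , Kk′ , ck , ck′ , pth =
                lift-~ c (connected Ku Kk (trans cu (sym ck))) ◅◅ pth ◅◅ lift-~ c (connected Kk′ Kv (trans ck′ (sym cv)))
              ... | false | true  | k , k′ , Kk , Kk′ , ck , ck′ , pth =
                lift-~ c (connected Ku Kk′ (trans cu (sym ck′))) ◅◅ ~-sym pth ◅◅ lift-~ c (connected Kk Kv (trans ck (sym cv)))
          cases (inj₂ same) = go (nonzero-one H-e′)
            where
            go : ∃[ c ] (c ≢ 0F × H c e′ ≢ 0F) → Count 1 (Completes K h)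
            go (c , c≢0 , n) = count-single c (countT record
              { balanced = H-balanced c ; colour = κ ; alive = new-alive live (H-g≢0 c≢0) n
              ; connected = conn ; leaves = leaves′ })
              where
              toK′ : ∀ {v} → L v ≡ true → ∃[ k ] (K k ≡ true × κ v ≡ colour k × v ~[ L , Live (H c) ] k)
              toK′ Lv with L-cases Lv
              ... | inj₁ Kv = _ , Kv , κ-K Kv , ε
              ... | inj₂ Rv = toK c Rv
              conn : ∀ {u v} → L u ≡ true → L v ≡ true → κ u ≡ κ v → u ~[ L , Live (H c) ] v
              conn Lu Lv eq with toK′ Lu | toK′ Lv
              ... | k , Kk , ck , p | k′ , Kk′ , ck′ , p′ =
                p ◅◅ lift-~ c (connected Kk Kk′ (trans (sym ck) (trans eq ck′))) ◅◅ ~-sym p′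
              leaves′ : ∀ β → ∃[ u ] ∃[ s ] ∃[ v ] (Link u s v × L u ≡ true × L v ≡ false × κ u ≡ β)
              leaves′ β with κ x Boolₚ.≟ β | leaves β
              ... | yes eq | _ = x , g , w , link-sym gl , R⊆L Rx , U-∉L Uw , eq
              ... | no neq | a , s , d , l , Ka , ¬Kd , ca with place K U d
              ...   | inK Kd = true≢false Kd ¬Kd
              ...   | inU Ud = a , s , d , l , K⊆L Ka , U-∉L Ud , trans (κ-K Ka) ca
              ...   | inR Rd = ⊥-elim (neq (trans (sym (same Rd)) (trans (κ-R Rd (link-sym l) Ka) ca)))

  -- One dead edge

  singles paths : ∀ {K} → Decomp K → ℕ
  singles (first _ _ _) = 0
  singles (next D _ _ _ _ (last _ _ _ _ _ _ _ _)) = suc (singles D)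
  singles (next D _ _ _ _ (cons _ _ _ _ _ _ _))   = singles D
  paths (first _ _ _) = 0
  paths (next D _ _ _ _ (last _ _ _ _ _ _ _ _)) = paths D
  paths (next D _ _ _ _ (cons _ _ _ _ _ _ _))   = suc (paths D)

  Ψ : VSet → (E → ℕ) → ℕ
  Ψ K w = ∑ (λ s → pickℕ (cross K s) (w s))

  -- The weight w s is for assignments that vanish at the edge s.  A path with two
  -- or more vertices increases P if its end edges both have weight P, and
  -- increases Ψ otherwise; a single vertex decreases Ψ by at most 2 P.
  record Bounds (K : VSet) (σ τ : ℕ) : Set where
    field
      P         : ℕ
      w         : E → ℕ
      w≤P       : ∀ s → w s ≤ P
      onAlive   : ∀ {h} → Alive K h → Count (2 ^ P) (Completes K h)
      onDead    : ∀ {h s} → Dead K h s → Count (2 ^ w s) (Completes K h)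
      onTwo     : ∀ {h} → Two K h → Count 1 (Completes K h)
      potential : σ ≤ P + (Ψ K w + (τ + τ) * P)

  1≤2^ : ∀ n → 1 ≤ 2 ^ n
  1≤2^ zero    = ≤-refl
  1≤2^ (suc n) = ≤-trans (1≤2^ n) (m≤m+n _ _)

  doubling : ∀ n → 2 ^ suc n ≡ 2 ^ n + 2 ^ n
  doubling n = cong (2 ^ n +_) (+-identityʳ _)

  -- `μ` is the maximum, or one more if `a` and `c` are equal and below `P`. It becomes the weight
  -- of the edges between `K` and the path: `reattach` guarantees the smaller of `2 ^ P` and
  -- `2 ^ a + 2 ^ c`, and two edges of weight `μ` outweigh the lost edges `g` and `e′`.
  merge : ∀ P a c → a ≤ P → c ≤ P →
    (a ≡ P × c ≡ P) ⊎ ∃[ μ ] (μ ≤ P × suc (a + c) ≤ μ + μ × 2 ^ μ ≤ 2 ^ a + 2 ^ c)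
  merge P a c a≤ c≤ with <-cmp a c
  ... | tri< a<c _ _ = inj₂ (c , c≤ , +-monoˡ-≤ c a<c , m≤n+m _ _)
  ... | tri> _ _ c<a = inj₂ (a , a≤ , ≤-trans (≤-reflexive (sym (+-suc a c))) (+-monoʳ-≤ a c<a) , m≤m+n _ _)
  ... | tri≈ _ refl _ with m≤n⇒m<n∨m≡n a≤
  ...   | inj₁ a<P = inj₂ (suc a , a<P , s≤s (+-monoʳ-≤ a (n≤1+n a)) , ≤-reflexive (doubling a))
  ...   | inj₂ a≡P = inj₁ (a≡P , a≡P)

  module Weights {K L U : VSet} {w₀ : V} {g : E} {x : V} (L≡ : ∀ (v : V) → L v ≡ not (U v)) (disj : Disjoint K U)
                 (gl : Link w₀ g x) (Uw : U w₀ ≡ true) (path : Path K U g x) (w : E → ℕ) (μ : ℕ) where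
    open Pass L≡ disj gl Uw path

    w′ : E → ℕ
    w′ s = if R (initial s) ∨ R (terminal s) then μ else w s

    w′-R : ∀ {u s v} → Link u s v → R v ≡ true → w′ s ≡ μ
    w′-R {s = s} (along refl refl) r rewrite r | Boolₚ.∨-zeroʳ (R (initial s)) = refl
    w′-R (against refl refl) r rewrite r = refl

    w′-other : ∀ {u s v} → Link u s v → R u ≡ false → R v ≡ false → w′ s ≡ w s
    w′-other (along refl refl) p q rewrite p | q = refl
    w′-other (against refl refl) p q rewrite p | q = refl

    w′-≤ : ∀ {P} → (∀ s → w s ≤ P) → μ ≤ P → ∀ s → w′ s ≤ P
    w′-≤ p q s with R (initial s) ∨ R (terminal s)
    ... | true  = q
    ... | false = p s

    K-¬R : ∀ {v} → K v ≡ true → R v ≡ false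
    K-¬R k = Boolₚ.¬-not λ r → true≢false k (rest-∉K K U r)

    U-¬R : ∀ {v} → U v ≡ true → R v ≡ false
    U-¬R u = Boolₚ.¬-not λ r → true≢false u (rest-∉U K U r)

    later-weight : ∀ {v o k} → R v ≡ true → Link v o k → K k ≡ true → pickℕ (cross K o) (w′ o) ≡ μ
    later-weight r l k rewrite cross-link K (link-sym l) k (rest-∉K K U r) = w′-R (link-sym l) r

    kept : ∀ s → cross L s ≡ true → s ≢ g → s ≢ e′ →
      pickℕ (cross K s) (w′ s) ≡ w s × (∀ {v} → At s v → R v ≡ true → ⊥)
    kept s c n n′ with link-cross L c
    ... | a , d , l , La , ¬Ld with L-leaves l La ¬Ld
    ...   | inj₂ (_ , inj₁ p) = ⊥-elim (n p)
    ...   | inj₂ (_ , inj₂ p) = ⊥-elim (n′ p)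
    ...   | inj₁ (Ka , ¬Kd) = same , none
      where
      same : pickℕ (cross K s) (w′ s) ≡ w s
      same rewrite cross-link K l Ka ¬Kd = w′-other l (K-¬R Ka) (U-¬R (∉L-U ¬Ld))
      none : ∀ {v} → At s v → R v ≡ true → ⊥
      none at r with at-link l at
      ... | inj₁ refl = true≢false r (K-¬R Ka)
      ... | inj₂ refl = true≢false r (U-¬R (∉L-U ¬Ld))

    -- Between the cuts of `L` and `K`, the edges `g` and `e′` are lost and those between `K` and
    -- the path are gained. `extra` is a lower bound for the weight gained.
    Ψ-step : ∀ (extra : E → ℕ) → extra g ≡ 0 → extra e′ ≡ 0 →
      (∀ s → (∀ {v} → At s v → R v ≡ true → ⊥) → extra s ≡ 0) →
      (∀ s → extra s ≤ pickℕ (cross K s) (w′ s)) →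
      Ψ L w + ∑ extra ≤ Ψ K w′ + (w g + w e′)
    Ψ-step extra xg xe xk x≤ = begin
      Ψ L w + ∑ extra
        ≡⟨ ∑-+ (λ s → pickℕ (cross L s) (w s)) extra ⟨
      ∑ (λ s → pickℕ (cross L s) (w s) + extra s)
        ≤⟨ ∑-mono pointwise ⟩
      ∑ (λ s → pickℕ (cross K s) (w′ s) + (pickℕ (does (s ≟ g)) (w s) + pickℕ (does (s ≟ e′)) (w s)))
        ≡⟨ ∑-+ (λ s → pickℕ (cross K s) (w′ s)) (λ s → pickℕ (does (s ≟ g)) (w s) + pickℕ (does (s ≟ e′)) (w s)) ⟩
      Ψ K w′ + ∑ (λ s → pickℕ (does (s ≟ g)) (w s) + pickℕ (does (s ≟ e′)) (w s))
        ≡⟨ cong (Ψ K w′ +_) (trans (∑-+ (λ s → pickℕ (does (s ≟ g)) (w s)) (λ s → pickℕ (does (s ≟ e′)) (w s)))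
             (cong₂ _+_ (ℕΣ.sum-single g w) (ℕΣ.sum-single e′ w))) ⟩
      Ψ K w′ + (w g + w e′) ∎
      where
      open ≤-Reasoning
      pick≤ : ∀ c a → pickℕ c a ≤ a
      pick≤ true  a = ≤-refl
      pick≤ false a = z≤n
      pointwise : ∀ s → pickℕ (cross L s) (w s) + extra s ≤
        pickℕ (cross K s) (w′ s) + (pickℕ (does (s ≟ g)) (w s) + pickℕ (does (s ≟ e′)) (w s))
      pointwise s with s ≟ g | s ≟ e′
      ... | yes refl | _ rewrite xg = ≤-trans (≤-reflexive (+-identityʳ _))
            (≤-trans (pick≤ (cross L s) (w s)) (≤-trans (m≤m+n (w s) _) (m≤n+m _ (pickℕ (cross K s) (w′ s)))))
      ... | no _ | yes refl rewrite xe = ≤-trans (≤-reflexive (+-identityʳ _))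
            (≤-trans (pick≤ (cross L s) (w s)) (m≤n+m _ _))
      ... | no n | no n′ = ≤-trans (body (cross L s) refl) (≤-reflexive (sym (+-identityʳ _)))
        where
        body : ∀ c → cross L s ≡ c → pickℕ c (w s) + extra s ≤ pickℕ (cross K s) (w′ s)
        body false _ = x≤ s
        body true  c with kept s c n n′
        ... | same , none rewrite xk s none = ≤-reflexive (trans (+-identityʳ _) (sym same))

    onDead′ : ∀ {q} → (∀ {h s} → Dead L h s → Count (2 ^ w s) (Completes L h)) →
      (∀ {h s₀} (A : Dead K h s₀) → R (Dead.v₀ A) ≡ true → Count q (Completes K h)) → q ≡ 2 ^ μ →
      ∀ {h s} → Dead K h s → Count (2 ^ w′ s) (Completes K h)
    onDead′ far near refl {h} {s} A with place K U (Dead.v₀ A)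
    ... | inK k = true≢false k (Dead.¬Kv₀ A)
    ... | inR r = subst (λ n → Count (2 ^ n) (Completes K h)) (sym (w′-R (Dead.link₀ A) r)) (near A r)
    ... | inU u = subst (λ n → Count (2 ^ n) (Completes K h)) (sym (w′-other (Dead.link₀ A) (K-¬R (Dead.Ku₀ A)) (U-¬R u)))
                    (dead-far A (U-∉L u) far)

  -- Weight 0 is safe at the single vertex, as even `Two` leaves one solution. The loss of
  -- `w g + w e′` is at most `P + P`, which is what a further single vertex is granted in the
  -- potential.
  single-step : ∀ {K L U w₀ g x o f k u σ τ} (L≡ : ∀ v → L v ≡ not (U v)) (disj : Disjoint K U)
    (gl : Link w₀ g x) (Uw : U w₀ ≡ true)
    (p : K x ≡ false) (p′ : U x ≡ false) (st : Star x g o f) (lo : Link x o k) (Kk : K k ≡ true) (lf : Link x f u)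
    (Uu : U u ≡ true) (only : ∀ {v} → rest K U v ≡ true → v ≡ x) →
    Bounds L σ τ → Bounds K σ (suc τ)
  single-step {K} {L} {U} {w₀} {g} {x} {o} {σ = σ} {τ} L≡ disj gl Uw p p′ st lo Kk lf Uu only B = record
    { P = P ; w = w′ ; w≤P = w′-≤ w≤P z≤n
    ; onAlive = λ {h} A → [ count-weaken {P = Completes K h} (m≤m+n _ _) , count-weaken {P = Completes K h} (m≤m+n _ _) ]′
        (alive-step onAlive onDead onDead A)
    ; onDead = onDead′ onDead near refl
    ; onTwo = two-step onAlive onDead onDead (1≤2^ P) (1≤2^ (w g)) onTwo
    ; potential = ≤-trans potential (arith (Ψ K w′) (w g) (w e′) (w≤P g) (w≤P e′)
        (≤-trans (≤-reflexive (sym (trans (cong (Ψ L w +_) (ℕΣ.sum-zero {#E} (λ _ → 0) λ _ → refl)) (+-identityʳ _))))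
          (Ψ-step (λ _ → 0) refl refl (λ _ _ → refl) (λ _ → z≤n))))
    }
    where
    open Bounds B
    path : Path K U g x
    path = last p p′ st lo Kk lf Uu only
    open Pass L≡ disj gl Uw path
    open Weights L≡ disj gl Uw path w 0
    near : ∀ {h s₀} (A : Dead K h s₀) → R (Dead.v₀ A) ≡ true → Count 1 (Completes K h)
    near {h} A r with dead-near onAlive onDead onDead A r onTwo
    ... | inj₁ (inj₁ c) = count-weaken {P = Completes K h} (1≤2^ P) c
    ... | inj₁ (inj₂ c) = count-weaken {P = Completes K h} (≤-trans (1≤2^ (w g)) (m≤m+n _ _)) c
    ... | inj₂ (_ , c)  = c
    arith : ∀ ψ a c → a ≤ P → c ≤ P → Ψ L w ≤ ψ + (a + c) →
      P + (Ψ L w + (τ + τ) * P) ≤ P + (ψ + (suc τ + suc τ) * P)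
    arith ψ a c a≤ c≤ le = +-monoʳ-≤ P (begin
      Ψ L w + (τ + τ) * P          ≤⟨ +-monoˡ-≤ _ (≤-trans le (+-monoʳ-≤ ψ (+-mono-≤ a≤ c≤))) ⟩
      (ψ + (P + P)) + (τ + τ) * P  ≡⟨ +-assoc ψ (P + P) _ ⟩
      ψ + ((P + P) + (τ + τ) * P)  ≡⟨ cong (ψ +_) (+-assoc P P _) ⟩
      ψ + (2 + (τ + τ)) * P        ≡⟨ cong (λ n → ψ + suc n * P) (sym (+-suc τ τ)) ⟩
      ψ + (suc τ + suc τ) * P      ∎)
      where open ≤-Reasoning

  -- The edges from the first two vertices of the path to `K` contribute `μ + μ` to `Ψ`. If `g` and
  -- `e′` have weight `P`, then `μ = P` makes up for their loss while `alive-step` doubles the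
  -- count. Otherwise `Ψ` itself grows.
  long-step : ∀ {K L U w₀ g x o f k y σ τ} (L≡ : ∀ v → L v ≡ not (U v)) (disj : Disjoint K U)
    (gl : Link w₀ g x) (Uw : U w₀ ≡ true)
    (p : K x ≡ false) (p′ : U x ≡ false) (st : Star x g o f) (lo : Link x o k) (Kk : K k ≡ true) (lf : Link x f y)
    (tail : Path K (add x U) f y) →
    Bounds L σ τ → Bounds K (suc σ) τ
  long-step {K} {L} {U} {w₀} {g} {x} {o₁} {f} {k₁} {y} {σ = σ} {τ} L≡ disj gl Uw p p′ st lo Kk lf tail B =
    go (merge P (w g) (w e′) (w≤P g) (w≤P e′))
    where
    open Bounds B
    path : Path K U g x
    path = cons p p′ st lo Kk lf tail
    open Pass L≡ disj gl Uw path
    y≢x : y ≢ x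
    y≢x e = link≢ lf (sym e)
    Ry : R y ≡ true
    Ry = proj₁ (R-elim K U x (head-R tail))
    near-min : ∀ {n h s₀} → n ≤ 2 ^ P → n ≤ 2 ^ w g + 2 ^ w e′ → (A : Dead K h s₀) → R (Dead.v₀ A) ≡ true →
      Count n (Completes K h)
    near-min {n} {h} n≤ n≤′ A r with dead-near onAlive onDead onDead A r onTwo
    ... | inj₁ (inj₁ c)   = count-weaken {P = Completes K h} n≤ c
    ... | inj₁ (inj₂ c)   = count-weaken {P = Completes K h} n≤′ c
    -- The case that leads to `Two` needs a path with one vertex.
    ... | inj₂ (only , _) = ⊥-elim (y≢x (trans (only Ry) (sym (only Rx))))
    module Gain (μ : ℕ) where
      open Weights L≡ disj gl Uw path w μ public
      gain : Ψ L w + (μ + μ) ≤ Ψ K w′ + (w g + w e′)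
      gain with later Ry
      ... | o₂ , k₂ , lo₂ , Kk₂ , _ = ≤-trans (≤-reflexive (cong (Ψ L w +_) (sym total-extra)))
              (Ψ-step extra (extra-0 g o₁≢g o₂≢g) (extra-0 e′ o₁≢e′ o₂≢e′)
                (λ s none → extra-0 s (λ { refl → none (link-atˡ lo) Rx }) (λ { refl → none (link-atˡ lo₂) Ry })) extra-≤)
        where
        extra : E → ℕ
        extra s = pickℕ (does (s ≟ o₁)) μ + pickℕ (does (s ≟ o₂)) μ
        total-extra : ∑ extra ≡ μ + μ
        total-extra = trans (∑-+ (λ s → pickℕ (does (s ≟ o₁)) μ) (λ s → pickℕ (does (s ≟ o₂)) μ))
          (cong₂ _+_ (ℕΣ.sum-single o₁ λ _ → μ) (ℕΣ.sum-single o₂ λ _ → μ))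
        o₁≢g : g ≢ o₁
        o₁≢g = Star.e₁≢e₂ st
        o₂≢g : g ≢ o₂
        o₂≢g refl = g-avoids (link-atʳ lo₂) Kk₂
        o₁≢e′ : e′ ≢ o₁
        o₁≢e′ e = e′-avoids (subst (λ s → At s k₁) (sym e) (link-atʳ lo)) Kk
        o₂≢e′ : e′ ≢ o₂
        o₂≢e′ e = e′-avoids (subst (λ s → At s k₂) (sym e) (link-atʳ lo₂)) Kk₂
        o₁≢o₂ : o₁ ≢ o₂
        o₁≢o₂ refl with at-link lo (link-atˡ lo₂)
        ... | inj₁ e = y≢x e
        ... | inj₂ refl = true≢false Kk (rest-∉K K U Ry)
        extra-0 : ∀ s → s ≢ o₁ → s ≢ o₂ → extra s ≡ 0
        extra-0 s n m with s ≟ o₁ | s ≟ o₂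
        ... | yes e | _ = ⊥-elim (n e)
        ... | no _ | yes e = ⊥-elim (m e)
        ... | no _ | no _ = refl
        extra-≤ : ∀ s → extra s ≤ pickℕ (cross K s) (w′ s)
        extra-≤ s with s ≟ o₁ | s ≟ o₂
        ... | yes refl | yes e = ⊥-elim (o₁≢o₂ e)
        ... | yes refl | no _ = ≤-reflexive (trans (+-identityʳ μ) (sym (later-weight Rx lo Kk)))
        ... | no _ | yes refl = ≤-reflexive (sym (later-weight Ry lo₂ Kk₂))
        ... | no _ | no _ = z≤n
    go : (w g ≡ P × w e′ ≡ P) ⊎ ∃[ μ ] (μ ≤ P × suc (w g + w e′) ≤ μ + μ × 2 ^ μ ≤ 2 ^ w g + 2 ^ w e′) → Bounds K (suc σ) τ
    go (inj₁ (wg , we)) = record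
      { P = suc P ; w = w′ ; w≤P = λ s → m≤n⇒m≤1+n (w′-≤ w≤P ≤-refl s)
      ; onAlive = λ {h} A → [ subst (λ n → Count n (Completes K h)) (sym (doubling P))
                            , count-weaken {P = Completes K h} double ]′ (alive-step onAlive onDead onDead A)
      ; onDead = onDead′ onDead (near-min ≤-refl (≤-trans (≤-reflexive (cong (2 ^_) (sym wg))) (m≤m+n _ _))) refl
      ; onTwo = two-step onAlive onDead onDead (1≤2^ P) (1≤2^ (w g)) onTwo
      ; potential = s≤s (≤-trans potential (+-monoʳ-≤ P (+-mono-≤ ψ≤ (*-monoʳ-≤ (τ + τ) (n≤1+n P)))))
      }
      where
      open Gain P
      double : 2 ^ suc P ≤ 2 ^ P + (2 ^ w g + 2 ^ w e′)
      double = ≤-trans (≤-reflexive (doubling P)) (+-monoʳ-≤ (2 ^ P) (≤-trans (≤-reflexive (cong (2 ^_) (sym wg))) (m≤m+n _ _)))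
      ψ≤ : Ψ L w ≤ Ψ K w′
      ψ≤ = +-cancelʳ-≤ (P + P) _ _ (≤-trans gain (≤-reflexive (cong (Ψ K w′ +_) (cong₂ _+_ wg we))))
    go (inj₂ (μ , μ≤ , 2μ , pow)) = record
      { P = P ; w = w′ ; w≤P = w′-≤ w≤P μ≤
      ; onAlive = λ {h} A → [ count-weaken {P = Completes K h} (m≤m+n _ _) , count-weaken {P = Completes K h} (m≤m+n _ _) ]′
          (alive-step onAlive onDead onDead A)
      ; onDead = onDead′ onDead (near-min (^-monoʳ-≤ 2 μ≤) pow) refl
      ; onTwo = two-step onAlive onDead onDead (1≤2^ P) (1≤2^ (w g)) onTwo
      ; potential = ≤-trans (s≤s potential) (≤-trans (≤-reflexive (sym (+-suc P _))) (+-monoʳ-≤ P (+-monoˡ-≤ _ ψ<)))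
      }
      where
      open Gain μ
      ψ< : suc (Ψ L w) ≤ Ψ K w′
      ψ< = +-cancelʳ-≤ (w g + w e′) _ _ (≤-trans (≤-reflexive (sym (+-suc (Ψ L w) _))) (≤-trans (+-monoʳ-≤ (Ψ L w) 2μ) gain))

  bounds : ∀ {K} (D : Decomp K) → Bounds K (paths D) (singles D)
  bounds {K} (first x ∉K others) with Pairing.other-vertex G two x
  ... | k , k≢x = record
    { P = 0 ; w = λ _ → 0 ; w≤P = λ _ → z≤n
    ; onAlive = λ A → finish-alive A (others k≢x) ; onDead = finish-dead ; onTwo = finish-two ; potential = z≤n }
    where open Finish {K} ∉K others
  bounds (next D L≡ disj gl Uw (last p p′ st lo Kk lf Uu only)) = single-step L≡ disj gl Uw p p′ st lo Kk lf Uu only (bounds D)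
  bounds (next D L≡ disj gl Uw (cons p p′ st lo Kk lf tail)) = long-step L≡ disj gl Uw p p′ st lo Kk lf tail (bounds D)

  -- Dead edges at interior vertices of paths

  -- every other vertex of a path, the ends excluded
  chosen : ∀ {K U g x} → Bool → Path K U g x → VSet
  chosen a (last _ _ _ _ _ _ _ _) v = false
  chosen {x = x} a (cons _ _ _ _ _ _ tail) v = if does (v ≟ x) then a else chosen (not a) tail v

  #chosen : ∀ {K U g x} → Bool → Path K U g x → ℕ
  #chosen a (last _ _ _ _ _ _ _ _) = 0
  #chosen a (cons _ _ _ _ _ _ tail) = ⟦ a ⟧ + #chosen (not a) tail

  chosen-R : ∀ {K U g x} a (path : Path K U g x) {v} → chosen a path v ≡ true → rest K U v ≡ true
  chosen-R {K} {U} {g} {x} a (cons p p′ _ _ _ _ tail) {v} h with v ≟ x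
  ... | yes refl = rest-intro K U p p′
  ... | no _ = proj₁ (R-elim K U x (chosen-R (not a) tail h))

  count-chosen : ∀ {K U g x} a (path : Path K U g x) → count (chosen a path) ≡ #chosen a path
  count-chosen a (last _ _ _ _ _ _ _ _) = ℕΣ.sum-zero {#V} (λ _ → 0) λ _ → refl
  count-chosen {K} {U} {g} {x} a (cons _ _ _ _ _ _ tail) = trans (∑-cong pointwise)
    (trans (∑-+ (λ v → pickℕ (does (v ≟ x)) ⟦ a ⟧) (λ v → ⟦ chosen (not a) tail v ⟧))
      (cong₂ _+_ (ℕΣ.sum-single x λ _ → ⟦ a ⟧) (count-chosen (not a) tail)))
    where
    tail-x : chosen (not a) tail x ≡ false
    tail-x = Boolₚ.¬-not λ h → proj₂ (R-elim K U x (chosen-R (not a) tail h)) refl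
    pointwise : ∀ v → ⟦ if does (v ≟ x) then a else chosen (not a) tail v ⟧ ≡ pickℕ (does (v ≟ x)) ⟦ a ⟧ + ⟦ chosen (not a) tail v ⟧
    pointwise v with v ≟ x
    ... | yes refl rewrite tail-x = sym (+-identityʳ _)
    ... | no _ = refl

  -- A chosen vertex with its neighbours `p` and `n` along the path. The condition on `p` is a
  -- parameter because, in the recursion, the predecessor of the head lies outside the remaining
  -- path.
  record Leaf (K U C : VSet) (v : V) (Pre : V → Set) : Set where
    field
      {p n k} : V
      {g o f} : E
      star-v  : Star v g o f
      link-g  : Link v g p
      link-o  : Link v o k
      link-f  : Link v f n
      Kk      : K k ≡ true
      Rn      : rest K U n ≡ true
      ¬Cn     : C n ≡ false
      pre     : Pre p

  chosen-tail : ∀ {K U g x} a (path : Path K U g x) {o f k y} (∉K : K x ≡ false) (∉U : U x ≡ false) (s : Star x g o f)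
    (lo : Link x o k) (Kk : K k ≡ true) (lf : Link x f y) (tail : Path K (add x U) f y) →
    ∀ {v} → v ≢ x → chosen (not a) tail v ≡ false → chosen a (cons {U = U} {g = g} ∉K ∉U s lo Kk lf tail) v ≡ false
  chosen-tail {x = x} a path ∉K ∉U s lo Kk lf tail {v} n h with v ≟ x
  ... | yes p = ⊥-elim (n p)
  ... | no _ = h

  chosen-head : ∀ {K U g x} (path : Path K U g x) → chosen false path x ≡ false
  chosen-head (last _ _ _ _ _ _ _ _) = refl
  chosen-head {x = x} (cons _ _ _ _ _ _ tail) with x ≟ x
  ... | yes _ = refl
  ... | no q = ⊥-elim (q refl)

  leaf : ∀ {K U g x w} a (path : Path K U g x) → Link w g x → ∀ {v} → chosen a path v ≡ true →
    Leaf K U (chosen a path) v (λ p → (v ≡ x × p ≡ w × a ≡ true) ⊎ (rest K U p ≡ true × chosen a path p ≡ false))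
  leaf {K} {U} {g} {x} {w} true path@(cons ∉K ∉U s lo Kk lf tail) gl {v} h with v ≟ x
  ... | yes refl = record
    { star-v = s ; link-g = link-sym gl ; link-o = lo ; link-f = lf ; Kk = Kk
    ; Rn = proj₁ (R-elim K U x (head-R tail))
    ; ¬Cn = chosen-tail true path ∉K ∉U s lo Kk lf tail (λ e → link≢ lf (sym e)) (chosen-head tail)
    ; pre = inj₁ (refl , refl , refl) }
  ... | no _ with leaf false tail lf h
  ...   | L = record
    { star-v = star-v ; link-g = link-g ; link-o = link-o ; link-f = link-f ; Kk = Kk′
    ; Rn = proj₁ (R-elim K U x Rn)
    ; ¬Cn = chosen-tail true path ∉K ∉U s lo Kk lf tail (proj₂ (R-elim K U x Rn)) ¬Cn
    ; pre = up pre }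
    where
    open Leaf L renaming (Kk to Kk′)
    up : ∀ {p} → (v ≡ _ × p ≡ x × false ≡ true) ⊎ (rest K (add x U) p ≡ true × chosen false tail p ≡ false) →
      (v ≡ x × p ≡ w × true ≡ true) ⊎ (rest K U p ≡ true × chosen true path p ≡ false)
    up (inj₁ (_ , _ , ()))
    up (inj₂ (r , c)) = inj₂ (proj₁ (R-elim K U x r) , chosen-tail true path ∉K ∉U s lo Kk lf tail (proj₂ (R-elim K U x r)) c)
  leaf {K} {U} {g} {x} {w} false path@(cons ∉K ∉U s lo Kk lf tail) gl {v} h with v ≟ x
  ... | yes refl with () ← h
  ... | no _ with leaf true tail lf h
  ...   | L = record
    { star-v = star-v ; link-g = link-g ; link-o = link-o ; link-f = link-f ; Kk = Kk′
    ; Rn = proj₁ (R-elim K U x Rn)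
    ; ¬Cn = chosen-tail false path ∉K ∉U s lo Kk lf tail (proj₂ (R-elim K U x Rn)) ¬Cn
    ; pre = inj₂ (up pre) }
    where
    open Leaf L renaming (Kk to Kk′)
    up : ∀ {p} → (v ≡ _ × p ≡ x × true ≡ true) ⊎ (rest K (add x U) p ≡ true × chosen true tail p ≡ false) →
      rest K U p ≡ true × chosen false path p ≡ false
    up (inj₁ (_ , refl , _)) = rest-intro K U ∉K ∉U , chosen-head path
    up (inj₂ (r , c)) = proj₁ (R-elim K U x r) , chosen-tail false path ∉K ∉U s lo Kk lf tail (proj₂ (R-elim K U x r)) c

  Free : (E → Fin 3) → List E → E → Set
  Free h F s = Live h s × s ∉ F

  -- As in Alive, but edges to vertices in good may vanish, and connectivity
  -- does not use the edges in F.
  record Relaxed (K : VSet) (h : E → Fin 3) (F : List E) (good : VSet) : Set where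
    field
      balanced  : Balanced K h
      alive     : ∀ {u s v} → Link u s v → K u ≡ true → K v ≡ false → Live h s ⊎ good v ≡ true
      connected : ∀ {u v} → K u ≡ true → K v ≡ true → u ~[ K , Free h F ] v
      unique    : Unique F
      live      : All (Live h) F
      inside    : All (λ s → ∀ {v} → At s v → K v ≡ true) F

  -- A vertex in `good` is a credit: its edge to `K` may vanish, which frees a value when that edge
  -- is an end edge of a path. One factor 2 may use up the credits at both ends of a path, hence
  -- `exponent + exponent`.
  record LeafBounds (K : VSet) (c : ℕ) : Set where
    field
      exponent  : ℕ
      good      : VSet
      onRelaxed : ∀ {h F} → Relaxed K h F good → Count (2 ^ (length F + exponent)) (Completes K h)
      good-∉K   : ∀ {v} → good v ≡ true → K v ≡ false
      good-K    : ∀ {v} → good v ≡ true → Neighbour K v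
      bound     : c ≤ exponent + exponent + count good

  module LeafStep {K L U : VSet} {w : V} {g : E} {x : V} (L≡ : ∀ (v : V) → L v ≡ not (U v)) (disj : Disjoint K U)
                  (gl : Link w g x) (Uw : U w ≡ true) (path : Path K U g x) where
    open Pass L≡ disj gl Uw path

    C good-R bad-R : VSet
    C = chosen false path
    good-R v = C v ∧ not (does (b₃ v ≟ zero))
    bad-R v = C v ∧ does (b₃ v ≟ zero)

    good-elim : ∀ {v} → good-R v ≡ true → C v ≡ true × b₃ v ≢ zero
    good-elim {v} h with C v | b₃ v ≟ zero
    ... | true | no n = refl , n
    ... | true | yes _ with () ← h

    bad-elim : ∀ {v} → bad-R v ≡ true → C v ≡ true × b₃ v ≡ zero
    bad-elim {v} h with C v | b₃ v ≟ zero
    ... | true | yes z = refl , z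
    ... | true | no _ with () ← h

    good-or-bad : count good-R + count bad-R ≡ #chosen false path
    good-or-bad = trans (sym (∑-+ (⟦_⟧ ∘ good-R) (⟦_⟧ ∘ bad-R))) (trans (∑-cong split) (count-chosen false path))
      where
      split : ∀ v → ⟦ good-R v ⟧ + ⟦ bad-R v ⟧ ≡ ⟦ C v ⟧
      split v with C v | does (b₃ v ≟ zero)
      ... | false | _     = refl
      ... | true  | true  = refl
      ... | true  | false = refl

    Twig : V → E → Set
    Twig v s = ∃[ z ] (Link v s z × R z ≡ true × C z ≡ false)

    -- The far end of a twig is not chosen, so the twigs taken at different vertices are distinct
    -- edges.
    twig-unique : ∀ {v v′ s} → Twig v s → Twig v′ s → C v′ ≡ true → v′ ≡ v
    twig-unique (z , l , _ , ¬Cz) (z′ , l′ , _ , _) Cv′ with at-link l (link-atˡ l′)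
    ... | inj₁ p = p
    ... | inj₂ refl = true≢false Cv′ ¬Cz

    twig-avoids : ∀ {v s} → C v ≡ true → Twig v s → Avoids K s
    twig-avoids Cv (z , l , Rz , _) = avoids l (rest-∉K K U (chosen-R false path Cv)) (rest-∉K K U Rz)

    -- If both path edges at `v` vanished, the boundary at `v` would be the value at the later edge
    -- up to sign: nonzero if that edge is live, zero if it is dead. Either contradicts the
    -- respective assumption on `b₃ v`.
    live-twig : ∀ {h v} → bd h v ≡ b₃ v → C v ≡ true →
      (b₃ v ≡ zero → ∀ {o k} → Link v o k → K k ≡ true → Live h o) →
      (b₃ v ≢ zero → ∀ {o k} → Link v o k → K k ≡ true → h o ≡ zero) →
      ∃[ s ] (Twig v s × Live h s)
    live-twig {h} {v} bal Cv zero-live nonzero-dead with leaf false path gl Cv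
    ... | lf with Leaf.pre lf
    ...   | inj₁ (_ , _ , ())
    ...   | inj₂ (Rp , ¬Cp) with h (Leaf.g lf) ≟ zero | h (Leaf.f lf) ≟ zero
    ...     | no n | _ = _ , (_ , Leaf.link-g lf , Rp , ¬Cp) , n
    ...     | _ | no n = _ , (_ , Leaf.link-f lf , Leaf.Rn lf , Leaf.¬Cn lf) , n
    ...     | yes zg | yes zf with b₃ v ≟ zero
    ...       | yes z = ⊥-elim (zero-live z link-o Kk (bd-unique link-o (link≢ link-o) {h} {λ _ → zero}
                (trans bal (trans z (sym (bd-0 v)))) agree))
      where
      open Leaf lf
      agree : ∀ s → At s v → s ≢ o → h s ≡ zero
      agree s at n with Star.only star-v at
      ... | inj₁ refl        = zg
      ... | inj₂ (inj₁ e)    = ⊥-elim (n e)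
      ... | inj₂ (inj₂ refl) = zf
    ...       | no nz = ⊥-elim (nz (trans (sym bal) (trans (bd-local agree) (bd-0 v))))
      where
      open Leaf lf
      agree : ∀ s → At s v → h s ≡ zero
      agree s at with Star.only star-v at
      ... | inj₁ refl        = zg
      ... | inj₂ (inj₁ refl) = nonzero-dead nz link-o Kk
      ... | inj₂ (inj₂ refl) = zf

    collect : ∀ {h} → (∀ {v} → bad-R v ≡ true → ∃[ s ] (Twig v s × Live h s)) →
      ∀ l → Unique l → All (λ v → bad-R v ≡ true) l →
      ∃[ F ] (Unique F × length F ≡ length l × All (λ s → Live h s × ∃[ v ] (v ∈ l × bad-R v ≡ true × Twig v s)) F)
    collect twig [] _ _ = [] , [] , refl , []
    collect {h} twig (v ∷ l) (v∉ ∷ u) (bad ∷ bads) with collect twig l u bads | twig bad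
    ... | F , uF , len , all | s , t , live =
        s ∷ F
      , All.map (λ { (_ , v′ , m , bad′ , t′) refl → All.lookup v∉ m (sym (twig-unique t t′ (proj₁ (bad-elim bad′)))) }) all ∷ uF
      , cong suc len
      , (live , v , here refl , bad , t) ∷ All.map (λ { (lv , v′ , m , p) → lv , v′ , there m , p }) all

    module _ {c : ℕ} (B : LeafBounds L c) where
      open LeafBounds B renaming (good to good-L; good-∉K to good-∉L; good-K to good-nbr-L)

      -- The chosen vertices with nonzero boundary become good. The credits of `w` and `u′` are
      -- spent, as their edges `g` and `e′` are fixed with this path.
      good-K : VSet
      good-K v = if R v then good-R v else (good-L v ∧ not (does (v ≟ w)) ∧ not (does (v ≟ u′)))

      marked : Bool
      marked = good-L w ∨ good-L u′

      good-K-R : ∀ {v} → R v ≡ true → good-K v ≡ good-R v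
      good-K-R r rewrite r = refl

      good-K-U : ∀ {v} → R v ≡ false → good-K v ≡ true → good-L v ≡ true × v ≢ w × v ≢ u′
      good-K-U {v} r h rewrite r with good-L v | v ≟ w | v ≟ u′
      ... | true | no n | no m = refl , n , m
      ... | true | yes _ | _ with () ← h
      good-K-U {v} r () | true | no _ | yes _

      U-¬R : ∀ {v} → U v ≡ true → R v ≡ false
      U-¬R u = Boolₚ.¬-not λ r → true≢false u (rest-∉U K U r)

      module _ {h : E → Fin 3} {F : List E} (S : Relaxed K h F good-K) where
        open Relaxed S
        open Family h balanced

        later-live : ∀ {v o k} → R v ≡ true → good-R v ≡ false → Link v o k → K k ≡ true → Live h o
        later-live r ng l Kk with alive (link-sym l) Kk (rest-∉K K U r)
        ... | inj₁ lv = lv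
        ... | inj₂ gd = true≢false (trans (sym (good-K-R r)) gd) ng

        bad-not-good : ∀ {v} → b₃ v ≡ zero → good-R v ≡ false
        bad-not-good {v} z = Boolₚ.¬-not λ gd → proj₂ (good-elim gd) z

        unchosen-not-good : ∀ {v} → C v ≡ false → good-R v ≡ false
        unchosen-not-good n = Boolₚ.¬-not λ gd → true≢false (proj₁ (good-elim gd)) n

        extra : ∀ c → ∃[ F′ ] (Unique F′ × length F′ ≡ count bad-R ×
          All (λ s → Live (H c) s × ∃[ v ] (bad-R v ≡ true × Twig v s)) F′)
        extra c with enumerate bad-R
        ... | l , ul , bads , len with collect {H c} twig l ul bads
          where
          twig : ∀ {v} → bad-R v ≡ true → ∃[ s ] (Twig v s × Live (H c) s)
          twig {v} bad with bad-elim bad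
          ... | Cv , z = live-twig {H c} (H-R c Rv) Cv
                (λ _ l Kk → H-live c (_ , link-atʳ l , Kk) (later-live Rv (bad-not-good z) l Kk)) (λ nz → ⊥-elim (nz z))
            where
            Rv : R v ≡ true
            Rv = chosen-R false path Cv
        ...   | F′ , uF , lenF , all = F′ , uF , trans lenF len , All.map (λ { (lv , v , _ , p) → lv , v , p }) all

        -- A good vertex whose later edge is dead uses a live twig to an unchosen neighbour, which
        -- is attached to `K` directly. A bad vertex is attached by its later edge, so its live twig
        -- can join the free edges; no connection runs through it.
        continue : ∀ c → Live (H c) g ⊎ good-L w ≡ true → Live (H c) e′ ⊎ good-L u′ ≡ true →
          Count (2 ^ (length F + (count bad-R + exponent))) (Completes L (H c))
        continue c live-g live-e′ with extra c
        ... | F′ , uF′ , len , all = subst (λ n → Count (2 ^ n) (Completes L (H c)))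
                (trans (cong (_+ exponent) (trans (length-++ F) (cong (length F +_) len))) (+-assoc (length F) _ _))
                (onRelaxed record
                  { balanced = H-balanced c ; alive = alive′ ; connected = connected′
                  ; unique = Uniqueₚ.++⁺ unique uF′ λ { (m , m′) → touch-∉F′ (F-touches m) m′ }
                  ; live = Allₚ.++⁺ (All.tabulate λ m → H-live c (F-touches m) (All.lookup live m)) (All.map proj₁ all)
                  ; inside = Allₚ.++⁺ (All.map (λ f {v} at → K⊆L (f at)) inside) (All.map inside′ all) })
          where
          F-touches : ∀ {s} → s ∈ F → Touches K s
          F-touches {s} m = _ , inj₁ refl , All.lookup inside m (inj₁ refl)
          touch-∉F′ : ∀ {s} → Touches K s → s ∉ F′
          touch-∉F′ (v , at , k) m with All.lookup all m
          ... | _ , v′ , bad , t = twig-avoids (proj₁ (bad-elim bad)) t at k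
          inside′ : ∀ {s} → Live (H c) s × ∃[ v ] (bad-R v ≡ true × Twig v s) → ∀ {v} → At s v → L v ≡ true
          inside′ (_ , v′ , bad , z , l , Rz , _) at with at-link l at
          ... | inj₁ refl = R⊆L (chosen-R false path (proj₁ (bad-elim bad)))
          ... | inj₂ refl = R⊆L Rz
          alive′ : ∀ {u s v} → Link u s v → L u ≡ true → L v ≡ false → Live (H c) s ⊎ good-L v ≡ true
          alive′ {u} {s} {v} l Lu ¬Lv with L-leaves l Lu ¬Lv
          ... | inj₁ (Ku , ¬Kv) with alive l Ku ¬Kv
          ...   | inj₁ lv = inj₁ (H-live c (_ , link-atˡ l , Ku) lv)
          ...   | inj₂ gd = inj₂ (proj₁ (good-K-U (U-¬R (∉L-U ¬Lv)) gd))
          alive′ {u} {s} {v} l Lu ¬Lv | inj₂ (_ , inj₁ refl) = at-g live-g (at-link gl (link-atʳ l))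
            where
            at-g : Live (H c) g ⊎ good-L w ≡ true → v ≡ w ⊎ v ≡ x → Live (H c) g ⊎ good-L v ≡ true
            at-g (inj₁ lv) _           = inj₁ lv
            at-g (inj₂ gd) (inj₁ refl) = inj₂ gd
            at-g (inj₂ _)  (inj₂ refl) = true≢false (R⊆L Rx) ¬Lv
          alive′ {u} {s} {v} l Lu ¬Lv | inj₂ (_ , inj₂ refl) = at-e′ live-e′ (at-link e′-link (link-atʳ l))
            where
            at-e′ : Live (H c) e′ ⊎ good-L u′ ≡ true → v ≡ x′ ⊎ v ≡ u′ → Live (H c) e′ ⊎ good-L v ≡ true
            at-e′ (inj₁ lv) _        = inj₁ lv
            at-e′ (inj₂ gd) (inj₂ e) = inj₂ (subst (λ z → good-L z ≡ true) (sym e) gd)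
            at-e′ (inj₂ _)  (inj₁ e) = true≢false (R⊆L Rx′) (subst (λ z → L z ≡ false) e ¬Lv)
          D : E → Set
          D = Free (H c) (F ++ F′)
          fresh : ∀ {s} → s ∉ F → s ∉ F′ → s ∉ F ++ F′
          fresh n n′ m = [ n , n′ ]′ (∈-++⁻ F m)
          ∉F : ∀ {s v} → At s v → K v ≡ false → s ∉ F
          ∉F at n m = true≢false (All.lookup inside m at) n
          via : ∀ {v o k} → R v ≡ true → Link v o k → K k ≡ true → Live h o → v ~[ L , D ] k
          via r l Kk lv = join l (R⊆L r) (K⊆L Kk) (H-live c (_ , link-atʳ l , Kk) lv ,
            fresh (∉F (link-atˡ l) (rest-∉K K U r)) (touch-∉F′ (_ , link-atʳ l , Kk)))
          att-safe : ∀ {v} → R v ≡ true → good-R v ≡ false → ∃[ k ] (K k ≡ true × v ~[ L , D ] k)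
          att-safe r ng with later r
          ... | o , k , l , Kk , _ = k , Kk , via r l Kk (later-live r ng l Kk)
          att : ∀ {v} → R v ≡ true → ∃[ k ] (K k ≡ true × v ~[ L , D ] k)
          att {v} r with good-R v in gd | later r
          ... | false | _ = att-safe r gd
          ... | true | o , k , l , Kk , only with h o ≟ zero
          ...   | no lv = k , Kk , via r l Kk lv
          ...   | yes dead = hop (live-twig {H c} (H-R c r) (proj₁ (good-elim gd)) (λ z → ⊥-elim (proj₂ (good-elim gd) z))
                    (λ _ l′ Kk′ → trans (H-touch c (_ , link-atʳ l′ , Kk′)) (subst (λ s → h s ≡ zero) (sym (only l′ Kk′)) dead)))
            where
            hop : ∃[ s ] (Twig v s × Live (H c) s) → ∃[ k ] (K k ≡ true × v ~[ L , D ] k)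
            hop (s , (z , lz , Rz , ¬Cz) , lv) with att-safe Rz (unchosen-not-good ¬Cz)
            ... | k′ , Kk′ , pth = k′ , Kk′ , join lz (R⊆L r) (R⊆L Rz) (lv , fresh (∉F (link-atˡ lz) (rest-∉K K U r)) s∉) ◅◅ pth
              where
              s∉ : s ∉ F′
              s∉ m with All.lookup all m
              ... | _ , v′ , bad , t with twig-unique (z , lz , Rz , ¬Cz) t (proj₁ (bad-elim bad))
              ...   | refl = proj₂ (good-elim gd) (proj₂ (bad-elim bad))
          toK : ∀ {v} → L v ≡ true → ∃[ k ] (K k ≡ true × v ~[ L , D ] k)
          toK Lv with L-cases Lv
          ... | inj₁ k = _ , k , ε
          ... | inj₂ r = att r
          connected′ : ∀ {u v} → L u ≡ true → L v ≡ true → u ~[ L , D ] v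
          connected′ Lu Lv with toK Lu | toK Lv
          ... | k , Kk , p | k′ , Kk′ , q = p ◅◅
                ~-map {K} {Free h F} K⊆L (λ t d → H-live c t (proj₁ d) , fresh (proj₂ d) (touch-∉F′ t)) (connected Kk Kk′) ◅◅ ~-sym q

        -- If `w` is good, `g` may vanish and two values keep `e′` alive. If `u′` is good, `e′` may
        -- vanish and the values 1 and 2 keep `g` alive.
        step-count : ∀ a a′ → good-L w ≡ a → good-L u′ ≡ a′ →
          Count (2 ^ (length F + (⟦ a ∨ a′ ⟧ + (count bad-R + exponent)))) (Completes K h)
        step-count a a′ ga ga′ = go a a′ ga ga′
          where
          N : ℕ
          N = length F + (count bad-R + exponent)
          double : Count (2 ^ N + 2 ^ N) (Completes K h) →
            Count (2 ^ (length F + (1 + (count bad-R + exponent)))) (Completes K h)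
          double = subst (λ n → Count n (Completes K h)) (trans (cong (2 ^ N +_) (sym (+-identityʳ _)))
            (cong (2 ^_) (sym (+-suc (length F) _))))
          go : ∀ a a′ → good-L w ≡ a → good-L u′ ≡ a′ →
            Count (2 ^ (length F + (⟦ a ∨ a′ ⟧ + (count bad-R + exponent)))) (Completes K h)
          go true a′ ga _ with nonzero-pair H-e′
          ... | c , c′ , n , e , e′ = double (count-two n (continue c (inj₂ ga) (inj₁ e)) (continue c′ (inj₂ ga) (inj₁ e′)))
          go false true _ ga′ = double (count-two {1F} {2F} (λ ())
            (continue 1F (inj₁ (H-g≢0 λ ())) (inj₂ ga′)) (continue 2F (inj₁ (H-g≢0 λ ())) (inj₂ ga′)))
          go false false _ _ with nonzero-one H-e′
          ... | c , c≢0 , n = count-single c (continue c (inj₁ (H-g≢0 c≢0)) (inj₁ n))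

      leaf-step : LeafBounds K (c + #chosen false path)
      leaf-step = record
        { exponent  = ⟦ marked ⟧ + (count bad-R + exponent)
        ; good      = good-K
        ; onRelaxed = λ S → step-count S _ _ refl refl
        ; good-∉K   = λ {v} → ∉K v
        ; good-K    = λ {v} → nbr v
        ; bound     = bound′
        }
        where
        ∉K : ∀ v → good-K v ≡ true → K v ≡ false
        ∉K v gd with R v Boolₚ.≟ true
        ... | yes r = rest-∉K K U r
        ... | no ¬r = Boolₚ.¬-not λ k → true≢false (K⊆L k) (good-∉L (proj₁ (good-K-U (Boolₚ.¬-not ¬r) gd)))
        nbr : ∀ v → good-K v ≡ true → Neighbour K v
        nbr v gd with R v Boolₚ.≟ true
        ... | yes r with later r
        ...   | o , k , l , Kk , _ = o , k , l , Kk
        nbr v gd | no ¬r with good-K-U (Boolₚ.¬-not ¬r) gd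
        ... | gl′ , v≢w , v≢u′ with good-nbr-L gl′
        ...   | s , k , l , Lk with L-cases Lk
        ...     | inj₁ Kk = s , k , l , Kk
        ...     | inj₂ Rk with entries (link-sym l) Rk (∉L-U (good-∉L gl′))
        ...       | inj₁ refl with at-link gl (link-atˡ l)
        ...         | inj₁ e = ⊥-elim (v≢w e)
        ...         | inj₂ refl = ⊥-elim (¬r Rx)
        nbr v gd | no ¬r | gl′ , v≢w , v≢u′ | s , k , l , Lk | inj₂ Rk | inj₂ refl with at-link e′-link (link-atˡ l)
        ...         | inj₁ e = ⊥-elim (¬r (subst (λ z → R z ≡ true) (sym e) Rx′))
        ...         | inj₂ e = ⊥-elim (v≢u′ e)
        goods : count good-L + count good-R ≤ count good-K + (⟦ good-L w ⟧ + ⟦ good-L u′ ⟧)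
        goods = ≤-trans (≤-reflexive (sym (∑-+ (⟦_⟧ ∘ good-L) (⟦_⟧ ∘ good-R)))) (≤-trans (∑-mono pointwise)
          (≤-reflexive (trans (∑-+ (⟦_⟧ ∘ good-K) (λ v → pickℕ (does (v ≟ w)) ⟦ good-L v ⟧ + pickℕ (does (v ≟ u′)) ⟦ good-L v ⟧))
            (cong (count good-K +_) (trans (∑-+ (λ v → pickℕ (does (v ≟ w)) ⟦ good-L v ⟧) (λ v → pickℕ (does (v ≟ u′)) ⟦ good-L v ⟧))
              (cong₂ _+_ (ℕΣ.sum-single w (⟦_⟧ ∘ good-L)) (ℕΣ.sum-single u′ (⟦_⟧ ∘ good-L))))))))
          where
          pointwise : ∀ v → ⟦ good-L v ⟧ + ⟦ good-R v ⟧ ≤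
            ⟦ good-K v ⟧ + (pickℕ (does (v ≟ w)) ⟦ good-L v ⟧ + pickℕ (does (v ≟ u′)) ⟦ good-L v ⟧)
          pointwise v = body (R v) refl
            where
            body : ∀ r → R v ≡ r → ⟦ good-L v ⟧ + ⟦ good-R v ⟧ ≤
              ⟦ good-K v ⟧ + (pickℕ (does (v ≟ w)) ⟦ good-L v ⟧ + pickℕ (does (v ≟ u′)) ⟦ good-L v ⟧)
            body true r rewrite good-K-R r | Boolₚ.¬-not (λ gd → true≢false (R⊆L r) (good-∉L {v} gd)) = m≤m+n _ _
            body false r rewrite Boolₚ.¬-not (λ gd → true≢false (chosen-R false path (proj₁ (good-elim {v} gd))) r) | r
              with good-L v | v ≟ w | v ≟ u′
            ... | false | _     | _     = z≤n
            ... | true  | yes _ | _     = s≤s z≤n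
            ... | true  | no _  | yes _ = ≤-refl
            ... | true  | no _  | no _  = ≤-refl
        or-≤ : ∀ a a′ → ⟦ a ⟧ + ⟦ a′ ⟧ ≤ ⟦ a ∨ a′ ⟧ + ⟦ a ∨ a′ ⟧
        or-≤ true  true  = ≤-refl
        or-≤ true  false = s≤s z≤n
        or-≤ false true  = s≤s z≤n
        or-≤ false false = ≤-refl
        bound′ : c + #chosen false path ≤ (⟦ marked ⟧ + (count bad-R + exponent)) + (⟦ marked ⟧ + (count bad-R + exponent)) + count good-K
        bound′ = arith c (#chosen false path) (count good-R) (count bad-R) (count good-L) (count good-K) ⟦ marked ⟧ exponent
          bound good-or-bad (≤-trans goods (+-monoʳ-≤ (count good-K) (or-≤ (good-L w) (good-L u′))))
          where
          open ≤-Reasoning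
          arith : ∀ c n gr br gl gk m e → c ≤ e + e + gl → gr + br ≡ n → gl + gr ≤ gk + (m + m) →
            c + n ≤ (m + (br + e)) + (m + (br + e)) + gk
          arith c n gr br gl gk m e p refl q = begin
            c + (gr + br)                    ≤⟨ +-monoˡ-≤ _ p ⟩
            (e + e + gl) + (gr + br)         ≡⟨ solve-ℕ 4 (λ e gl gr br → (e :+ e :+ gl) :+ (gr :+ br) := (e :+ e :+ br) :+ (gl :+ gr)) refl e gl gr br ⟩
            (e + e + br) + (gl + gr)         ≤⟨ +-monoʳ-≤ (e + e + br) q ⟩
            -- A bad vertex raises the exponent and thus counts twice, although once would do.
            (e + e + br) + (gk + (m + m))    ≤⟨ m≤m+n ((e + e + br) + (gk + (m + m))) br ⟩
            (e + e + br) + (gk + (m + m)) + br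
              ≡⟨ solve-ℕ 4 (λ e br gk m → (e :+ e :+ br) :+ (gk :+ (m :+ m)) :+ br := (m :+ (br :+ e)) :+ (m :+ (br :+ e)) :+ gk) refl e br gk m ⟩
            (m + (br + e)) + (m + (br + e)) + gk ∎
            where open +-*-Solver renaming (solve to solve-ℕ)

  leaves : ∀ {K} → Decomp K → ℕ
  leaves (first _ _ _)          = 0
  leaves (next D _ _ _ _ path) = leaves D + #chosen false path

  leaf-bounds : ∀ {K} (D : Decomp K) → LeafBounds K (leaves D)
  leaf-bounds {K} (first x ∉K others) = record
    { exponent = 0 ; good = λ _ → false ; onRelaxed = base ; good-∉K = λ () ; good-K = λ () ; bound = z≤n }
    where
    open Finish {K} ∉K others
    base : ∀ {h F} → Relaxed K h F (λ _ → false) → Count (2 ^ (length F + 0)) (Completes K h)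
    base {h} {F} S = subst (λ n → Count (2 ^ n) (Completes K h)) (sym (+-identityʳ (length F)))
      (finish balanced F unique live λ {u} {v} → reach u v)
      where
      open Relaxed S
      reach : ∀ u v → u ~[ (λ _ → true) , Free h F ] v
      reach u v with star-of x
      ... | s , _ , _ , st with at-other (Star.at₁ st)
      ...   | k , l with others (λ e → link≢ l (sym e))
      ...     | Kk with alive (link-sym l) Kk ∉K
      ...       | inj₁ lv = everywhere connected (link-sym l) Kk
                    (lv , λ m → true≢false (All.lookup inside m (link-atˡ l)) ∉K)
  leaf-bounds (next D L≡ disj gl Uw path) = LeafStep.leaf-step L≡ disj gl Uw path (leaf-bounds D)

  -- Counting vertices and edges

  #path : ∀ {K U g x} → Path K U g x → ℕ
  #path (last _ _ _ _ _ _ _ _)    = 1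
  #path (cons _ _ _ _ _ _ tail) = suc (#path tail)

  #vertices : ∀ {K} → Decomp K → ℕ
  #vertices (first _ _ _)          = 0
  #vertices (next D _ _ _ _ path) = #vertices D + #path path

  count-add : ∀ (x : V) (S : VSet) → S x ≡ false → count (add x S) ≡ suc (count S)
  count-add x S p = trans (count-cong pointwise) (count-toggle-on S x p)
    where
    pointwise : ∀ v → add x S v ≡ toggle S x v
    pointwise v with v ≟ x
    ... | yes refl rewrite p = refl
    ... | no _ = trans (Boolₚ.∨-identityʳ (S v)) (sym (Boolₚ.xor-identityʳ (S v)))

  not-K : ∀ {K U : VSet} {x : V} → Disjoint K U → K x ≡ false → U x ≡ false → (∀ {v} → rest K U v ≡ true → v ≡ x) →
    ∀ v → not (K v) ≡ add x U v
  not-K {K} {U} {x = x} disj p p′ only v with place K U v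
  ... | inK k rewrite k = sym (add-false x U (disj k) λ { refl → true≢false k p })
  ... | inU u rewrite u = cong not (Boolₚ.¬-not λ k → true≢false u (disj k))
  ... | inR r with only r
  ...   | refl rewrite p = sym (add-here x U)

  count-path : ∀ {K U g x} (path : Path K U g x) → Disjoint K U → count (not ∘ K) ≡ count U + #path path
  count-path {K} {U} {g} {x} (last p p′ _ _ _ _ _ only) disj =
    trans (count-cong (not-K {K} {U} disj p p′ only)) (trans (count-add x U p′) (+-comm 1 _))
  count-path {K} {U} {g} {x} (cons p p′ _ _ _ _ tail) disj =
    trans (count-path tail (disjoint-add {K} {U} disj p)) (trans (cong (_+ #path tail) (count-add x U p′)) (sym (+-suc _ _)))

  cross-both-out : ∀ (S : VSet) {u s v} → Link u s v → S u ≡ false → S v ≡ false → cross S s ≡ false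
  cross-both-out S (along refl refl)   p q rewrite p | q = refl
  cross-both-out S (against refl refl) p q rewrite p | q = refl

  incident : V → E → Bool
  incident x s = does (initial s ≟ x) xor does (terminal s ≟ x)

  incident-true : ∀ {x s} → At s x → incident x s ≡ true
  incident-true {x} {s} at with initial s ≟ x | terminal s ≟ x
  ... | yes p | yes q = ⊥-elim (proj₂ cubic s (trans p (sym q)))
  ... | yes _ | no _ = refl
  ... | no _ | yes _ = refl
  incident-true (inj₁ p) | no n | no _ = ⊥-elim (n p)
  incident-true (inj₂ q) | no _ | no n = ⊥-elim (n q)

  incident-star : ∀ {x e₁ e₂ e₃} → Star x e₁ e₂ e₃ → ∀ s →
    incident x s ≡ (does (s ≟ e₁) xor does (s ≟ e₂)) xor does (s ≟ e₃)
  incident-star {x} {e₁} {e₂} {e₃} st s with s ≟ e₁ | s ≟ e₂ | s ≟ e₃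
  ... | yes refl | yes q | _ = ⊥-elim (Star.e₁≢e₂ st q)
  ... | yes refl | no _ | yes q = ⊥-elim (Star.e₁≢e₃ st q)
  ... | no _ | yes refl | yes q = ⊥-elim (Star.e₂≢e₃ st q)
  ... | yes refl | no _ | no _ = incident-true (Star.at₁ st)
  ... | no _ | yes refl | no _ = incident-true (Star.at₂ st)
  ... | no _ | no _ | yes refl = incident-true (Star.at₃ st)
  ... | no n₁ | no n₂ | no n₃ with initial s ≟ x | terminal s ≟ x
  ...   | no _ | no _ = refl
  ...   | yes p | _ = ⊥-elim ([ n₁ , [ n₂ , n₃ ]′ ]′ (Star.only st (inj₁ p)))
  ...   | no _ | yes q = ⊥-elim ([ n₁ , [ n₂ , n₃ ]′ ]′ (Star.only st (inj₂ q)))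

  cross-add : ∀ {U : VSet} {x e₁ e₂ e₃} → U x ≡ false → Star x e₁ e₂ e₃ →
    cross (add x U) ≗ toggle (toggle (toggle (cross U) e₁) e₂) e₃
  cross-add {U} {x} {e₁} {e₂} {e₃} p st s = begin
    add x U (initial s) xor add x U (terminal s)
      ≡⟨ cong₂ _xor_ (add≡ (initial s)) (add≡ (terminal s)) ⟩
    (U (initial s) xor does (initial s ≟ x)) xor (U (terminal s) xor does (terminal s ≟ x))
      ≡⟨ xor-interchange (U (initial s)) (U (terminal s)) _ _ ⟩
    cross U s xor incident x s
      ≡⟨ cong (cross U s xor_) (incident-star st s) ⟩
    cross U s xor ((does (s ≟ e₁) xor does (s ≟ e₂)) xor does (s ≟ e₃))
      ≡⟨ Boolₚ.xor-assoc (cross U s) _ _ ⟨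
    (cross U s xor (does (s ≟ e₁) xor does (s ≟ e₂))) xor does (s ≟ e₃)
      ≡⟨ cong (_xor does (s ≟ e₃)) (Boolₚ.xor-assoc (cross U s) _ _) ⟨
    toggle (toggle (toggle (cross U) e₁) e₂) e₃ s ∎
    where
    open ≡-Reasoning
    add≡ : ∀ v → add x U v ≡ U v xor does (v ≟ x)
    add≡ v with v ≟ x
    ... | yes refl rewrite p = refl
    ... | no _ = trans (Boolₚ.∨-identityʳ (U v)) (sym (Boolₚ.xor-identityʳ (U v)))

  d-gain : ∀ {U : VSet} {x g o f} → U x ≡ false → Star x g o f → cross U g ≡ true → cross U o ≡ false → cross U f ≡ false →
    d (add x U) ≡ suc (d U)
  d-gain {U} {x} {g} {o} {f} p st cg co cf = trans (count-cong (cross-add {U} p st))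
    (trans (count-toggle-on t₂ f (trans (toggle-other t₁ (≢sym (Star.e₂≢e₃ st))) (trans (toggle-other (cross U) (≢sym (Star.e₁≢e₃ st))) cf)))
      (cong suc (trans (count-toggle-on t₁ o (trans (toggle-other (cross U) (≢sym (Star.e₁≢e₂ st))) co))
        (count-toggle-off (cross U) g cg))))
    where
    t₁ t₂ : E → Bool
    t₁ = toggle (cross U) g
    t₂ = toggle t₁ o
    ≢sym : ∀ {a b : E} → a ≢ b → b ≢ a
    ≢sym n e = n (sym e)

  d-loss : ∀ {U : VSet} {x g o f} → U x ≡ false → Star x g o f → cross U g ≡ true → cross U o ≡ false → cross U f ≡ true →
    suc (d (add x U)) ≡ d U
  d-loss {U} {x} {g} {o} {f} p st cg co cf = trans (cong suc (count-cong (cross-add {U} p st)))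
    (trans (count-toggle-off t₂ f (trans (toggle-other t₁ (≢sym (Star.e₂≢e₃ st))) (trans (toggle-other (cross U) (≢sym (Star.e₁≢e₃ st))) cf)))
      (trans (count-toggle-on t₁ o (trans (toggle-other (cross U) (≢sym (Star.e₁≢e₂ st))) co))
        (count-toggle-off (cross U) g cg)))
    where
    t₁ t₂ : E → Bool
    t₁ = toggle (cross U) g
    t₂ = toggle t₁ o
    ≢sym : ∀ {a b : E} → a ≢ b → b ≢ a
    ≢sym n e = n (sym e)

  d-not : ∀ (S : VSet) → d (not ∘ S) ≡ d S
  d-not S = count-cong (cross-not S)

  d-cong : ∀ {S T : VSet} → (∀ v → S v ≡ T v) → d S ≡ d T
  d-cong p = count-cong λ s → cong₂ _xor_ (p (initial s)) (p (terminal s))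

  -- Moving a vertex across trades one crossing edge for two, except for the last vertex, which
  -- trades two for one.
  d-path : ∀ {K U g x w} (path : Path K U g x) → Disjoint K U → Link w g x → U w ≡ true → d K + 2 ≡ d U + #path path
  d-path {K} {U} {g} {x} {w} (last {f = f} p p′ st lo Kk lf Uu only) disj gl Uw = begin
    d K + 2                ≡⟨ cong (_+ 2) (trans (sym (d-not K)) (d-cong (not-K {K} {U} disj p p′ only))) ⟩
    d (add x U) + 2        ≡⟨ +-suc (d (add x U)) 1 ⟩
    suc (d (add x U)) + 1  ≡⟨ cong (_+ 1) (d-loss {U} p′ st (cross-link U gl Uw p′) (cross-both-out U lo p′ (disj Kk))
                                (cross-link U (link-sym lf) Uu p′)) ⟩
    d U + 1                ∎
    where open ≡-Reasoning
  d-path {K} {U} {g} {x} {w} (cons {y = y} p p′ st lo Kk lf tail) disj gl Uw = begin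
    d K + 2                       ≡⟨ d-path tail (disjoint-add {K} {U} disj p) lf (add-here x U) ⟩
    d (add x U) + #path tail      ≡⟨ cong (_+ #path tail) (d-gain {U} p′ st (cross-link U gl Uw p′) (cross-both-out U lo p′ (disj Kk))
                                       (cross-both-out U lf p′ (proj₁ (add-out x U (head-∉U tail))))) ⟩
    suc (d U) + #path tail        ≡⟨ +-suc (d U) (#path tail) ⟨
    d U + suc (#path tail)        ∎
    where open ≡-Reasoning

  steps : ∀ {K} → Decomp K → ℕ
  steps D = singles D + paths D

  steps-next : ∀ {K L U w g x} (D : Decomp L) (L≡ : ∀ v → L v ≡ not (U v)) (disj : Disjoint K U)
    (gl : Link w g x) (Uw : U w ≡ true) (path : Path K U g x) → steps (next D L≡ disj gl Uw path) ≡ suc (steps D)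
  steps-next D L≡ disj gl Uw (last _ _ _ _ _ _ _ _) = refl
  steps-next D L≡ disj gl Uw (cons _ _ _ _ _ _ _)   = +-suc (singles D) (paths D)

  not-L : ∀ {L U : VSet} → (∀ v → L v ≡ not (U v)) → ∀ v → not (L v) ≡ U v
  not-L {L} {U} L≡ v = trans (cong not (L≡ v)) (Boolₚ.not-involutive (U v))

  first-is-single : ∀ {K : VSet} {x : V} → K x ≡ false → (∀ {v} → v ≢ x → K v ≡ true) → ∀ v → not (K v) ≡ single x v
  first-is-single {K} {x} p q v = go (v ≟ x)
    where
    go : Dec (v ≡ x) → not (K v) ≡ single x v
    go (yes refl) = trans (cong not p) (sym (single-here x))
    go (no n)     = trans (cong not (q n)) (sym (single-false x n))

  count-decomp : ∀ {K} (D : Decomp K) → count (not ∘ K) ≡ suc (#vertices D)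
  count-decomp {K} (first x p q) = trans (count-cong (first-is-single {K} p q)) (trans (∑-cong indicator) (ℕΣ.sum-single x λ _ → 1))
    where
    indicator : ∀ v → ⟦ single x v ⟧ ≡ pickℕ (does (v ≟ x)) 1
    indicator v = refl
  count-decomp (next {K} {L} {U} D L≡ disj gl Uw path) = trans (count-path path disj)
    (cong (_+ #path path) (trans (sym (count-cong (not-L {L} {U} L≡))) (count-decomp D)))

  -- The cut starts at 3 and changes by the length of each path minus 2. It is 3 again at the last
  -- vertex, so paths have two vertices on average.
  d-decomp : ∀ {K} (D : Decomp K) → d K + (steps D + steps D) ≡ 3 + #vertices D
  d-decomp {K} (first x p q) = trans (+-identityʳ _) (trans (sym (d-not K)) (trans (d-cong (first-is-single {K} p q)) (proj₁ cubic x)))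
  d-decomp {K} (next {L = L} {U} D L≡ disj gl Uw path) rewrite steps-next D L≡ disj gl Uw path = begin
    d K + (suc τ + suc τ)            ≡⟨ solve-ℕ 2 (λ k t → k :+ ((con 1 :+ t) :+ (con 1 :+ t)) := (k :+ con 2) :+ (t :+ t)) refl (d K) τ ⟩
    (d K + 2) + (τ + τ)              ≡⟨ cong (_+ (τ + τ)) (d-path path disj gl Uw) ⟩
    (d U + #path path) + (τ + τ)     ≡⟨ solve-ℕ 3 (λ k p t → (k :+ p) :+ (t :+ t) := (k :+ (t :+ t)) :+ p) refl (d U) (#path path) τ ⟩
    (d U + (τ + τ)) + #path path     ≡⟨ cong (λ n → n + (τ + τ) + #path path) (trans (sym (d-not U)) (sym (d-cong L≡))) ⟩
    (d L + (τ + τ)) + #path path     ≡⟨ cong (_+ #path path) (d-decomp D) ⟩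
    3 + #vertices D + #path path     ∎
    where
    open ≡-Reasoning
    open +-*-Solver renaming (solve to solve-ℕ)
    τ : ℕ
    τ = steps D

  -- The two bounds exchange their roles when the head is dropped, so they are proved together.
  path-chosen : ∀ {K U g x} (path : Path K U g x) →
    #path path ≤ #chosen false path + #chosen false path + 2 × #path path ≤ #chosen true path + #chosen true path + 1
  path-chosen (last _ _ _ _ _ _ _ _) = s≤s z≤n , s≤s z≤n
  path-chosen (cons _ _ _ _ _ _ tail) with path-chosen tail
  ... | p , q = ≤-trans (s≤s q) (≤-reflexive (sym (+-suc (t + t) 1)))
              , ≤-trans (s≤s p) (≤-reflexive (solve-ℕ 1 (λ f → con 1 :+ (f :+ f :+ con 2) := (con 1 :+ f) :+ (con 1 :+ f) :+ con 1) refl f))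
    where
    open +-*-Solver renaming (solve to solve-ℕ)
    t f : ℕ
    t = #chosen true tail
    f = #chosen false tail

  vertices-≤ : ∀ {K} (D : Decomp K) → #vertices D ≤ singles D + (leaves D + leaves D) + (paths D + paths D)
  vertices-≤ (first _ _ _) = z≤n
  vertices-≤ (next D _ _ _ _ (last _ _ _ _ _ _ _ _)) = ≤-trans (+-monoˡ-≤ 1 (vertices-≤ D))
    (≤-reflexive (solve-ℕ 3 (λ s l p → (s :+ (l :+ l) :+ (p :+ p)) :+ con 1 :=
      (con 1 :+ s) :+ ((l :+ con 0) :+ (l :+ con 0)) :+ (p :+ p)) refl (singles D) (leaves D) (paths D)))
    where open +-*-Solver renaming (solve to solve-ℕ)
  vertices-≤ (next D _ _ _ _ path@(cons _ _ _ _ _ _ tail)) = ≤-trans (+-mono-≤ (vertices-≤ D) (proj₁ (path-chosen path)))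
    (≤-reflexive (solve-ℕ 4 (λ s l p c → (s :+ (l :+ l) :+ (p :+ p)) :+ (c :+ c :+ con 2) :=
      s :+ ((l :+ c) :+ (l :+ c)) :+ ((con 1 :+ p) :+ (con 1 :+ p))) refl (singles D) (leaves D) (paths D) (#chosen false path)))
    where open +-*-Solver renaming (solve to solve-ℕ)

  count-complement : ∀ {n} (p : Fin n → Bool) → count (not ∘ p) + count p ≡ n
  count-complement {n} p = trans (sym (∑-+ (⟦_⟧ ∘ not ∘ p) (⟦_⟧ ∘ p)))
    (trans (∑-cong λ i → one (p i)) (trans (∑-const n 1) (*-identityʳ n)))
    where
    one : ∀ c → ⟦ not c ⟧ + ⟦ c ⟧ ≡ 1
    one true  = refl
    one false = refl

  module Top {K : VSet} {r : V} (Kr : K r ≡ true) (only : ∀ {v : V} → K v ≡ true → v ≡ r) (D : Decomp K) where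

    K≡ : ∀ v → K v ≡ single r v
    K≡ v = go (v ≟ r)
      where
      go : Dec (v ≡ r) → K v ≡ single r v
      go (yes refl) = trans Kr (sym (single-here r))
      go (no n)     = trans (Boolₚ.¬-not λ k → n (only k)) (sym (single-false r n))

    dK : d K ≡ 3
    dK = trans (d-cong K≡) (proj₁ cubic r)

    #V≡ : #V ≡ 2 + #vertices D
    #V≡ = trans (sym (count-complement K)) (trans (cong₂ _+_ (count-decomp D)
      (trans (count-cong K≡) (ℕΣ.sum-single r λ _ → 1))) (+-comm _ 1))

    τ : ℕ
    τ = steps D

    vertices≡ : #vertices D ≡ τ + τ
    vertices≡ = +-cancelˡ-≡ 3 _ _ (trans (sym (d-decomp D)) (cong (_+ (τ + τ)) dK))

    #E≡ : #E ≡ 3 + (τ + τ + τ)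
    #E≡ = *-cancelʳ-≡ #E _ 2 (trans (sym (handshake (proj₂ cubic))) (trans (∑-cong (proj₁ cubic)) (trans (∑-const #V 3)
      (trans (cong (_* 3) (trans #V≡ (cong (2 +_) vertices≡)))
        (solve-ℕ 1 (λ t → (con 2 :+ (t :+ t)) :* con 3 := (con 3 :+ (t :+ t :+ t)) :* con 2) refl τ)))))
      where open +-*-Solver renaming (solve to solve-ℕ)

    ℓ≡ : #E ∸ #V ≡ suc τ
    ℓ≡ = trans (cong₂ _∸_ #E≡ (trans #V≡ (cong (2 +_) vertices≡)))
      (trans (cong (_∸ (τ + τ)) (sym (+-suc (τ + τ) τ))) (m+n∸m≡n (τ + τ) (suc τ)))

    -- With an average length of two, single vertices are balanced by interior vertices of longer
    -- paths, and `vertices-≤` bounds those by twice the number of chosen ones.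
    singles-≤ : singles D ≤ leaves D + leaves D
    singles-≤ = +-cancelˡ-≤ (singles D + (paths D + paths D)) _ _ (≤-trans (≤-reflexive (trans
        (solve-ℕ 2 (λ s p → s :+ (p :+ p) :+ s := (s :+ p) :+ (s :+ p)) refl (singles D) (paths D)) (sym vertices≡)))
      (≤-trans (vertices-≤ D) (≤-reflexive
        (solve-ℕ 3 (λ s l p → s :+ l :+ (p :+ p) := s :+ (p :+ p) :+ l) refl (singles D) (leaves D + leaves D) (paths D)))))
      where open +-*-Solver renaming (solve to solve-ℕ)

  -- The last vertex

  module AtRoot {K : VSet} {r : V} (Kr : K r ≡ true) (only : ∀ {v : V} → K v ≡ true → v ≡ r)
                {e₁ e₂ e₃ : E} (st : Star r e₁ e₂ e₃) where

    y₁ y₂ y₃ : V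
    y₁ = proj₁ (at-other (Star.at₁ st))
    y₂ = proj₁ (at-other (Star.at₂ st))
    y₃ = proj₁ (at-other (Star.at₃ st))

    l₁ : Link r e₁ y₁
    l₁ = proj₂ (at-other (Star.at₁ st))
    l₂ : Link r e₂ y₂
    l₂ = proj₂ (at-other (Star.at₂ st))
    l₃ : Link r e₃ y₃
    l₃ = proj₂ (at-other (Star.at₃ st))

    start : Fin 3 → Fin 3 → E → Fin 3
    start a c s = if does (s ≟ e₁) then a else if does (s ≟ e₂) then c else zero

    start₁ : ∀ a c → start a c e₁ ≡ a
    start₁ a c with e₁ ≟ e₁
    ... | yes _ = refl
    ... | no n  = ⊥-elim (n refl)

    start₂ : ∀ a c → start a c e₂ ≡ c
    start₂ a c with e₂ ≟ e₁ | e₂ ≟ e₂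
    ... | yes p | _     = ⊥-elim (Star.e₁≢e₂ st (sym p))
    ... | no _  | yes _ = refl
    ... | no _  | no n  = ⊥-elim (n refl)

    -- The values at `e₁` and `e₂` are free, and that at `e₃` follows from the boundary at `r`.
    sol : Fin 3 → Fin 3 → E → Fin 3
    sol a c = proj₁ (solve-at l₃ (link≢ l₃) (start a c) (b₃ r))

    sol-bd : ∀ a c → bd (sol a c) r ≡ b₃ r
    sol-bd a c = proj₁ (proj₂ (solve-at l₃ (link≢ l₃) (start a c) (b₃ r)))

    sol₁ : ∀ a c → sol a c e₁ ≡ a
    sol₁ a c = trans (proj₂ (proj₂ (solve-at l₃ (link≢ l₃) (start a c) (b₃ r))) e₁ (Star.e₁≢e₃ st)) (start₁ a c)

    sol₂ : ∀ a c → sol a c e₂ ≡ c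
    sol₂ a c = trans (proj₂ (proj₂ (solve-at l₃ (link≢ l₃) (start a c) (b₃ r))) e₂ (Star.e₂≢e₃ st)) (start₂ a c)

    separating : ∀ a → Separating (λ c → sol a c e₃)
    separating a {c} {c′} n eq = n (trans (sym (sol₂ a c)) (trans
      (bd-unique l₂ (link≢ l₂) {sol a c} {sol a c′} (trans (sol-bd a c) (sym (sol-bd a c′))) agree) (sol₂ a c′)))
      where
      agree : ∀ s → At s r → s ≢ e₂ → sol a c s ≡ sol a c′ s
      agree s at s≢ with Star.only st at
      ... | inj₁ refl        = trans (sol₁ a c) (sym (sol₁ a c′))
      ... | inj₂ (inj₁ p)    = ⊥-elim (s≢ p)
      ... | inj₂ (inj₂ refl) = eq

    nowhere-zero : ∀ a → a ≢ zero → ∃[ c ] (∀ {s} → At s r → Live (sol a c) s)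
    nowhere-zero a a≢0 with nonzero-one (separating a)
    ... | c , c≢0 , n = c , live
      where
      live : ∀ {s} → At s r → Live (sol a c) s
      live at z with Star.only st at
      ... | inj₁ refl        = a≢0 (trans (sym (sol₁ a c)) z)
      ... | inj₂ (inj₁ refl) = c≢0 (trans (sym (sol₂ a c)) z)
      ... | inj₂ (inj₂ refl) = n z

    at-r : ∀ {u s v} → Link u s v → K u ≡ true → At s r
    at-r l k = subst (At _) (only k) (link-atˡ l)

    sol-balanced : ∀ a c → Balanced K (sol a c)
    sol-balanced a c k = subst (λ v → bd (sol a c) v ≡ b₃ v) (sym (only k)) (sol-bd a c)

    trivial : ∀ {D : E → Set} {u v} → K u ≡ true → K v ≡ true → u ~[ K , D ] v
    trivial {D} {u} p q = subst (λ z → u ~[ K , D ] z) (trans (only p) (sym (only q))) ε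

    alive-sol : ∀ a c → (∀ {s} → At s r → Live (sol a c) s) → Alive K (sol a c)
    alive-sol a c live = record
      { balanced = sol-balanced a c ; alive = λ l k _ → live (at-r l k) ; connected = trivial }

    relaxed-sol : ∀ a c {good} → (∀ {s} → At s r → Live (sol a c) s) → Relaxed K (sol a c) [] good
    relaxed-sol a c live = record
      { balanced = sol-balanced a c ; alive = λ l k _ → inj₁ (live (at-r l k)) ; connected = trivial
      ; unique = [] ; live = [] ; inside = [] }

    -- Each nonzero value at `e₁` extends to an assignment that is nonzero at all edges of `r`. This
    -- doubling is the `suc` in the exponents below.
    two-starts : ∀ {N} → (∀ a c → (∀ {s} → At s r → Live (sol a c) s) → Count N (Completes K (sol a c))) →
      Count (N + N) (NowhereZero G b)
    two-starts cnt with nowhere-zero 1F (λ ()) | nowhere-zero 2F (λ ())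
    ... | c , live | c′ , live′ = count-+ {P = Completes K (sol 1F c)} {Q = Completes K (sol 2F c′)} {R = NowhereZero G b}
          (cnt 1F c live) (cnt 2F c′ live′) apart proj₁ proj₁
      where
      value : ∀ {a c k} → Completes K (sol a c) k → mod3 (k e₁) ≡ a
      value {a} {c} (_ , m) = trans (m (r , Star.at₁ st , Kr)) (sol₁ a c)
      apart : ∀ {k k′} → Completes K (sol 1F c) k → Completes K (sol 2F c′) k′ → ¬ k ≗ k′
      apart p q eq with () ← trans (sym (value p)) (trans (cong mod3 (eq e₁)) (value q))

    star-sum : ∀ P → ∑ (λ s → pickℕ (does (s ≟ e₁)) P + (pickℕ (does (s ≟ e₂)) P + pickℕ (does (s ≟ e₃)) P)) ≡ P + (P + P)
    star-sum P = trans (∑-+ (λ s → pickℕ (does (s ≟ e₁)) P) (λ s → pickℕ (does (s ≟ e₂)) P + pickℕ (does (s ≟ e₃)) P))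
      (cong₂ _+_ (ℕΣ.sum-single e₁ λ _ → P) (trans (∑-+ (λ s → pickℕ (does (s ≟ e₂)) P) (λ s → pickℕ (does (s ≟ e₃)) P))
        (cong₂ _+_ (ℕΣ.sum-single e₂ λ _ → P) (ℕΣ.sum-single e₃ λ _ → P))))

    Ψ-≤ : ∀ {w P} → (∀ s → w s ≤ P) → Ψ K w ≤ P + (P + P)
    Ψ-≤ {w} {P} w≤ = ≤-trans (∑-mono pointwise) (≤-reflexive (star-sum P))
      where
      pointwise : ∀ s → pickℕ (cross K s) (w s) ≤ pickℕ (does (s ≟ e₁)) P + (pickℕ (does (s ≟ e₂)) P + pickℕ (does (s ≟ e₃)) P)
      pointwise s with cross K s in c
      ... | false = z≤n
      ... | true with link-cross K c
      ...   | u , v , l , Ku , _ with Star.only st (at-r l Ku) | s ≟ e₁ | s ≟ e₂ | s ≟ e₃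
      ...     | _ | yes _ | _ | _ = ≤-trans (w≤ s) (m≤m+n P _)
      ...     | _ | no _ | yes _ | _ = ≤-trans (w≤ s) (m≤m+n P _)
      ...     | _ | no _ | no _ | yes _ = w≤ s
      ...     | inj₁ p | no n | _ | _ = ⊥-elim (n p)
      ...     | inj₂ (inj₁ p) | _ | no n | _ = ⊥-elim (n p)
      ...     | inj₂ (inj₂ p) | _ | _ | no n = ⊥-elim (n p)

    neighbours-≤3 : ∀ {p : VSet} → (∀ {v} → p v ≡ true → Neighbour K v) → count p ≤ 3
    neighbours-≤3 {p} nb = ≤-trans (∑-mono pointwise) (≤-reflexive
      (trans (∑-+ (λ v → pickℕ (does (v ≟ y₁)) 1) (λ v → pickℕ (does (v ≟ y₂)) 1 + pickℕ (does (v ≟ y₃)) 1))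
      (cong₂ _+_ (ℕΣ.sum-single y₁ λ _ → 1) (trans (∑-+ (λ v → pickℕ (does (v ≟ y₂)) 1) (λ v → pickℕ (does (v ≟ y₃)) 1))
        (cong₂ _+_ (ℕΣ.sum-single y₂ λ _ → 1) (ℕΣ.sum-single y₃ λ _ → 1))))))
      where
      near : ∀ {v} → Neighbour K v → v ≡ y₁ ⊎ v ≡ y₂ ⊎ v ≡ y₃
      near (o , k , l , Kk) with only Kk
      ... | refl with Star.only st (link-atʳ l)
      ...   | inj₁ refl        = inj₁ (link-target (link-sym l) l₁)
      ...   | inj₂ (inj₁ refl) = inj₂ (inj₁ (link-target (link-sym l) l₂))
      ...   | inj₂ (inj₂ refl) = inj₂ (inj₂ (link-target (link-sym l) l₃))
      pointwise : ∀ v → ⟦ p v ⟧ ≤ pickℕ (does (v ≟ y₁)) 1 + (pickℕ (does (v ≟ y₂)) 1 + pickℕ (does (v ≟ y₃)) 1)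
      pointwise v with p v in pv
      ... | false = z≤n
      ... | true with near (nb pv) | v ≟ y₁ | v ≟ y₂ | v ≟ y₃
      ...     | _ | yes _ | _ | _ = s≤s z≤n
      ...     | _ | no _ | yes _ | _ = s≤s z≤n
      ...     | _ | no _ | no _ | yes _ = ≤-refl
      ...     | inj₁ q | no n | _ | _ = ⊥-elim (n q)
      ...     | inj₂ (inj₁ q) | _ | no n | _ = ⊥-elim (n q)
      ...     | inj₂ (inj₂ q) | _ | _ | no n = ⊥-elim (n q)

    module _ (D : Decomp K) where
      open Top Kr only D
      private
        module B = Bounds (bounds D)
        module L = LeafBounds (leaf-bounds D)

      count-tokens : Count (2 ^ suc B.P) (NowhereZero G b)
      count-tokens = subst (λ n → Count n (NowhereZero G b)) (sym (doubling B.P))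
        (two-starts λ a c live → B.onAlive (alive-sol a c live))

      count-leaves : Count (2 ^ suc L.exponent) (NowhereZero G b)
      count-leaves = subst (λ n → Count n (NowhereZero G b)) (sym (doubling L.exponent))
        (two-starts λ a c live → L.onRelaxed (relaxed-sol a c live))

      bound : ∀ N → B.P ≤ N → L.exponent ≤ N → #E ∸ #V ≤ 9 * (suc N * suc N)
      bound N P≤ E≤ = begin
        #E ∸ #V                      ≡⟨ ℓ≡ ⟩
        -- `r` has three neighbours, so at most `2 * N + 3` vertices are chosen and at most `q`
        -- paths are single vertices. It has three edges, so `Ψ` is at most `3 * N`.
        suc (singles D + paths D)    ≤⟨ s≤s (+-mono-≤ singles-≤N (≤-trans B.potential paths-≤N)) ⟩
        suc (q + (N + (N + (N + N) + (q + q) * N)))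
          ≡⟨ solve-ℕ 1 (λ n → con 1 :+ ((con 4 :* n :+ con 6) :+ (n :+ (n :+ (n :+ n) :+ ((con 4 :* n :+ con 6) :+ (con 4 :* n :+ con 6)) :* n)))
               := con 8 :* (n :* n) :+ con 18 :* n :+ con 7 :+ con 2 :* n) refl N ⟩
        -- Replacing `2 * N` by `N * N + 2` completes the square; this fixes the constant 9.
        8 * (N * N) + 18 * N + 7 + 2 * N          ≤⟨ +-monoʳ-≤ (8 * (N * N) + 18 * N + 7) (square N) ⟩
        8 * (N * N) + 18 * N + 7 + (N * N + 2)
          ≡⟨ solve-ℕ 1 (λ n → con 8 :* (n :* n) :+ con 18 :* n :+ con 7 :+ (n :* n :+ con 2)
               := con 9 :* ((con 1 :+ n) :* (con 1 :+ n))) refl N ⟩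
        9 * (suc N * suc N)          ∎
        where
        open ≤-Reasoning
        open +-*-Solver renaming (solve to solve-ℕ)
        q : ℕ
        q = 4 * N + 6
        leaves-≤ : leaves D ≤ N + N + 3
        leaves-≤ = ≤-trans L.bound (+-mono-≤ (+-mono-≤ E≤ E≤) (neighbours-≤3 L.good-K))
        singles-≤N : singles D ≤ q
        singles-≤N = ≤-trans singles-≤ (≤-trans (+-mono-≤ leaves-≤ leaves-≤)
          (≤-reflexive (solve-ℕ 1 (λ n → (n :+ n :+ con 3) :+ (n :+ n :+ con 3) := con 4 :* n :+ con 6) refl N)))
        paths-≤N : B.P + (Ψ K B.w + (singles D + singles D) * B.P) ≤ N + (N + (N + N) + (q + q) * N)
        paths-≤N = +-mono-≤ P≤ (+-mono-≤ (≤-trans (Ψ-≤ B.w≤P) (+-mono-≤ P≤ (+-mono-≤ P≤ P≤)))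
          (*-mono-≤ (+-mono-≤ singles-≤N singles-≤N) P≤))
        square : ∀ n → 2 * n ≤ n * n + 2
        square 0 = z≤n
        square 1 = s≤s (s≤s z≤n)
        square (suc (suc n)) = ≤-trans (*-monoˡ-≤ (suc (suc n)) (s≤s (s≤s (z≤n {n})))) (m≤m+n _ 2)

      cubic-bound : ∃[ M ] (#E ∸ #V ≤ 9 * (M * M) × Count (2 ^ M) (NowhereZero G b))
      cubic-bound with ≤-total B.P L.exponent
      ... | inj₁ P≤E = suc L.exponent , bound L.exponent P≤E ≤-refl , count-leaves
      ... | inj₂ E≤P = suc B.P , bound B.P ≤-refl E≤P , count-tokens

cubic-good : CubicGood
cubic-good G conn3 cubic two _ b total with CubicGraph.decompose G conn3 cubic two
... | K , r , Kr , only , D with CubicGraph.star-of G conn3 cubic r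
... | _ , _ , _ , st = Choices.AtRoot.cubic-bound G conn3 cubic two b total {K} Kr only st D

-- From prescribed boundaries to flows that avoid f

module Flows (G : OrientedGraph) where
  open OrientedGraph G
  open Boundary ℤ₆ G
  open AbelianGroup ℤ₆ using (inverseˡ; comm; assoc; identityʳ; identityˡ)
  open AbelianGroupProperties ℤ₆ using (∙-cancelʳ; //-rightDividesˡ; ε⁻¹≈ε)

  sum-filter : ∀ {n} (φ : E → Fin 6) (end : E → V) (v : V) (t : Fin n → E) →
    foldr _+₆_ zero (map φ (filter (λ e → end e ≟ v) (List.tabulate t))) ≡ sum (λ i → pick (does (end (t i) ≟ v)) (φ (t i)))
  sum-filter {zero}  φ end v t = refl
  sum-filter {suc n} φ end v t with end (t zero) ≟ v
  ... | yes _ = cong (φ (t zero) +₆_) (sum-filter φ end v (t ∘ suc))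
  ... | no _  = trans (sum-filter φ end v (t ∘ suc)) (sym (identityˡ _))

  flow : ∀ {φ} → (∀ v → bd φ v ≡ zero) → IsFlow ℤ₆ G φ
  flow {φ} p v = trans (sum-filter φ initial v id) (trans (trans (sym (//-rightDividesˡ Σi Σo)) (trans (cong (_+₆ Σi) diff) (identityˡ Σi)))
    (sym (sum-filter φ terminal v id)))
    where
    Σo Σi : Fin 6
    Σo = sum (out φ v)
    Σi = sum (into φ v)
    diff : Σo +₆ (-₆ Σi) ≡ zero
    diff = trans (trans (cong (Σo +₆_) (sym (sum-⁻¹ (into φ v)))) (sym (∑-distrib-+ (out φ v) (λ e → -₆ into φ v e)))) (p v)

  module _ (f : E → Fin 6) where

    b : V → Fin 6
    b v = -₆ bd f v

    b-total : sum b ≡ zero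
    b-total = trans (sum-⁻¹ (bd f)) (trans (cong -₆_ (bd-total f)) ε⁻¹≈ε)

    shift : (E → Fin 6) → E → Fin 6
    shift k e = k e +₆ f e

    shift-count : ∀ {N} → Count N (NowhereZero G b) → Count N (λ φ → IsFlow ℤ₆ G φ × (∀ e → φ e ≢ f e))
    shift-count (Φ , inj , nz) = (λ i → shift (Φ i)) , (λ eq → inj λ e → ∙-cancelʳ (f e) _ _ (eq e)) , λ i →
        flow (λ v → trans (bd-∙ (Φ i) f v) (trans (cong (_+₆ bd f v) (proj₁ (nz i) v)) (inverseˡ (bd f v))))
      , λ e eq → proj₂ (nz i) e (∙-cancelʳ (f e) _ _ (trans eq (sym (identityˡ (f e)))))

-- Comparison with the real bound

*-^-distrib : ∀ a b n → (a * b) ^ n ≡ a ^ n * b ^ n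
*-^-distrib a b zero    = refl
*-^-distrib a b (suc n) = trans (cong (a * b *_) (*-^-distrib a b n)) ([m*n]*[o*p]≡[m*o]*[n*p] a b (a ^ n) (b ^ n))

-- If ℓ ≤ 9M² and 8 ≤ ℓ, then √ℓ / log₂ ℓ ≤ 3M / 3.
root-log-bound : ∀ {ℓ M} → 8 ≤ ℓ → ℓ ≤ 9 * (M * M) → (2^ (√ ℓ ÷ log₂ ℓ)) ≤ᵣ fromℕ (2 ^ M)
root-log-bound {ℓ} {M} 8≤ℓ ℓ≤ (x / y) (inj₁ x<y) = ≤-trans x<y (m≤n*m y (2 ^ M) {{m^n≢0 2 M}})
root-log-bound {ℓ} {M} 8≤ℓ ℓ≤ (x / y) (inj₂ ((p / q) , ((u / v) , above , below) , x^q<)) =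
  ≰⇒> λ 2^My≤x → 1+n≰n (≤-trans (≤-trans x^q< 2^p≤) (^-monoˡ-≤ q 2^My≤x))
  where
  open ≤-Reasoning
  -- `u / v` lies above `log₂ ℓ`, hence above 3, because `ℓ` is at least 8.
  3v<u : 3 * v < u
  3v<u = ≰⇒> λ u≤3v → 1+n≰n (≤-trans above (begin
    2 ^ u          ≤⟨ ^-monoʳ-≤ 2 u≤3v ⟩
    2 ^ (3 * v)    ≡⟨ ^-*-assoc 2 3 v ⟨
    8 ^ v          ≤⟨ ^-monoˡ-≤ v 8≤ℓ ⟩
    ℓ ^ v          ∎))
  sq : ∀ n → n ^ 2 ≡ n * n
  sq n = cong (n *_) (*-identityʳ n)
  -- The product of `p / q` and `u / v` lies below `√ ℓ`, hence below `3 * M`.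
  pu<3Mqv : p * u < 3 * M * (q * v)
  pu<3Mqv = ≰⇒> λ le → 1+n≰n (≤-trans below (begin
    ℓ * (q * v) ^ 2                     ≤⟨ *-monoˡ-≤ ((q * v) ^ 2) ℓ≤ ⟩
    9 * (M * M) * (q * v) ^ 2           ≡⟨ cong (9 * (M * M) *_) (sq (q * v)) ⟩
    9 * (M * M) * (q * v * (q * v))     ≡⟨ solve-ℕ 2 (λ m z → con 9 :* (m :* m) :* (z :* z) := (con 3 :* m :* z) :* (con 3 :* m :* z)) refl M (q * v) ⟩
    3 * M * (q * v) * (3 * M * (q * v)) ≤⟨ *-mono-≤ le le ⟩
    p * u * (p * u)                     ≡⟨ sq (p * u) ⟨
    (p * u) ^ 2                         ∎))
    where open +-*-Solver renaming (solve to solve-ℕ)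
  p≤Mq : p ≤ M * q
  p≤Mq = ≮⇒≥ λ Mq<p → 1+n≰n (≤-trans pu<3Mqv (begin
    3 * M * (q * v)    ≡⟨ solve-ℕ 3 (λ m q v → con 3 :* m :* (q :* v) := m :* q :* (con 3 :* v)) refl M q v ⟩
    M * q * (3 * v)    ≤⟨ *-mono-≤ (<⇒≤ Mq<p) (<⇒≤ 3v<u) ⟩
    p * u              ∎))
    where open +-*-Solver renaming (solve to solve-ℕ)
  2^p≤ : 2 ^ p * y ^ q ≤ (2 ^ M * y) ^ q
  2^p≤ = begin
    2 ^ p * y ^ q          ≤⟨ *-monoˡ-≤ (y ^ q) (^-monoʳ-≤ 2 p≤Mq) ⟩
    2 ^ (M * q) * y ^ q    ≡⟨ cong (_* y ^ q) (^-*-assoc 2 M q) ⟨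
    (2 ^ M) ^ q * y ^ q    ≡⟨ *-^-distrib (2 ^ M) y q ⟨
    (2 ^ M * y) ^ q        ∎

theorem1p11 : (G : OrientedGraph) → let open OrientedGraph G in
    EdgeConnected 3 →
    let ℓ = #E ∸ #V in
    11 ≤ ℓ →
    (f : E → Fin 6) →
    AtLeast (2^ (√ ℓ ÷ log₂ ℓ))
    (λ (φ : E → Fin 6) → IsFlow ℤ₆ G φ × (∀ e → φ e ≢ f e))
theorem1p11 G connected big f =
  -- The excess 2 |E| - 3 |V| is at most 2 |E|, so this is enough fuel.
  finish (reduce cubic-good (#E * 2) G (edgeConnected⇒conn3 connected) (proj₁ connected) big (m≤m+n _ _)
    (Flows.b G f) (Flows.b-total G f))
  where
  open OrientedGraph G
  open Cuts G using (edgeConnected⇒conn3)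
  finish : ∃[ M ] (#E ∸ #V ≤ 9 * (M * M) × Count (2 ^ M) (NowhereZero G (Flows.b G f))) →
    AtLeast (2^ (√ (#E ∸ #V) ÷ log₂ (#E ∸ #V))) (λ (φ : E → Fin 6) → IsFlow ℤ₆ G φ × (∀ e → φ e ≢ f e))
  finish (M , bound , count) = 2 ^ M , root-log-bound {M = M} (≤-trans (m≤m+n 8 3) big) bound , Flows.shift-count G f count
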